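{- Let $G$ be a finite simple graph of order $n$ with maximum degree $\Delta$. If $G$ is edge-$\Delta$-critical and $\Delta \geq \frac{2n}{3}+12$, then $G$ is Hamiltonian.
   Context: All graphs are finite and simple (no loops or parallel edges). $\chi'(G)$ denotes the chromatic index of $G$ (the least number of colors in a proper edge coloring). A graph $G$ with maximum degree $\Delta$ is called edge-$\Delta$-critical if $\chi'(G)=\Delta+1$ and $\chi'(H)\le \Delta$ for every proper subgraph $H$ of $G$. -}

module Defs where

open import Data.Nat using (ℕ; zero; suc; _+_; _*_; _≤_; _<_)
open import Data.Bool using (Bool; true; false; T; if_then_else_)
open import Data.Fin using (Fin; zero; suc; toℕ)
open import Data.Product using (Σ; ∃; _×_; _,_)
open import Relation.Nullary using (¬_)
open import Relation.Binary.PropositionalEquality using (_≡_; _≢_)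
open import Function.Bundles using (_↔_; Inverse)
open import Data.Sum using (_⊎_)

record Graph (n : ℕ) : Set where
  field
    adj   : Fin n → Fin n → Bool
    sym   : ∀ u v → adj u v ≡ adj v u
    irrefl : ∀ v → adj v v ≡ false
open Graph public

countB : ∀ {n} → (Fin n → Bool) → ℕ
countB {zero} f = 0
countB {suc n} f = (if f zero then 1 else 0) + countB (λ i → f (suc i))

degree : ∀ {n} → Graph n → Fin n → ℕ
degree G v = countB (adj G v)

IsMaxDegree : ∀ {n} → Graph n → ℕ → Set
IsMaxDegree {n} G Δ = (∀ v → degree G v ≤ Δ) × (Σ (Fin n) λ v → degree G v ≡ Δ)

record Subgraph {n : ℕ} (G : Graph n) : Set where
  field
    vert  : Fin n → Bool
    edge  : Fin n → Fin n → Bool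
    esym  : ∀ u v → edge u v ≡ edge v u
    e⊆G   : ∀ u v → T (edge u v) → T (adj G u v)
    e⊆V   : ∀ u v → T (edge u v) → T (vert u)
open Subgraph public

Proper : ∀ {n} {G : Graph n} → Subgraph G → Set
Proper {n} {G} H =
  (Σ (Fin n) λ v → vert H v ≡ false)
  ⊎ (Σ (Fin n) λ u → Σ (Fin n) λ v → T (adj G u v) × edge H u v ≡ false)

EdgeColouring : ∀ {n} → (Fin n → Fin n → Bool) → ℕ → Set
EdgeColouring {n} E k =
  Σ ((u v : Fin n) → T (E u v) → Fin k) λ c →
    (∀ u v (e : T (E u v)) (e' : T (E v u)) → c u v e ≡ c v u e')
    × (∀ u v w (e : T (E u v)) (e' : T (E u w)) → v ≢ w → c u v e ≢ c u w e')

ColourableWith : ∀ {n} → (Fin n → Fin n → Bool) → ℕ → Set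
ColourableWith E k = EdgeColouring E k

ChromaticIndexIs : ∀ {n} → (Fin n → Fin n → Bool) → ℕ → Set
ChromaticIndexIs E k = ColourableWith E k × (∀ j → j < k → ¬ ColourableWith E j)

EdgeCritical : ∀ {n} → Graph n → ℕ → Set
EdgeCritical G Δ =
  IsMaxDegree G Δ
  × ChromaticIndexIs (adj G) (suc Δ)
  × (∀ (H : Subgraph G) → Proper H → ColourableWith (edge H) Δ)

Hamiltonian : ∀ {n} → Graph n → Set
Hamiltonian {n} G =
  3 ≤ n × Σ (Fin n ↔ Fin n) λ σ →
    ∀ (i j : Fin n) →
      (toℕ j ≡ suc (toℕ i) ⊎ (suc (toℕ i) ≡ n × toℕ j ≡ 0)) →
      T (adj G (Inverse.to σ i) (Inverse.to σ j))

{-# OPTIONS --safe #-}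
module Submission where

-- Write k for Δ and call a vertex small if its degree is less than k / 2. Let A be a set of vertices of low degree
-- and, for a vertex z, let m z be k minus the number of neighbours of z outside A. Kempe changes in the
-- k-colourings of G − xy, x ∈ A, show that the average of m z over the neighbours z of x is at most
-- (deg x + 4c) / 2, where c is 0 or 2, so the sum of 1 / m z over these neighbours is at least
-- 2 deg x / (deg x + 4c). Double counting these weights over the edges at A has two consequences.
-- For sets A of small vertices it gives |N(P)| ≥ 2|P| for P ⊆ A, hence by Hall's theorem two private neighbours
-- of each small vertex. For A the set of vertices of degree at most h, with k ≤ 2h < n, it shows that
-- |A| < h or that more than h vertices have degree at least n − h (Chvátal's condition). Consequently the
-- Bondy–Chvátal closure turns the vertices that are not small into a clique, and there a Hamiltonian cycle
-- visits each small vertex between its two private neighbours.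

open import Defs
open import Data.Nat using (ℕ; zero; suc; _+_; _*_; _∸_; _≤_; _<_; _≥_; z≤n; s≤s; _≤?_; _/_; _!; NonZero; >-nonZero)
open import Data.Nat.Properties using (≤-refl; ≤-trans; ≤-reflexive; ≤-antisym; ≤-pred; <⇒≤; ≰⇒>; ≮⇒≥; n≤1+n; m≤m+n; m≤n+m; +-comm; +-assoc; +-identityʳ; +-suc; +-mono-≤; +-monoˡ-≤; +-monoʳ-≤; +-cancelˡ-≤; +-cancelʳ-≤; +-cancelʳ-≡; *-comm; *-assoc; *-identityʳ; *-zeroʳ; *-distribˡ-+; *-distribʳ-+; *-monoˡ-≤; *-monoʳ-≤; *-cancelˡ-≤; *-cancelʳ-≤; m∸n+n≡m; m+[n∸m]≡n; m∸n≤m; m≤n+o⇒m∸n≤o; ≤-total; m≤n⇒∃[o]m+o≡n; 1+n≰n; suc-injective; _!≢0)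
open import Data.Nat.Divisibility using (m≤n⇒m!∣n!; ∣-trans; m∣m*n)
open import Data.Nat.DivMod using (m/n*n≡m)
open import Data.Nat.Tactic.RingSolver using (solve-∀)
open import Data.Bool using (Bool; true; false; T; if_then_else_; not; _∧_; _∨_)
open import Data.Bool.Properties using (T?; T-irrelevant)
open import Data.Fin using (Fin; zero; suc; toℕ; cast; splitAt; _↑ˡ_; _↑ʳ_)
open import Data.Fin.Properties using (_≟_; any?; all?; splitAt-↑ˡ; splitAt-↑ʳ; toℕ-cast; cast-is-id; cast-trans) renaming (suc-injective to fin-suc-injective)
open import Data.Fin.Subset.Properties using (anySubset?)
open import Data.Product using (∃; ∃-syntax; Σ-syntax; _×_; _,_; proj₁; proj₂)
open import Data.Sum using (_⊎_; inj₁; inj₂; [_,_]′) renaming (swap to ⊎-swap)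
open import Data.Sum.Properties using (inj₁-injective; inj₂-injective)
open import Data.Empty using (⊥; ⊥-elim)
open import Data.Unit using (tt)
open import Data.Vec using (Vec; lookup; tabulate)
open import Data.Vec.Properties using (lookup∘tabulate)
open import Data.List using (List; []; _∷_; _++_; length; concatMap; allFin; [_])
open import Data.List.Properties using (length-tabulate; ++-identityʳ)
open import Data.List.Membership.Propositional using (_∈_; _∉_)
open import Data.List.Membership.Propositional.Properties using (∈-++⁺ˡ; ∈-++⁺ʳ; ∈-++⁻; ∈-allFin; ∈-lookup)
open import Data.List.Membership.Propositional.Properties.WithK using (unique⇒irrelevant; unique∧set⇒bag)
open import Data.List.Relation.Unary.Any using (here; there; index)
open import Data.List.Relation.Unary.Any.Properties using (lookup-index)
open import Data.List.Relation.Unary.All using (All; []; _∷_)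
open import Data.List.Relation.Unary.AllPairs using ([]; _∷_)
open import Data.List.Relation.Unary.Unique.Propositional using (Unique)
open import Data.List.Relation.Unary.Unique.Propositional.Properties using (allFin⁺; ++⁺)
open import Data.List.Relation.Binary.Permutation.Propositional using (_↭_; ↭-refl; ↭-prep; ↭-sym; ↭-trans; ↭⇒↭ₛ)
open import Data.List.Relation.Binary.Permutation.Propositional.Properties using (∈-resp-↭; ↭-length; ++-comm; ∷↭∷ʳ; ++⁺ˡ)
open import Data.List.Relation.Binary.Permutation.Setoid.Properties using (Unique-resp-↭)
open import Data.List.Relation.Binary.BagAndSetEquality using (∼bag⇒↭)
open import Function using (_∘_; id; case_of_)
open import Function.Bundles using (mk↔ₛ′; mk⇔)
open import Relation.Nullary using (¬_; Dec; yes; no; does; contradiction; ¬?; _×-dec_; _⊎-dec_)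
open import Relation.Nullary.Decidable using (decidable-stable; dec-true; dec-false; does-⇔)
open import Relation.Binary.PropositionalEquality using (_≡_; _≢_; refl; trans; cong; cong₂; subst; ≢-sym; setoid) renaming (sym to ≡-sym)
import Data.List as List
import Data.List.Membership.DecPropositional as DecMembership
import Data.List.Relation.Binary.Permutation.Propositional as Perm
import Data.List.Relation.Unary.All as All

-- The weights `1 / m z` serve two purposes. A vertex `z` has at most `m z` neighbours in A, so it
-- receives total weight at most 1; and by convexity an upper bound on the average of `m` around `x`
-- becomes a lower bound on the weight that `x` sends out. The obstacle is that the recolouring
-- lemmas only speak of a vertex of A that misses two colours also missing at `x`. If the degrees of
-- both add up to less than k, counting supplies these colours, and c = 0. Otherwise further Kempe
-- changes must create them, which succeeds only for one of three given vertices at a time and has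
-- to keep the colours already in play frozen; hence c = 2. The additive constant 36 = 3 · 12 pays
-- for these exceptions. Small vertices are treated apart because Chvátal's condition is derived
-- only for h ≥ k / 2, so that the closure is controlled only between vertices that are not small.

-- Finite sums and counting

indicator : {P : Set} → Dec P → ℕ
indicator d = if does d then 1 else 0

indicator-yes : {P : Set} (d : Dec P) → P → indicator d ≡ 1
indicator-yes (yes _) _ = refl
indicator-yes (no ¬p) p = contradiction p ¬p

indicator-no : {P : Set} (d : Dec P) → ¬ P → indicator d ≡ 0
indicator-no (yes p) ¬p = contradiction p ¬p
indicator-no (no _)  _  = refl

sum : ∀ {n} → (Fin n → ℕ) → ℕ
sum {zero}  f = 0
sum {suc n} f = f zero + sum (f ∘ suc)

# : ∀ {n} {P : Fin n → Set} → (∀ i → Dec (P i)) → ℕ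
# P? = sum (indicator ∘ P?)

sum-mono : ∀ {n} {f g : Fin n → ℕ} → (∀ i → f i ≤ g i) → sum f ≤ sum g
sum-mono {zero}  _ = z≤n
sum-mono {suc n} h = +-mono-≤ (h zero) (sum-mono (h ∘ suc))

sum-strict : ∀ {n} {f g : Fin n → ℕ} (i : Fin n) → (∀ j → f j ≤ g j) → suc (f i) ≤ g i → suc (sum f) ≤ sum g
sum-strict zero    h s = +-mono-≤ s (sum-mono (h ∘ suc))
sum-strict {f = f} (suc i) h s = ≤-trans (≤-reflexive (≡-sym (+-suc (f zero) _))) (+-mono-≤ (h zero) (sum-strict i (h ∘ suc) s))
sum-cong : ∀ {n} {f g : Fin n → ℕ} → (∀ i → f i ≡ g i) → sum f ≡ sum g
sum-cong {zero}  _ = refl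
sum-cong {suc n} h = cong₂ _+_ (h zero) (sum-cong (h ∘ suc))

interchange : ∀ a b c d → (a + b) + (c + d) ≡ (a + c) + (b + d)
interchange = solve-∀

sum-+ : ∀ {n} (f g : Fin n → ℕ) → sum (λ i → f i + g i) ≡ sum f + sum g
sum-+ {zero}  f g = refl
sum-+ {suc n} f g = trans (cong (f zero + g zero +_) (sum-+ (f ∘ suc) (g ∘ suc)))
                          (interchange (f zero) (g zero) _ _)

sum-* : ∀ {n} c (f : Fin n → ℕ) → sum (λ i → c * f i) ≡ c * sum f
sum-* {zero}  c f = ≡-sym (*-zeroʳ c)
sum-* {suc n} c f = trans (cong (c * f zero +_) (sum-* c (f ∘ suc))) (≡-sym (*-distribˡ-+ c (f zero) _))

sum-const : ∀ n c → sum {n} (λ _ → c) ≡ n * c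
sum-const zero    c = refl
sum-const (suc n) c = cong (c +_) (sum-const n c)

sum-0 : ∀ n → sum {n} (λ _ → 0) ≡ 0
sum-0 zero    = refl
sum-0 (suc n) = sum-0 n

sum-swap : ∀ {m n} (f : Fin m → Fin n → ℕ) → sum (λ i → sum (f i)) ≡ sum (λ j → sum (λ i → f i j))
sum-swap {zero}  {n} f = ≡-sym (sum-0 n)
sum-swap {suc m} f = trans (cong (sum (f zero) +_) (sum-swap (f ∘ suc)))
                           (≡-sym (sum-+ (f zero) (λ j → sum (λ i → f (suc i) j))))

sum-indicator-* : ∀ {n} {P : Fin n → Set} (P? : ∀ i → Dec (P i)) c →
                  sum (λ i → indicator (P? i) * c) ≡ # P? * c
sum-indicator-* P? c = trans (sum-cong (λ i → *-comm (indicator (P? i)) c))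
                             (trans (sum-* c (indicator ∘ P?)) (*-comm c _))

#-mono : ∀ {n} {P Q : Fin n → Set} (P? : ∀ i → Dec (P i)) (Q? : ∀ i → Dec (Q i)) →
         (∀ i → P i → Q i) → # P? ≤ # Q?
#-mono P? Q? h = sum-mono go
  where
  go : ∀ i → indicator (P? i) ≤ indicator (Q? i)
  go i with P? i
  ... | no _  = z≤n
  ... | yes p = ≤-reflexive (≡-sym (indicator-yes (Q? i) (h i p)))

#-cong : ∀ {n} {P Q : Fin n → Set} (P? : ∀ i → Dec (P i)) (Q? : ∀ i → Dec (Q i)) →
         (∀ i → P i → Q i) → (∀ i → Q i → P i) → # P? ≡ # Q?
#-cong P? Q? f g = ≤-antisym (#-mono P? Q? f) (#-mono Q? P? g)

#-∪ : ∀ {n} {P Q R : Fin n → Set} (P? : ∀ i → Dec (P i)) (Q? : ∀ i → Dec (Q i)) (R? : ∀ i → Dec (R i)) →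
      (∀ i → P i → Q i ⊎ R i) → # P? ≤ # Q? + # R?
#-∪ P? Q? R? h = ≤-trans (sum-mono go) (≤-reflexive (sum-+ (indicator ∘ Q?) (indicator ∘ R?)))
  where
  go : ∀ i → indicator (P? i) ≤ indicator (Q? i) + indicator (R? i)
  go i with P? i
  ... | no _ = z≤n
  ... | yes p with h i p
  ...   | inj₁ q rewrite indicator-yes (Q? i) q = s≤s z≤n
  ...   | inj₂ r rewrite indicator-yes (R? i) r = m≤n+m 1 _

#-disjoint : ∀ {n} {P Q R : Fin n → Set} (P? : ∀ i → Dec (P i)) (Q? : ∀ i → Dec (Q i)) (R? : ∀ i → Dec (R i)) →
             (∀ i → P i → R i) → (∀ i → Q i → R i) → (∀ i → P i → Q i → ⊥) → # P? + # Q? ≤ # R?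
#-disjoint P? Q? R? f g h = ≤-trans (≤-reflexive (≡-sym (sum-+ (indicator ∘ P?) (indicator ∘ Q?)))) (sum-mono go)
  where
  go : ∀ i → indicator (P? i) + indicator (Q? i) ≤ indicator (R? i)
  go i with P? i | Q? i
  ... | yes p | yes q = ⊥-elim (h i p q)
  ... | yes p | no _  = ≤-reflexive (≡-sym (indicator-yes (R? i) (f i p)))
  ... | no _  | yes q = ≤-reflexive (≡-sym (indicator-yes (R? i) (g i q)))
  ... | no _  | no _  = z≤n

#-¬ : ∀ {n} {P : Fin n → Set} (P? : ∀ i → Dec (P i)) → # P? + # (¬? ∘ P?) ≡ n
#-¬ {n} P? = trans (≡-sym (sum-+ (indicator ∘ P?) _)) (trans (sum-cong go) (trans (sum-const n 1) (*-identityʳ n)))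
  where
  go : ∀ i → indicator (P? i) + indicator (¬? (P? i)) ≡ 1
  go i with P? i
  ... | yes _ = refl
  ... | no _  = refl

#-split : ∀ {n} {P Q : Fin n → Set} (P? : ∀ i → Dec (P i)) (Q? : ∀ i → Dec (Q i)) →
          # P? ≡ # (λ i → P? i ×-dec Q? i) + # (λ i → P? i ×-dec ¬? (Q? i))
#-split P? Q? = trans (sum-cong go) (sum-+ (λ i → indicator (P? i ×-dec Q? i)) _)
  where
  go : ∀ i → indicator (P? i) ≡ indicator (P? i ×-dec Q? i) + indicator (P? i ×-dec ¬? (Q? i))
  go i with P? i | Q? i
  ... | yes _ | yes _ = refl
  ... | yes _ | no _  = refl
  ... | no _  | yes _ = refl
  ... | no _  | no _  = refl

#-≤ : ∀ {n} {P : Fin n → Set} (P? : ∀ i → Dec (P i)) → # P? ≤ n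
#-≤ P? = ≤-trans (m≤m+n (# P?) _) (≤-reflexive (#-¬ P?))

#-T : ∀ {n} (f : Fin n → Bool) → # (T? ∘ f) ≡ countB f
#-T {zero}  f = refl
#-T {suc n} f = cong ((if f zero then 1 else 0) +_) (#-T (f ∘ suc))

#-∅ : ∀ {n} {P : Fin n → Set} (P? : ∀ i → Dec (P i)) → (∀ i → ¬ P i) → # P? ≡ 0
#-∅ {n} P? h = trans (sum-cong (λ i → indicator-no (P? i) (h i))) (sum-0 n)

#-remove : ∀ {n} {P : Fin n → Set} (P? : ∀ i → Dec (P i)) j → P j →
           # P? ≡ suc (# (λ i → P? i ×-dec ¬? (i ≟ j)))
#-remove {suc n} P? zero p rewrite indicator-yes (P? zero) p
  | indicator-no (P? zero ×-dec ¬? (zero {n} ≟ zero)) (λ q → proj₂ q refl)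
  = cong suc (#-cong (P? ∘ suc) (λ i → P? (suc i) ×-dec ¬? (suc i ≟ zero)) (λ i q → q , λ ()) (λ i → proj₁))
#-remove {suc n} {P} P? (suc j) p = trans (cong (indicator (P? zero) +_) (#-remove (P? ∘ suc) j p))
  (trans (+-suc (indicator (P? zero)) _) (cong suc (cong₂ _+_ head tail)))
  where
  head : indicator (P? zero) ≡ indicator (P? zero ×-dec ¬? (zero ≟ suc j))
  head with P? zero
  ... | yes _ = refl
  ... | no _  = refl
  tail : # (λ i → P? (suc i) ×-dec ¬? (i ≟ j)) ≡ # (λ i → P? (suc i) ×-dec ¬? (suc i ≟ suc j))
  tail = #-cong (λ i → P? (suc i) ×-dec ¬? (i ≟ j)) (λ i → P? (suc i) ×-dec ¬? (suc i ≟ suc j))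
    (λ i q → proj₁ q , λ { refl → proj₂ q refl }) (λ i q → proj₁ q , λ { refl → proj₂ q refl })

#-inject : ∀ {m n} {P : Fin m → Set} {Q : Fin n → Set} (P? : ∀ i → Dec (P i)) (Q? : ∀ i → Dec (Q i))
           (R : Fin m → Fin n → Set) → (∀ i → P i → ∃[ j ] (Q j × R i j)) →
           (∀ i i′ j → R i j → R i′ j → i ≡ i′) → # P? ≤ # Q?
#-inject {zero}  P? Q? R f inj = z≤n
#-inject {suc m} {P = P} {Q} P? Q? R f inj with P? zero
... | no _  = #-inject (P? ∘ suc) Q? (R ∘ suc) (f ∘ suc)
               (λ i i′ j r r′ → fin-suc-injective (inj (suc i) (suc i′) j r r′))
... | yes p with f zero p
... | j , q , r = ≤-trans (s≤s (#-inject (P? ∘ suc) (λ i → Q? i ×-dec ¬? (i ≟ j)) (R ∘ suc) g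
               (λ i i′ j r r′ → fin-suc-injective (inj (suc i) (suc i′) j r r′))))
               (≤-reflexive (≡-sym (#-remove Q? j q)))
  where
  g : ∀ i → P (suc i) → ∃[ j′ ] ((Q j′ × j′ ≢ j) × R (suc i) j′)
  g i p′ with f (suc i) p′
  ... | j′ , q′ , r′ = j′ , (q′ , λ { refl → case inj (suc i) zero j r′ r of λ () }) , r′

#-some : ∀ {n} {P : Fin n → Set} (P? : ∀ i → Dec (P i)) → 1 ≤ # P? → ∃ P
#-some {suc n} P? h with P? zero
... | yes p = zero , p
... | no _  with #-some (P? ∘ suc) h
...   | i , p = suc i , p

#-pick : ∀ {n} {P : Fin n → Set} (P? : ∀ i → Dec (P i)) c → suc c ≤ # P? →
         ∃[ i ] (P i × c ≤ # (λ j → P? j ×-dec ¬? (j ≟ i)))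
#-pick P? c h with #-some P? (≤-trans (s≤s z≤n) h)
... | i , p = i , p , ≤-pred (≤-trans h (≤-reflexive (#-remove P? i p)))

#-two : ∀ {n} {P : Fin n → Set} (P? : ∀ i → Dec (P i)) → 2 ≤ # P? → ∃[ i ] ∃[ j ] (P i × P j × i ≢ j)
#-two P? h with #-pick P? 1 h
... | i , pi , h′ with #-some (λ j → P? j ×-dec ¬? (j ≟ i)) h′
... | j , pj , j≢i = i , j , pi , pj , ≢-sym j≢i

#-three : ∀ {n} {P : Fin n → Set} (P? : ∀ i → Dec (P i)) → 3 ≤ # P? →
          ∃[ i ] ∃[ j ] ∃[ l ] (P i × P j × P l × i ≢ j × i ≢ l × j ≢ l)
#-three P? h with #-pick P? 2 h
... | i , pi , h′ with #-two (λ j → P? j ×-dec ¬? (j ≟ i)) h′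
... | j , l , (pj , j≢i) , (pl , l≢i) , j≢l = i , j , l , pi , pj , pl , ≢-sym j≢i , ≢-sym l≢i , j≢l

#-list : ∀ {n} {P : Fin n → Set} (P? : ∀ i → Dec (P i)) (xs : List (Fin n)) →
         (∀ i → P i → i ∈ xs) → # P? ≤ length xs
#-list P? []       h = ≤-reflexive (#-∅ P? (λ i p → case h i p of λ ()))
#-list P? (x ∷ xs) h = ≤-trans (#-∪ P? (_≟ x) (λ i → P? i ×-dec ¬? (i ≟ x)) split)
  (+-mono-≤ single (#-list (λ i → P? i ×-dec ¬? (i ≟ x)) xs rest))
  where
  split : ∀ i → _ → i ≡ x ⊎ (_ × i ≢ x)
  split i p with i ≟ x
  ... | yes e = inj₁ e
  ... | no ne = inj₂ (p , ne)
  single : # (_≟ x) ≤ 1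
  single = ≤-trans (≤-reflexive (#-remove (_≟ x) x refl))
             (s≤s (≤-reflexive (#-∅ (λ i → (i ≟ x) ×-dec ¬? (i ≟ x)) (λ i q → proj₂ q (proj₁ q)))))
  rest : ∀ i → _ → i ∈ xs
  rest i (p , ne) with h i p
  ... | here e = contradiction e ne
  ... | there m = m

-- Alternating paths of two involutions

-- The component of a in the graph of two involutions is a path when a is fixed by the first one:
-- its only vertices fixed by f or g are a and the other end e.
record AlternatingPath {n} (f g : Fin n → Fin n) (a : Fin n) : Set where
  field
    on       : Fin n → Bool
    end      : Fin n
    on-start : on a ≡ true
    f-closed : ∀ v → on (f v) ≡ on v
    g-closed : ∀ v → on (g v) ≡ on v
    ends     : ∀ v → on v ≡ true → f v ≡ v ⊎ g v ≡ v → v ≡ a ⊎ v ≡ end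

true≢false : ∀ {b} → b ≡ true → b ≡ false → ⊥
true≢false {true} _ ()
true≢false {false} ()

module _ {n} (a : Fin n) where

  involution-closed : (h : Fin n → Fin n) → (∀ v → h (h v) ≡ v) → (on : Fin n → Bool) →
                      (∀ v → on v ≡ true → on (h v) ≡ true) → ∀ v → on (h v) ≡ on v
  involution-closed h hh on c v with on v in eq | on (h v) in eq′
  ... | true  | true  = refl
  ... | false | false = refl
  ... | true  | false = ⊥-elim (true≢false (c v eq) eq′)
  ... | false | true  = ⊥-elim (true≢false (trans (cong on (≡-sym (hh v))) (c (h v) eq′)) eq)

  -- The path is explored from a; cur is the last vertex reached, and h is the involution to be followed next.
  explore : (h h′ : Fin n → Fin n) → (∀ v → h (h v) ≡ v) → (∀ v → h′ (h′ v) ≡ v) →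
            (on : Fin n → Bool) (cur : Fin n) (fuel : ℕ) →
            # (λ v → ¬? (T? (on v))) ≤ fuel →
            on a ≡ true → on cur ≡ true →
            (∀ v → on v ≡ true → on (h′ v) ≡ true) →
            (∀ v → on v ≡ true → v ≢ cur → on (h v) ≡ true × h v ≢ cur) →
            (∀ v → on v ≡ true → h′ v ≡ v → v ≡ a) →
            (∀ v → on v ≡ true → v ≢ cur → h v ≡ v → v ≡ a) →
            AlternatingPath h h′ a × AlternatingPath h′ h a
  explore h h′ hh hh′ on cur fuel le oa oc c′ c e′ e with h cur ≟ cur
  -- The next involution fixes `cur`, so the path ends here. Both orders of the two involutions are
  -- returned because their roles swap with every recursive call.
  ... | yes fx = path , record { AlternatingPath path renaming (f-closed to g-closed; g-closed to f-closed)
                               ; ends = λ v o x → AlternatingPath.ends path v o ([ inj₂ , inj₁ ]′ x) }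
    where
    ch : ∀ v → on v ≡ true → on (h v) ≡ true
    ch v o with v ≟ cur
    ... | yes refl = trans (cong on fx) o
    ... | no ne    = proj₁ (c v o ne)
    en : ∀ v → on v ≡ true → h v ≡ v ⊎ h′ v ≡ v → v ≡ a ⊎ v ≡ cur
    en v o x with v ≟ cur
    ... | yes q = inj₂ q
    en v o (inj₁ x) | no ne = inj₁ (e v o ne x)
    en v o (inj₂ x) | no ne = inj₁ (e′ v o x)
    path : AlternatingPath h h′ a
    path = record { on = on ; end = cur ; on-start = oa ; f-closed = involution-closed h hh on ch
                  ; g-closed = involution-closed h′ hh′ on c′ ; ends = en }
  ... | no nf = step fuel le
    where
    new : Fin n
    new = h cur
    -- A visited vertex other than `cur` has an `h`-image different from `cur`, whereas `h` sends
    -- `new` back to `cur`.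
    off : on new ≡ false
    off with on new in eq
    ... | false = refl
    ... | true  = ⊥-elim (proj₂ (c new eq nf) (hh cur))
    on′ : Fin n → Bool
    on′ v = on v ∨ does (v ≟ new)
    on′-old : ∀ v → on v ≡ true → on′ v ≡ true
    on′-old v o rewrite o = refl
    on′-new : on′ new ≡ true
    on′-new rewrite off = dec-true (new ≟ new) refl
    inv′ : ∀ v → on′ v ≡ true → on v ≡ true ⊎ v ≡ new
    inv′ v o with on v | v ≟ new
    ... | true | _ = inj₁ refl
    ... | false | yes q = inj₂ q
    inv′ v () | false | no _
    not-new : ∀ v → on v ≡ true → v ≢ new
    not-new v o refl = true≢false o off
    T-off : ∀ v → on v ≡ false → ¬ T (on v)
    T-off v o rewrite o = λ ()
    fewer : suc (# (λ v → ¬? (T? (on′ v)))) ≤ # (λ v → ¬? (T? (on v)))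
    fewer = ≤-trans (s≤s (#-mono (λ v → ¬? (T? (on′ v))) (λ v → ¬? (T? (on v)) ×-dec ¬? (v ≟ new)) sub))
              (≤-reflexive (≡-sym (#-remove (λ v → ¬? (T? (on v))) new (T-off new off))))
      where
      sub : ∀ v → ¬ T (on′ v) → ¬ T (on v) × v ≢ new
      sub v nt with on v | v ≟ new
      ... | true  | _     = contradiction tt nt
      ... | false | yes _ = contradiction tt nt
      ... | false | no q  = (λ ()) , q
    d′ : ∀ v → on′ v ≡ true → on′ (h v) ≡ true
    d′ v o with inv′ v o
    ... | inj₂ refl = trans (cong on′ (hh cur)) (on′-old cur oc)
    ... | inj₁ o′ with v ≟ cur
    ...   | yes refl = on′-new
    ...   | no ne    = on′-old _ (proj₁ (c v o′ ne))
    d : ∀ v → on′ v ≡ true → v ≢ new → on′ (h′ v) ≡ true × h′ v ≢ new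
    d v o ne with inv′ v o
    ... | inj₂ q  = contradiction q ne
    ... | inj₁ o′ = on′-old _ (c′ v o′) , not-new _ (c′ v o′)
    f′ : ∀ v → on′ v ≡ true → h v ≡ v → v ≡ a
    f′ v o x with inv′ v o
    ... | inj₂ refl = contradiction (trans (≡-sym x) (hh cur)) nf
    ... | inj₁ o′ with v ≟ cur
    ...   | yes refl = contradiction x nf
    ...   | no ne    = e v o′ ne x
    f₀ : ∀ v → on′ v ≡ true → v ≢ new → h′ v ≡ v → v ≡ a
    f₀ v o ne x with inv′ v o
    ... | inj₂ q  = contradiction q ne
    ... | inj₁ o′ = e′ v o′ x
    step : ∀ fuel → # (λ v → ¬? (T? (on v))) ≤ fuel → AlternatingPath h h′ a × AlternatingPath h′ h a
    step zero le = case ≤-trans fewer le of λ ()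
    step (suc fuel) le with explore h′ h hh′ hh on′ new fuel (≤-pred (≤-trans fewer le))
                              (on′-old a oa) on′-new d′ d f′ f₀
    ... | p , q = q , p

abstract
  -- As `f` fixes `a`, the path leaves `a` along `g`; hence `explore` is started with `g`, and the
  -- second order of the result is the one wanted.
  alternatingPath : ∀ {n} (f g : Fin n → Fin n) (a : Fin n) → (∀ v → f (f v) ≡ v) → (∀ v → g (g v) ≡ v) →
                    f a ≡ a → AlternatingPath f g a
  alternatingPath f g a ff gg fa = proj₂ (explore a g f gg ff (λ v → does (v ≟ a)) a _ ≤-refl
    (dec-true (a ≟ a) refl) (dec-true (a ≟ a) refl) c′ c (λ v o _ → is v o) (λ v o ne _ → is v o))
    where
    is : ∀ v → does (v ≟ a) ≡ true → v ≡ a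
    is v o with v ≟ a
    ... | yes q = q
    is v () | no _
    c′ : ∀ v → does (v ≟ a) ≡ true → does (f v ≟ a) ≡ true
    c′ v o rewrite is v o | fa = dec-true (a ≟ a) refl
    c : ∀ v → does (v ≟ a) ≡ true → v ≢ a → does (g v ≟ a) ≡ true × g v ≢ a
    c v o ne = contradiction (is v o) ne

-- Kempe changes

module Recolouring {n} (G : Graph n) (k : ℕ) (uncolourable : ¬ ColourableWith (adj G) k) where

  Vertex Colour : Set
  Vertex = Fin n
  Colour = Fin k

  Adj : Vertex → Vertex → Set
  Adj u v = T (adj G u v)

  Adj-sym : ∀ {u v} → Adj u v → Adj v u
  Adj-sym {u} {v} = subst T (Graph.sym G u v)

  Adj-irrefl : ∀ {v} → ¬ Adj v v
  Adj-irrefl {v} = subst T (irrefl G v)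

  -- A proper colouring of G − xy: M κ v is the neighbour of v along colour κ,
  -- and v itself if the colour κ is missing at v.
  record State (x y : Vertex) : Set where
    no-eta-equality
    field
      M         : Colour → Vertex → Vertex
      invol     : ∀ κ v → M κ (M κ v) ≡ v
      edge-of   : ∀ κ v → M κ v ≢ v → Adj v (M κ v)
      proper    : ∀ κ μ v → M κ v ≡ M μ v → M κ v ≢ v → κ ≡ μ
      covers    : ∀ u v → Adj u v → ¬ ((u ≡ x × v ≡ y) ⊎ (u ≡ y × v ≡ x)) → ∃[ κ ] M κ u ≡ v
      uncoloured : ∀ κ → M κ x ≢ y
      adjacent  : Adj x y

    x≢y : x ≢ y
    x≢y refl = Adj-irrefl adjacent

    flip : ∀ {κ u v} → M κ u ≡ v → M κ v ≡ u
    flip {κ} {u} refl = invol κ u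

    same-colour : ∀ {κ μ u v} → M κ u ≡ v → M μ u ≡ v → v ≢ u → κ ≡ μ
    same-colour {κ} {μ} {u} p q ne = proper κ μ u (trans p (≡-sym q)) (λ e → ne (trans (≡-sym p) e))

  open State public

  abstract
    -- Otherwise the uncoloured edge could take the colour κ, and the whole graph would be
    -- k-coloured.
    no-common-hole : ∀ {x y} (S : State x y) {κ} → M S κ x ≡ x → M S κ y ≡ y → ⊥
    no-common-hole {x} {y} S {κ} mx my = uncolourable (c , c-sym , c-proper)
      where
      c : ∀ u v → Adj u v → Colour
      c u v e with (u ≟ x) ×-dec (v ≟ y) | (u ≟ y) ×-dec (v ≟ x)
      ... | yes _ | _     = κ
      ... | no _  | yes _ = κ
      ... | no p  | no q  = proj₁ (covers S u v e [ p , q ]′)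
      -- A view of `c`: symmetry and properness follow by cases on the reason for a colour, without
      -- repeating the tests made by `c`.
      data Spec (u v : Vertex) : Colour → Set where
        fst-end : u ≡ x → v ≡ y → Spec u v κ
        snd-end : u ≡ y → v ≡ x → Spec u v κ
        normal  : ∀ {μ} → M S μ u ≡ v → Spec u v μ
      spec : ∀ u v (e : Adj u v) → Spec u v (c u v e)
      spec u v e with (u ≟ x) ×-dec (v ≟ y) | (u ≟ y) ×-dec (v ≟ x)
      ... | yes (p , q) | _     = fst-end p q
      ... | no _  | yes (p , q) = snd-end p q
      ... | no p  | no q  = normal (proj₂ (covers S u v e [ p , q ]′))
      ne : ∀ {u v} → Adj u v → v ≢ u
      ne e refl = Adj-irrefl e
      spec-sym : ∀ {u v κ₁ κ₂} → Adj u v → Spec u v κ₁ → Spec v u κ₂ → κ₁ ≡ κ₂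
      spec-sym a (fst-end _ _) (fst-end _ _) = refl
      spec-sym a (fst-end _ _) (snd-end _ _) = refl
      spec-sym a (fst-end refl refl) (normal m) = contradiction (flip S m) (uncoloured S _)
      spec-sym a (snd-end _ _) (fst-end _ _) = refl
      spec-sym a (snd-end _ _) (snd-end _ _) = refl
      spec-sym a (snd-end refl refl) (normal m) = contradiction m (uncoloured S _)
      spec-sym a (normal m) (fst-end refl refl) = contradiction (flip S m) (uncoloured S _)
      spec-sym a (normal m) (snd-end refl refl) = contradiction m (uncoloured S _)
      spec-sym a (normal m) (normal m′) = same-colour S m (flip S m′) (ne a)
      c-sym : ∀ u v (e : Adj u v) (e′ : Adj v u) → c u v e ≡ c v u e′
      c-sym u v e e′ = spec-sym e (spec u v e) (spec v u e′)
      spec-proper : ∀ {u v w μ} → v ≢ w → Adj u v → Adj u w → Spec u v μ → Spec u w μ → ⊥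
      spec-proper d a b (fst-end p q) (fst-end p′ q′) = d (trans q (≡-sym q′))
      spec-proper d a b (fst-end p q) (snd-end p′ q′) = x≢y S (trans (≡-sym p) p′)
      spec-proper d a b (fst-end refl q) (normal m) = ne b (trans (≡-sym m) mx)
      spec-proper d a b (snd-end p q) (fst-end p′ q′) = x≢y S (trans (≡-sym p′) p)
      spec-proper d a b (snd-end p q) (snd-end p′ q′) = d (trans q (≡-sym q′))
      spec-proper d a b (snd-end refl q) (normal m) = ne b (trans (≡-sym m) my)
      spec-proper d a b (normal m) (fst-end refl q) = ne a (trans (≡-sym m) mx)
      spec-proper d a b (normal m) (snd-end refl q) = ne a (trans (≡-sym m) my)
      spec-proper d a b (normal m) (normal m′) = d (trans (≡-sym m) m′)
      c-proper : ∀ u v w (e : Adj u v) (e′ : Adj u w) → v ≢ w → c u v e ≢ c u w e′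
      c-proper u v w e e′ d eq = spec-proper d e e′ (spec u v e) (subst (Spec u w) (≡-sym eq) (spec u w e′))

  transposed : Colour → Colour → Bool → Colour → Colour
  transposed α β false κ = κ
  transposed α β true  κ with κ ≟ α | κ ≟ β
  ... | yes _ | _     = β
  ... | no _  | yes _ = α
  ... | no _  | no _  = κ

  transposed-invol : ∀ α β b κ → transposed α β b (transposed α β b κ) ≡ κ
  transposed-invol α β false κ = refl
  transposed-invol α β true κ with κ ≟ α | κ ≟ β
  transposed-invol α β true κ | yes p | _ with β ≟ α | β ≟ β
  ... | yes q | _     = trans q (≡-sym p)
  ... | no _  | yes _ = ≡-sym p
  ... | no _  | no r  = contradiction refl r
  transposed-invol α β true κ | no p | yes q with α ≟ α
  ... | yes _ = ≡-sym q
  ... | no r  = contradiction refl r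
  transposed-invol α β true κ | no p | no q with κ ≟ α | κ ≟ β
  ... | yes r | _     = contradiction r p
  ... | no _  | yes r = contradiction r q
  ... | no _  | no _  = refl

  transposed-α : ∀ α β → transposed α β true α ≡ β
  transposed-α α β with α ≟ α | α ≟ β
  ... | yes _ | _ = refl
  ... | no r  | _ = contradiction refl r

  transposed-β : ∀ α β → transposed α β true β ≡ α
  transposed-β α β = trans (cong (transposed α β true) (≡-sym (transposed-α α β))) (transposed-invol α β true α)

  transposed-other : ∀ α β b κ → κ ≢ α → κ ≢ β → transposed α β b κ ≡ κ
  transposed-other α β false κ p q = refl
  transposed-other α β true κ p q with κ ≟ α | κ ≟ β
  ... | yes r | _     = contradiction r p
  ... | no _  | yes r = contradiction r q
  ... | no _  | no _  = refl

  -- The set `on` may be any union of α-β components, so this covers both the exchange away from a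
  -- path and the recolouring of a single edge.
  module Swap {x y} (S : State x y) (α β : Colour) (on : Vertex → Bool)
              (closed-α : ∀ v → on (M S α v) ≡ on v) (closed-β : ∀ v → on (M S β v) ≡ on v) where

    τ : Vertex → Colour → Colour
    τ v = transposed α β (on v)

    N : Colour → Vertex → Vertex
    N κ v = M S (τ v κ) v

    -- Neighbours along α or β lie on the same side of `on`, and the transposition does not touch
    -- the other colours. Thus both ends of an edge agree on its new colour.
    τ-stable : ∀ κ v → τ (N κ v) κ ≡ τ v κ
    τ-stable κ v with κ ≟ α | κ ≟ β
    ... | no p | no q = trans (transposed-other α β (on (N κ v)) κ p q) (≡-sym (transposed-other α β (on v) κ p q))
    ... | yes refl | _ = cong (λ b → transposed α β b κ) (on-α (on v) refl)
      where
      on-α : ∀ b → on v ≡ b → on (N α v) ≡ on v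
      on-α false e rewrite e = trans (closed-α v) e
      on-α true  e rewrite e = trans (cong (λ c → on (M S c v)) (transposed-α α β)) (trans (closed-β v) e)
    ... | no _ | yes refl = cong (λ b → transposed α β b κ) (on-β (on v) refl)
      where
      on-β : ∀ b → on v ≡ b → on (N β v) ≡ on v
      on-β false e rewrite e = trans (closed-β v) e
      on-β true  e rewrite e = trans (cong (λ c → on (M S c v)) (transposed-β α β)) (trans (closed-α v) e)

    swapped : State x y
    swapped = record
      { M = N
      ; invol = λ κ v → trans (cong (λ c → M S c (N κ v)) (τ-stable κ v)) (invol S (τ v κ) v)
      ; edge-of = λ κ v → edge-of S (τ v κ) v
      ; proper = λ κ μ v e ne → trans (≡-sym (transposed-invol α β (on v) κ))
          (trans (cong (τ v) (proper S (τ v κ) (τ v μ) v e ne)) (transposed-invol α β (on v) μ))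
      ; covers = λ u v a h → let (κ , e) = covers S u v a h in
          τ u κ , trans (cong (λ c → M S c u) (transposed-invol α β (on u) κ)) e
      ; uncoloured = λ κ → uncoloured S (τ x κ)
      ; adjacent = adjacent S }

    off-same : ∀ {v} → on v ≡ false → ∀ κ → M swapped κ v ≡ M S κ v
    off-same {v} e κ rewrite e = refl

    other-same : ∀ κ v → κ ≢ α → κ ≢ β → M swapped κ v ≡ M S κ v
    other-same κ v p q = cong (λ c → M S c v) (transposed-other α β (on v) κ p q)

    on-α : ∀ {v} → on v ≡ true → M swapped α v ≡ M S β v
    on-α {v} e rewrite e | transposed-α α β = refl

    on-β : ∀ {v} → on v ≡ true → M swapped β v ≡ M S α v
    on-β {v} e rewrite e | transposed-β α β = refl

  Same : ∀ {x y x′ y′} → State x y → State x′ y′ → Vertex → Set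
  Same S S′ v = ∀ κ → M S′ κ v ≡ M S κ v

  Others-same : ∀ {x y} → State x y → State x y → Colour → Colour → Set
  Others-same S S′ α β = ∀ κ v → κ ≢ α → κ ≢ β → M S′ κ v ≡ M S κ v

  Exchanged : ∀ {x y} → State x y → State x y → Colour → Colour → Vertex → Set
  Exchanged S S′ α β v = M S′ α v ≡ M S β v × M S′ β v ≡ M S α v

  End : ∀ {x y} → State x y → Colour → Colour → Vertex → Set
  End S α β v = M S α v ≡ v ⊎ M S β v ≡ v

  -- The exchange takes place off the path rather than on it, so that all colours at `x` survive.
  module Away {x y} (S : State x y) (α β : Colour) (mx : M S α x ≡ x) where

    path : AlternatingPath (M S α) (M S β) x
    path = alternatingPath (M S α) (M S β) x (invol S α) (invol S β) mx

    open AlternatingPath path public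

    open Swap S α β (not ∘ on) (λ v → cong not (f-closed v)) (λ v → cong not (g-closed v)) public

    on-same : ∀ {v} → on v ≡ true → Same S swapped v
    on-same e = off-same (cong not e)

    x-same : Same S swapped x
    x-same = on-same on-start

    exchanged : ∀ {v} → on v ≡ false → Exchanged S swapped α β v
    exchanged e = on-α (cong not e) , on-β (cong not e)

    side : ∀ v → on v ≡ true ⊎ on v ≡ false
    side v with on v
    ... | true  = inj₁ refl
    ... | false = inj₂ refl

  abstract
    -- Both `a` and `b` are ends of α-β paths. The path from `x` has only one other end, so at least
    -- one of them lies off it and is exchanged.
    awayPair : ∀ {x y} (S : State x y) (α β : Colour) → M S α x ≡ x →
               ∀ a b → a ≢ b → a ≢ x → b ≢ x → End S α β a → End S α β b →
               Σ[ S′ ∈ State x y ] (Same S S′ x × Others-same S S′ α β ×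
                 (Exchanged S S′ α β a ⊎ Exchanged S S′ α β b))
    awayPair {x} S α β mx a b a≢b a≢x b≢x ea eb = swapped , x-same , other-same , which
      where
      open Away S α β mx
      which : Exchanged S swapped α β a ⊎ Exchanged S swapped α β b
      which with side a | side b
      ... | inj₂ oa | _       = inj₁ (exchanged oa)
      ... | inj₁ _  | inj₂ ob = inj₂ (exchanged ob)
      ... | inj₁ oa | inj₁ ob with ends a oa ea | ends b ob eb
      ...   | inj₁ p | _      = contradiction p a≢x
      ...   | inj₂ _ | inj₁ q = contradiction q b≢x
      ...   | inj₂ p | inj₂ q = contradiction (trans p (≡-sym q)) a≢b

    -- The α–β path from x must end at y (otherwise y would miss α after a Kempe change);
    -- all the other components are exchanged at once.
    awayXY : ∀ {x y} (S : State x y) (α β : Colour) → M S α x ≡ x → M S β y ≡ y →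
             Σ[ S′ ∈ State x y ] (Same S S′ x × Same S S′ y × Others-same S S′ α β ×
               (∀ v → v ≢ x → v ≢ y → End S α β v → Exchanged S S′ α β v))
    awayXY {x} {y} S α β mx my = swapped , x-same , on-same y-on , other-same , rest
      where
      open Away S α β mx
      y-on : on y ≡ true
      y-on with side y
      ... | inj₁ oy = oy
      ... | inj₂ oy = ⊥-elim (no-common-hole swapped (trans (x-same α) mx) (trans (proj₁ (exchanged oy)) my))
      y-end : y ≡ end
      y-end = [ (λ e → contradiction (≡-sym e) (x≢y S)) , id ]′ (ends y y-on (inj₂ my))
      rest : ∀ v → v ≢ x → v ≢ y → End S α β v → Exchanged S swapped α β v
      rest v v≢x v≢y ev with side v
      ... | inj₂ ov = exchanged ov
      ... | inj₁ ov = ⊥-elim ([ v≢x , (λ e → v≢y (trans e (≡-sym y-end))) ]′ (ends v ov ev))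

    -- As β is missing at both ends of the γ-edge from `y′` to `u`, these two vertices form a whole
    -- γ-β component; the Kempe change on it merely turns the colour of the edge into β.
    recolour : ∀ {x y} (S : State x y) {γ β y′ u} → M S γ y′ ≡ u → M S β y′ ≡ y′ → M S β u ≡ u →
               Σ[ S′ ∈ State x y ] (M S′ γ y′ ≡ y′ × M S′ β y′ ≡ u × M S′ γ u ≡ u ×
                 (∀ v → v ≢ y′ → v ≢ u → Same S S′ v) × Others-same S S′ γ β)
    recolour S {γ} {β} {y′} {u} e by bu = swapped , trans (on-α on-y) by , trans (on-β on-y) e ,
        trans (on-α on-u) bu , (λ v p q → off-same (off v p q)) , other-same
      where
      on : Vertex → Bool
      on v = does (v ≟ y′) ∨ does (v ≟ u)
      on-y : on y′ ≡ true
      on-y rewrite dec-true (y′ ≟ y′) refl = refl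
      on-u : on u ≡ true
      on-u with does (u ≟ y′)
      ... | true  = refl
      ... | false = dec-true (u ≟ u) refl
      off : ∀ v → v ≢ y′ → v ≢ u → on v ≡ false
      off v p q rewrite dec-false (v ≟ y′) p | dec-false (v ≟ u) q = refl
      closed : ∀ κ → (∀ v → on v ≡ true → on (M S κ v) ≡ true) → ∀ v → on (M S κ v) ≡ on v
      closed κ = involution-closed y′ (M S κ) (invol S κ) on
      cases : ∀ v → on v ≡ true → v ≡ y′ ⊎ v ≡ u
      cases v o with v ≟ y′ | v ≟ u
      ... | yes p | _     = inj₁ p
      ... | no _  | yes q = inj₂ q
      cases v () | no _ | no _
      cγ : ∀ v → on v ≡ true → on (M S γ v) ≡ true
      cγ v o with cases v o
      ... | inj₁ refl = trans (cong on e) on-u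
      ... | inj₂ refl = trans (cong on (flip S e)) on-y
      cβ : ∀ v → on v ≡ true → on (M S β v) ≡ true
      cβ v o with cases v o
      ... | inj₁ refl = trans (cong on by) on-y
      ... | inj₂ refl = trans (cong on bu) on-u
      open Swap S γ β on (closed γ cγ) (closed β cβ)

    -- The basic step of a Vizing fan: `xy` takes the colour γ, which is missing at `y`, and `xz`
    -- gives it up. Only the involution of γ is rewired, at `x`, `y` and `z`.
    shift : ∀ {x y} (S : State x y) {γ z} → M S γ y ≡ y → M S γ x ≡ z → z ≢ x →
            Σ[ S′ ∈ State x z ] (M S′ γ x ≡ y × M S′ γ z ≡ z × (∀ κ v → κ ≢ γ → M S′ κ v ≡ M S κ v))
    shift {x} {y} S {γ} {z} my e z≢x = record
        { M = N ; invol = N-invol ; edge-of = N-edge ; proper = N-proper ; covers = N-covers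
        ; uncoloured = N-unc ; adjacent = subst (Adj x) e (edge-of S γ x (λ q → z≢x (trans (≡-sym e) q))) }
      , Nx , Nz , (λ κ v ne → N-other κ ne v)
      where
      z≢y : z ≢ y
      z≢y z≡y = uncoloured S γ (trans e z≡y)
      P : Vertex → Vertex
      P v with v ≟ x | v ≟ y | v ≟ z
      ... | yes _ | _ | _ = y
      ... | no _ | yes _ | _ = x
      ... | no _ | no _ | yes _ = z
      ... | no _ | no _ | no _ = M S γ v
      Px : P x ≡ y
      Px with x ≟ x
      ... | yes _ = refl
      ... | no r = contradiction refl r
      Py : P y ≡ x
      Py with y ≟ x | y ≟ y
      ... | yes r | _ = contradiction (≡-sym r) (x≢y S)
      ... | no _ | yes _ = refl
      ... | no _ | no r = contradiction refl r
      Pz : P z ≡ z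
      Pz with z ≟ x | z ≟ y | z ≟ z
      ... | yes r | _ | _ = contradiction r z≢x
      ... | no _ | yes r | _ = contradiction r z≢y
      ... | no _ | no _ | yes _ = refl
      ... | no _ | no _ | no r = contradiction refl r
      Pv : ∀ v → v ≢ x → v ≢ y → v ≢ z → P v ≡ M S γ v
      Pv v a b c with v ≟ x | v ≟ y | v ≟ z
      ... | yes r | _ | _ = contradiction r a
      ... | no _ | yes r | _ = contradiction r b
      ... | no _ | no _ | yes r = contradiction r c
      ... | no _ | no _ | no _ = refl
      data Kind (v : Vertex) : Set where
        isx : v ≡ x → Kind v
        isy : v ≡ y → Kind v
        isz : v ≡ z → Kind v
        else : v ≢ x → v ≢ y → v ≢ z → Kind v
      kind : ∀ v → Kind v
      kind v with v ≟ x | v ≟ y | v ≟ z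
      ... | yes r | _ | _ = isx r
      ... | no _ | yes r | _ = isy r
      ... | no _ | no _ | yes r = isz r
      ... | no a | no b | no c = else a b c
      P-invol : ∀ v → P (P v) ≡ v
      P-invol v with kind v
      ... | isx refl = trans (cong P Px) Py
      ... | isy refl = trans (cong P Py) Px
      ... | isz refl = trans (cong P Pz) Pz
      ... | else a b c = trans (cong P (Pv v a b c)) (trans (Pv (M S γ v)
              (λ q → c (trans (≡-sym (flip S q)) e)) (λ q → b (trans (≡-sym (flip S q)) my))
              (λ q → a (trans (≡-sym (flip S q)) (flip S e)))) (invol S γ v))
      N : Colour → Vertex → Vertex
      N κ with κ ≟ γ
      ... | yes _ = P
      ... | no _  = M S κ
      N-γ : ∀ v → N γ v ≡ P v
      N-γ v with γ ≟ γ
      ... | yes _ = refl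
      ... | no r = contradiction refl r
      N-other : ∀ κ → κ ≢ γ → ∀ v → N κ v ≡ M S κ v
      N-other κ ne v with κ ≟ γ
      ... | yes r = contradiction r ne
      ... | no _ = refl
      Nx : N γ x ≡ y
      Nx = trans (N-γ x) Px
      Nz : N γ z ≡ z
      Nz = trans (N-γ z) Pz
      N-invol : ∀ κ v → N κ (N κ v) ≡ v
      N-invol κ v with κ ≟ γ
      ... | yes _ = P-invol v
      ... | no _ = invol S κ v
      N-edge : ∀ κ v → N κ v ≢ v → Adj v (N κ v)
      N-edge κ v ne with κ ≟ γ
      ... | no _ = edge-of S κ v ne
      ... | yes _ with kind v
      ...   | isx refl = subst (Adj x) (≡-sym Px) (adjacent S)
      ...   | isy refl = subst (Adj y) (≡-sym Py) (Adj-sym (adjacent S))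
      ...   | isz refl = contradiction Pz ne
      ...   | else a b c = subst (Adj v) (≡-sym (Pv v a b c)) (edge-of S γ v (λ q → ne (trans (Pv v a b c) q)))
      P-M : ∀ μ v → μ ≢ γ → P v ≡ M S μ v → P v ≢ v → ⊥
      P-M μ v ne q d with kind v
      ... | isx refl = uncoloured S μ (trans (≡-sym q) Px)
      ... | isy refl = uncoloured S μ (flip S (trans (≡-sym q) Py))
      ... | isz refl = d Pz
      ... | else a b c = ne (≡-sym (proper S γ μ v (trans (≡-sym (Pv v a b c)) q) (λ r → d (trans (Pv v a b c) r))))
      N-proper : ∀ κ μ v → N κ v ≡ N μ v → N κ v ≢ v → κ ≡ μ
      N-proper κ μ v q d with κ ≟ γ | μ ≟ γ
      ... | yes r | yes r′ = trans r (≡-sym r′)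
      ... | yes _ | no ne = ⊥-elim (P-M μ v ne q d)
      ... | no ne | yes _ = ⊥-elim (P-M κ v ne (≡-sym q) (λ r → d (trans q r)))
      ... | no _ | no _ = proper S κ μ v q d
      N-unc : ∀ κ → N κ x ≢ z
      N-unc κ q with κ ≟ γ
      ... | yes _ = z≢y (trans (≡-sym q) Px)
      ... | no ne = ne (same-colour S q e z≢x)
      N-covers : ∀ u v → Adj u v → ¬ ((u ≡ x × v ≡ z) ⊎ (u ≡ z × v ≡ x)) → ∃[ κ ] N κ u ≡ v
      N-covers u v a h with (u ≟ x) ×-dec (v ≟ y) | (u ≟ y) ×-dec (v ≟ x)
      ... | yes (refl , refl) | _ = γ , Nx
      ... | no _ | yes (refl , refl) = γ , trans (N-γ y) Py
      ... | no p | no q with covers S u v a [ p , q ]′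
      ...   | κ , m with κ ≟ γ
      ...     | no ne = κ , trans (N-other κ ne u) m
      ...     | yes refl = γ , trans (N-γ u) (trans (Pv u (λ { refl → h (inj₁ (refl , trans (≡-sym m) e)) })
                  (λ { refl → Adj-irrefl (subst (Adj y) (trans (≡-sym m) my) a) })
                  (λ { refl → h (inj₂ (refl , trans (≡-sym m) (flip S e))) })) m)

  -- Two colours, because an exchange typically uses up one of them while the other is still needed
  -- for the final contradiction.
  Shares2 : ∀ {x y} → State x y → Vertex → Set
  Shares2 {x} S v = ∃[ α ] ∃[ α′ ] (α ≢ α′ × (M S α x ≡ x × M S α v ≡ v) × (M S α′ x ≡ x × M S α′ v ≡ v))

  module _ {x y} (S : State x y) where

    ≢-by-colour : ∀ {κ μ v} → M S κ v ≢ v → M S μ v ≡ v → κ ≢ μ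
    ≢-by-colour p q refl = p q

    -- An α-β exchange off the path from `x` to `y` makes `u` miss β, just as `y` does; then the
    -- edge `yu` can be recoloured from γ to β.
    free : ∀ {β γ α u} → M S β y ≡ y → M S γ y ≡ u → u ≢ y → M S α x ≡ x → M S α u ≡ u →
           Σ[ S′ ∈ State x y ] (Same S S′ x × M S′ γ y ≡ y)
    free {β} {γ} {α} {u} by e u≢y ax au with awayXY S α β ax by
    ... | S₁ , x₁ , y₁ , o₁ , ex with recolour S₁ (trans (y₁ γ) e) (trans (y₁ β) by)
                                     (trans (proj₂ (ex u u≢x u≢y (inj₁ au))) au)
      where
      u≢x : u ≢ x
      u≢x refl = uncoloured S γ (flip S e)
    ... | S₂ , gy , _ , _ , s₂ , _ = S₂ , (λ κ → trans (s₂ x (x≢y S) x≢u κ) (x₁ κ)) , gy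
      where
      x≢u : x ≢ u
      x≢u refl = uncoloured S γ (flip S e)

    -- Here `free` would make κ missing at `y` as well as at `x`. This is the argument for Kierstead
    -- paths on the vertices `x`, `y`, `u` and one more edge uncoloured at the start.
    no-shared-neighbour : ∀ {β κ α u} → M S β y ≡ y → M S κ x ≡ x → M S κ y ≡ u → u ≢ y → M S α x ≡ x → M S α u ≡ u → ⊥
    no-shared-neighbour {κ = κ} by kx e u≢y ax au with free by e u≢y ax au
    ... | S′ , x-same , gy = no-common-hole S′ (trans (x-same κ) kx) gy

  module _ {x y} (S : State x y) {γ z} (my : M S γ y ≡ y) (xz : M S γ x ≡ z) (z≢x : z ≢ x) where

    z≢y : z ≢ y
    z≢y z≡y = uncoloured S γ (trans xz z≡y)

    γ-at-x : M S γ x ≢ x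
    γ-at-x q = z≢x (trans (≡-sym xz) q)

    ≢γ : ∀ {κ} → M S κ x ≡ x → κ ≢ γ
    ≢γ q refl = γ-at-x q

    -- Shifting the uncoloured edge to `xz` puts `z` in the place of `y`; colours missing at `x`
    -- differ from γ and are not affected.
    no-shared-second-neighbour : ∀ {κ w α} → M S κ x ≡ x → M S κ z ≡ w → w ≢ z → M S α x ≡ x → M S α w ≡ w → ⊥
    no-shared-second-neighbour {κ} {w} {α} kx zw w≢z ax aw with shift S my xz z≢x
    ... | S′ , _ , γz , o = no-shared-neighbour S′ γz (trans (o κ x (≢γ kx)) kx) (trans (o κ z (≢γ kx)) zw) w≢z
                              (trans (o α x (≢γ ax)) ax) (trans (o α w (≢γ ax)) aw)

    x-hole-used-at-z : ∀ {κ} → M S κ x ≡ x → M S κ z ≢ z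
    x-hole-used-at-z {κ} kx kz with shift S my xz z≢x
    ... | S′ , _ , γz , o = no-common-hole S′ (trans (o κ x (≢γ kx)) kx) (trans (o κ z (≢γ kx)) kz)

  module _ {x y} (S : State x y) {γ z} (my : M S γ y ≡ y) (xz : M S γ x ≡ z) (z≢x : z ≢ x) where

    -- The α-κ exchange off the path from `x` to `y` would turn the missing colour κ of `z` into α,
    -- which is missing at `x`.
    y-hole-used-at-z : ∀ {α κ} → M S α x ≡ x → M S κ y ≡ y → κ ≢ γ → M S κ z ≢ z
    y-hole-used-at-z {α} {κ} ax ky ne kz with awayXY S α κ ax ky
    ... | S′ , x′ , y′ , _ , ex = x-hole-used-at-z S′ (trans (y′ γ) my) (trans (x′ γ) xz) z≢x (trans (x′ α) ax)
          (trans (proj₁ (ex z z≢x (z≢y S my xz z≢x) (inj₂ kz))) kz)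

    -- The η-κ exchange off the path from `x` to `y` gives the edge `zw` the colour η, missing at
    -- `x`, while `w` still shares η′ with `x`.
    no-sharing-along-y-hole : ∀ {κ w} → M S κ y ≡ y → κ ≢ γ → M S κ z ≡ w → w ≢ z → w ≢ x → Shares2 S w → ⊥
    no-sharing-along-y-hole {κ} {w} ky κ≢γ zw w≢z w≢x (η , η′ , ne , (ηx , ηw) , (η′x , η′w)) with awayXY S η κ ηx ky
    ... | S′ , x′ , y′ , o , ex = no-shared-second-neighbour S′ (trans (y′ γ) my) (trans (x′ γ) xz) z≢x (trans (x′ η) ηx)
          (flip S′ (trans (proj₁ (ex w w≢x w≢y (inj₁ ηw))) (flip S zw))) w≢z
          (trans (x′ η′) η′x) (trans (o η′ w (≢-sym ne) (λ { refl → w≢z (trans (≡-sym η′w) (flip S zw)) })) η′w)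
      where
      w≢y : w ≢ y
      w≢y refl = w≢z (trans (≡-sym ky) (flip S zw))

  module _ {x y} (S : State x y) {γ z} (my : M S γ y ≡ y) (xz : M S γ x ≡ z) (z≢x : z ≢ x)
           {κ u} (yu : M S κ y ≡ u) (u≢y : u ≢ y) where

    κ≢γ : κ ≢ γ
    κ≢γ refl = u≢y (trans (≡-sym yu) my)

    u≢x : u ≢ x
    u≢x refl = uncoloured S κ (flip S yu)

    -- After a shift `y` and `z` trade places: `yu` then leaves the fan vertex `y` along a colour
    -- missing at the new end `z`.
    no-hole-beside-sharing : Shares2 S u → M S κ z ≢ z
    no-hole-beside-sharing (η , η′ , ne , (ηx , ηu) , (η′x , η′u)) kz with shift S my xz z≢x
    ... | S′ , γx , γz , o = no-sharing-along-y-hole S′ γz γx (≢-sym (x≢y S)) (trans (o κ z κ≢γ) kz) κ≢γ (trans (o κ y κ≢γ) yu) u≢y u≢x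
          (η , η′ , ne , (trans (o η x (g ηx)) ηx , trans (o η u (g ηx)) ηu)
                       , (trans (o η′ x (g η′x)) η′x , trans (o η′ u (g η′x)) η′u))
      where
      g : ∀ {κ} → M S κ x ≡ x → κ ≢ γ
      g = ≢γ S my xz z≢x

    module _ {w} (zw : M S κ z ≡ w) (w≢z : w ≢ z) where

      w≢x : w ≢ x
      w≢x refl = κ≢γ (same-colour S (flip S zw) xz z≢x)

      u≢w : u ≢ w
      u≢w refl = uncoloured S γ (trans xz (trans (≡-sym (flip S zw)) (flip S yu)))

      κ-at-u : M S κ u ≢ u
      κ-at-u q = u≢y (trans (≡-sym q) (flip S yu))

      κ-at-w : M S κ w ≢ w
      κ-at-w q = w≢z (trans (≡-sym q) (flip S zw))

      -- The α-κ exchange away from `x` gives `yu` or `zw` the colour α, which is missing at `x`.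
      -- The remaining shared colour, α′ at `u` or α″ at `w`, then contradicts the corresponding
      -- neighbour lemma.
      common-hole : ∀ {α α′ α″} → M S α x ≡ x → M S α u ≡ u → M S α w ≡ w →
                    M S α′ x ≡ x → M S α′ u ≡ u → α′ ≢ α → M S α″ x ≡ x → M S α″ w ≡ w → α″ ≢ α → ⊥
      common-hole {α} {α′} {α″} ax au aw a′x a′u n′ a″x a″w n″
        with awayPair S α κ ax u w u≢w u≢x w≢x (inj₁ au) (inj₁ aw)
      ... | S′ , x′ , o , inj₁ (eu , _) = no-shared-neighbour S′ (trans (o γ y γ≢α (≢-sym κ≢γ)) my) (trans (x′ α) ax)
              (flip S′ (trans eu (flip S yu))) u≢y (trans (x′ α′) a′x)
              (trans (o α′ u n′ (≢-sym (≢-by-colour S κ-at-u a′u))) a′u)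
        where
        γ≢α : γ ≢ α
        γ≢α = ≢-sym (≢γ S my xz z≢x ax)
      ... | S′ , x′ , o , inj₂ (ew , _) = no-shared-second-neighbour S′ (trans (o γ y γ≢α (≢-sym κ≢γ)) my) (trans (x′ γ) xz) z≢x
              (trans (x′ α) ax) (flip S′ (trans ew (flip S zw))) w≢z (trans (x′ α″) a″x)
              (trans (o α″ w n″ (≢-sym (≢-by-colour S κ-at-w a″w))) a″w)
        where
        γ≢α : γ ≢ α
        γ≢α = ≢-sym (≢γ S my xz z≢x ax)

      -- First make u miss γ and recolour yu from κ to γ; then the κ–q change away from x and y turns
      -- the colour of zw into q; finally u recovers κ, so that yu gets back its colour.
      distinct-holes : ∀ {p p′ q q′} → M S p x ≡ x → M S p u ≡ u → M S p′ x ≡ x → M S p′ u ≡ u →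
                       M S q x ≡ x → M S q w ≡ w → M S q′ x ≡ x → M S q′ w ≡ w →
                       p ≢ p′ → q ≢ q′ → p ≢ q → p ≢ q′ → p′ ≢ q → p′ ≢ q′ → ⊥
      distinct-holes {p} {p′} {q} {q′} px pu p′x p′u qx qw q′x q′w pp′ qq′ pq pq′ p′q p′q′ =
        no-shared-second-neighbour S₅ γy₅ xz₅ z≢x (trans (x₅ q) (trans (x₄ q) (trans (x₃ q) (trans (x₂ q) (trans (x₁ q) qx))))) zw₅ w≢z
          (trans (x₅ q′) (trans (x₄ q′) (trans (x₃ q′) (trans (x₂ q′) (trans (x₁ q′) q′x))))) q′w₅
        where
        g : ∀ {κ} → M S κ x ≡ x → κ ≢ γ
        g = ≢γ S my xz z≢x
        w≢y : w ≢ y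
        w≢y refl = no-common-hole S qx qw
        z≢u : z ≢ u
        z≢u refl = w≢y (trans (≡-sym zw) (flip S yu))
        κ≢ku : ∀ {c} → M S c u ≡ u → c ≢ κ
        κ≢ku h = ≢-sym (≢-by-colour S κ-at-u h)
        κ≢kw : ∀ {c} → M S c w ≡ w → c ≢ κ
        κ≢kw h = ≢-sym (≢-by-colour S κ-at-w h)
        r₁ = awayXY S p′ γ p′x my
        S₁ = proj₁ r₁
        x₁ : Same S S₁ x
        x₁ = proj₁ (proj₂ r₁)
        y₁ : Same S S₁ y
        y₁ = proj₁ (proj₂ (proj₂ r₁))
        o₁ : Others-same S S₁ p′ γ
        o₁ = proj₁ (proj₂ (proj₂ (proj₂ r₁)))
        γu₁ : M S₁ γ u ≡ u
        γu₁ = trans (proj₂ (proj₂ (proj₂ (proj₂ (proj₂ r₁))) u u≢x u≢y (inj₁ p′u))) p′u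
        r₂ = recolour S₁ (trans (y₁ κ) yu) (trans (y₁ γ) my) γu₁
        S₂ = proj₁ r₂
        κy₂ : M S₂ κ y ≡ y
        κy₂ = proj₁ (proj₂ r₂)
        γy₂ : M S₂ γ y ≡ u
        γy₂ = proj₁ (proj₂ (proj₂ r₂))
        v₂ : ∀ v → v ≢ y → v ≢ u → Same S₁ S₂ v
        v₂ = proj₁ (proj₂ (proj₂ (proj₂ (proj₂ r₂))))
        o₂ : Others-same S₁ S₂ κ γ
        o₂ = proj₂ (proj₂ (proj₂ (proj₂ (proj₂ r₂))))
        x₂ : Same S₁ S₂ x
        x₂ = v₂ x (x≢y S) (≢-sym u≢x)
        zw₂ : M S₂ κ z ≡ w
        zw₂ = trans (v₂ z (z≢y S my xz z≢x) z≢u κ) (trans (o₁ κ z (≢-sym (κ≢ku p′u)) κ≢γ) zw)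
        hole₂ : ∀ {c v} → M S c x ≡ x → c ≢ p′ → c ≢ κ → M S c v ≡ v → M S₂ c v ≡ v
        hole₂ {c} {v} cx cp′ cκ cv = trans (o₂ c v cκ (g cx)) (trans (o₁ c v cp′ (g cx)) cv)
        qw₂ : M S₂ q w ≡ w
        qw₂ = hole₂ qx (≢-sym p′q) (κ≢kw qw) qw
        r₃ = awayXY S₂ q κ (trans (x₂ q) (trans (x₁ q) qx)) κy₂
        S₃ = proj₁ r₃
        x₃ : Same S₂ S₃ x
        x₃ = proj₁ (proj₂ r₃)
        y₃ : Same S₂ S₃ y
        y₃ = proj₁ (proj₂ (proj₂ r₃))
        o₃ : Others-same S₂ S₃ q κ
        o₃ = proj₁ (proj₂ (proj₂ (proj₂ r₃)))
        wz₃ : M S₃ q w ≡ z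
        wz₃ = trans (proj₁ (proj₂ (proj₂ (proj₂ (proj₂ r₃))) w w≢x w≢y (inj₁ qw₂))) (flip S₂ zw₂)
        pu₃ : M S₃ p u ≡ u
        pu₃ = trans (o₃ p u pq (κ≢ku pu)) (hole₂ px pp′ (κ≢ku pu) pu)
        q′w₃ : M S₃ q′ w ≡ w
        q′w₃ = trans (o₃ q′ w (≢-sym qq′) (κ≢kw q′w)) (hole₂ q′x (≢-sym p′q′) (κ≢kw q′w) q′w)
        r₄ = awayXY S₃ p κ (trans (x₃ p) (trans (x₂ p) (trans (x₁ p) px))) (trans (y₃ κ) κy₂)
        S₄ = proj₁ r₄
        x₄ : Same S₃ S₄ x
        x₄ = proj₁ (proj₂ r₄)
        y₄ : Same S₃ S₄ y
        y₄ = proj₁ (proj₂ (proj₂ r₄))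
        o₄ : Others-same S₃ S₄ p κ
        o₄ = proj₁ (proj₂ (proj₂ (proj₂ r₄)))
        κu₄ : M S₄ κ u ≡ u
        κu₄ = trans (proj₂ (proj₂ (proj₂ (proj₂ (proj₂ r₄))) u u≢x u≢y (inj₁ pu₃))) pu₃
        r₅ = recolour S₄ (trans (y₄ γ) (trans (y₃ γ) γy₂)) (trans (y₄ κ) (trans (y₃ κ) κy₂)) κu₄
        S₅ = proj₁ r₅
        γy₅ : M S₅ γ y ≡ y
        γy₅ = proj₁ (proj₂ r₅)
        v₅ : ∀ v → v ≢ y → v ≢ u → Same S₄ S₅ v
        v₅ = proj₁ (proj₂ (proj₂ (proj₂ (proj₂ r₅))))
        o₅ : Others-same S₄ S₅ γ κ
        o₅ = proj₂ (proj₂ (proj₂ (proj₂ (proj₂ r₅))))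
        x₅ : Same S₄ S₅ x
        x₅ = v₅ x (x≢y S) (≢-sym u≢x)
        xz₅ : M S₅ γ x ≡ z
        xz₅ = trans (x₅ γ) (trans (x₄ γ) (trans (x₃ γ) (trans (x₂ γ) (trans (x₁ γ) xz))))
        zw₅ : M S₅ q z ≡ w
        zw₅ = flip S₅ (trans (o₅ q w (g qx) (κ≢kw qw)) (trans (o₄ q w (≢-sym pq) (κ≢kw qw)) wz₃))
        q′w₅ : M S₅ q′ w ≡ w
        q′w₅ = trans (o₅ q′ w (g q′x) (κ≢kw q′w)) (trans (o₄ q′ w (≢-sym pq′) (κ≢kw q′w)) q′w₃)

      no-double-sharing : Shares2 S u → Shares2 S w → ⊥
      no-double-sharing (p , p′ , pp′ , (px , pu) , (p′x , p′u)) (q , q′ , qq′ , (qx , qw) , (q′x , q′w))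
        with p ≟ q | p ≟ q′ | p′ ≟ q | p′ ≟ q′
      ... | yes refl | _ | _ | _ = common-hole px pu qw p′x p′u (≢-sym pp′) q′x q′w (≢-sym qq′)
      ... | no _ | yes refl | _ | _ = common-hole px pu q′w p′x p′u (≢-sym pp′) qx qw qq′
      ... | no _ | no _ | yes refl | _ = common-hole p′x p′u qw px pu pp′ q′x q′w (≢-sym qq′)
      ... | no _ | no _ | no _ | yes refl = common-hole p′x p′u q′w px pu pp′ qx qw qq′
      ... | no a | no b | no c | no d = distinct-holes px pu p′x p′u qx qw q′x q′w pp′ qq′ a b c d

-- Counting missing colours

-- The pattern of the linear estimates below: the hypotheses are added up to `l ≤ r`, and the ring
-- solver exhibits the part `Z` common to both sides.
cancel : ∀ {l r X Y} Z → l ≤ r → X + Z ≡ l → r ≡ Y + Z → X ≤ Y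
cancel {X = X} {Y} Z le refl refl = +-cancelʳ-≤ Z X Y le

-- The hypotheses on `a`, `b`, `c` and their overlaps give 3p ≤ 3 + u + 6 + 3f ≤ h + 8 + 2f, and f ≤
-- 12 makes this h + 32, less than the assumed h + 38.
round-arith : ∀ h p f a b c u ab ac bc → h + 38 ≤ 3 * p → f ≤ 12 → u + f + 1 ≤ h →
  p ≤ 1 + (a + f) → p ≤ 1 + (b + f) → p ≤ 1 + (c + f) → a + b + c ≤ u + (ab + ac + bc) →
  ab ≤ 2 → ac ≤ 2 → bc ≤ 2 → ⊥
round-arith h p f a b c u ab ac bc hp f≤ u≤ pa pb pc abc ab≤ ac≤ bc≤ =
  1+n≰n (≤-trans (m≤m+n 33 5) (cancel {X = 38} {Y = 32} (h + (p + p + p) + (f + f) + (a + b + c) + u + f + 1 + (ab + ac + bc))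
    (+-mono-≤ hp (+-mono-≤ (+-mono-≤ f≤ f≤) (+-mono-≤ u≤ (+-mono-≤ (+-mono-≤ pa (+-mono-≤ pb pc))
       (+-mono-≤ abc (+-mono-≤ ab≤ (+-mono-≤ ac≤ bc≤)))))))
    (e₁ h p f a b c u ab ac bc) (e₂ h p f a b c u ab ac bc)))
  where
  e₁ : ∀ h p f a b c u ab ac bc →
    38 + (h + (p + p + p) + (f + f) + (a + b + c) + u + f + 1 + (ab + ac + bc))
    ≡ (h + 38) + ((f + f) + ((u + f + 1) + ((p + (p + p)) + ((a + b + c) + (ab + (ac + bc))))))
  e₁ = solve-∀
  e₂ : ∀ h p f a b c u ab ac bc →
    3 * p + ((12 + 12) + (h + (((1 + (a + f)) + ((1 + (b + f)) + (1 + (c + f)))) + ((u + (ab + ac + bc)) + (2 + (2 + 2))))))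
    ≡ 32 + (h + (p + p + p) + (f + f) + (a + b + c) + u + f + 1 + (ab + ac + bc))
  e₂ = solve-∀

#-three-sets : ∀ {n} {P Q R U : Fin n → Set} (P? : ∀ i → Dec (P i)) (Q? : ∀ i → Dec (Q i)) (R? : ∀ i → Dec (R i))
  (U? : ∀ i → Dec (U i)) → (∀ i → P i → U i) → (∀ i → Q i → U i) → (∀ i → R i → U i) →
  # P? + # Q? + # R? ≤ # U? + (# (λ i → P? i ×-dec Q? i) + # (λ i → P? i ×-dec R? i) + # (λ i → Q? i ×-dec R? i))
#-three-sets P? Q? R? U? pu qu ru = ≤-trans
    (≤-reflexive (trans (≡-sym (trans (sum-+ (λ i → indicator (P? i) + indicator (Q? i)) _) (cong (_+ # R?) (sum-+ (indicator ∘ P?) _)))) refl))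
    (≤-trans (sum-mono go) (≤-reflexive (trans (sum-+ (indicator ∘ U?) _) (cong (# U? +_)
      (trans (sum-+ (λ i → indicator (P? i ×-dec Q? i) + indicator (P? i ×-dec R? i)) _)
             (cong (_+ # (λ i → Q? i ×-dec R? i)) (sum-+ (λ i → indicator (P? i ×-dec Q? i)) _)))))))
  where
  go : ∀ i → indicator (P? i) + indicator (Q? i) + indicator (R? i) ≤
       indicator (U? i) + (indicator (P? i ×-dec Q? i) + indicator (P? i ×-dec R? i) + indicator (Q? i ×-dec R? i))
  go i with P? i | Q? i | R? i
  ... | yes p | yes _ | yes _ rewrite indicator-yes (U? i) (pu i p) = s≤s (s≤s (s≤s z≤n))
  ... | yes p | yes _ | no _  rewrite indicator-yes (U? i) (pu i p) = ≤-refl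
  ... | yes p | no _  | yes _ rewrite indicator-yes (U? i) (pu i p) = ≤-refl
  ... | yes p | no _  | no _  rewrite indicator-yes (U? i) (pu i p) = ≤-refl
  ... | no _  | yes q | yes _ rewrite indicator-yes (U? i) (qu i q) = ≤-refl
  ... | no _  | yes q | no _  rewrite indicator-yes (U? i) (qu i q) = ≤-refl
  ... | no _  | no _  | yes r rewrite indicator-yes (U? i) (ru i r) = ≤-refl
  ... | no _  | no _  | no _  = z≤n

module Degrees {n} (G : Graph n) (k : ℕ) (uncolourable : ¬ ColourableWith (adj G) k) where

  open Recolouring G k uncolourable public
  open DecMembership (_≟_ {k}) using (_∈?_)

  Adj? : ∀ u v → Dec (Adj u v)
  Adj? u v = T? (adj G u v)

  deg : Vertex → ℕ
  deg v = # (Adj? v)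

  Hole : ∀ {x y} → State x y → Vertex → Colour → Set
  Hole S v κ = M S κ v ≡ v

  Hole? : ∀ {x y} (S : State x y) v κ → Dec (Hole S v κ)
  Hole? S v κ = M S κ v ≟ v

  module _ {x y} (S : State x y) where

    along : Vertex → Colour → Vertex → Set
    along v κ w = M S κ v ≡ w × w ≢ v

    along-injective : ∀ v κ μ w → along v κ w → along v μ w → κ ≡ μ
    along-injective v κ μ w (p , ne) (q , _) = same-colour S p q ne

    holes-≥ : ∀ v → k ≤ # (Hole? S v) + deg v
    holes-≥ v = ≤-trans (≤-reflexive (≡-sym (#-¬ (Hole? S v)))) (+-monoʳ-≤ (# (Hole? S v))
      (#-inject (λ κ → ¬? (Hole? S v κ)) (Adj? v) (along v) (λ κ h → M S κ v , edge-of S κ v h , refl , h)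
        (along-injective v)))

    -- One edge at `v` carries no colour, which gains one missing colour over `holes-≥`.
    uncoloured-end : ∀ v w → Adj v w → (∀ κ → M S κ v ≢ w) → suc k ≤ # (Hole? S v) + deg v
    uncoloured-end v w a u = ≤-trans (s≤s (≤-reflexive (≡-sym (#-¬ (Hole? S v)))))
      (≤-trans (≤-reflexive (≡-sym (+-suc (# (Hole? S v)) _))) (+-monoʳ-≤ (# (Hole? S v))
      (≤-trans (s≤s (#-inject (λ κ → ¬? (Hole? S v κ)) (λ w′ → Adj? v w′ ×-dec ¬? (w′ ≟ w)) (along v)
        (λ κ h → M S κ v , (edge-of S κ v h , u κ) , refl , h) (along-injective v)))
        (≤-reflexive (≡-sym (#-remove (Adj? v) w a))))))

    holes-x : suc k ≤ # (Hole? S x) + deg x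
    holes-x = uncoloured-end x y (adjacent S) (uncoloured S)

    holes-y : suc k ≤ # (Hole? S y) + deg y
    holes-y = uncoloured-end y x (Adj-sym (adjacent S)) (λ κ e → uncoloured S κ (flip S e))

    nonholes-x : suc (# (λ κ → ¬? (Hole? S x κ))) ≤ deg x
    nonholes-x = +-cancelˡ-≤ (# (Hole? S x)) _ _ (≤-trans (≤-reflexive
      (trans (+-suc (# (Hole? S x)) _) (cong suc (#-¬ (Hole? S x))))) holes-x)

    module _ (deg≤k : ∀ v → deg v ≤ k) where
      hole-at-y : ∃ (Hole S y)
      hole-at-y = #-some (Hole? S y) (+-cancelʳ-≤ (deg y) _ _ (≤-trans (s≤s (deg≤k y)) holes-y))

      hole-at-x : ∃ (Hole S x)
      hole-at-x = #-some (Hole? S x) (+-cancelʳ-≤ (deg x) _ _ (≤-trans (s≤s (deg≤k x)) holes-x))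

    -- By `no-common-hole` the ends of the uncoloured edge miss disjoint sets of colours, of sizes
    -- at least k + 1 - deg x and k + 1 - deg y.
    degree-sum : k + 2 ≤ deg x + deg y
    degree-sum = cancel (# (Hole? S x) + # (Hole? S y) + k)
      (+-mono-≤ disjoint (+-mono-≤ holes-x holes-y))
      (e₁ (# (Hole? S x)) (# (Hole? S y)) k) (e₂ (# (Hole? S x)) (# (Hole? S y)) k (deg x) (deg y))
      where
      disjoint : # (Hole? S x) + # (Hole? S y) ≤ k
      disjoint = ≤-trans (#-disjoint (Hole? S x) (Hole? S y) (λ κ → T? true) (λ _ _ → tt) (λ _ _ → tt)
        (λ κ p q → no-common-hole S p q)) (#-≤ (λ κ → T? true))
      e₁ : ∀ a b k → (k + 2) + (a + b + k) ≡ (a + b) + (suc k + suc k)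
      e₁ = solve-∀
      e₂ : ∀ a b k c d → k + ((a + c) + (b + d)) ≡ (c + d) + (a + b + k)
      e₂ = solve-∀

  -- At least k + 1 - deg x colours are missing at `x` and k - deg v at `v`; by the hypothesis these
  -- numbers add up to at least k + 2.
  shares2-by-degree : ∀ {x y} (S : State x y) v → deg v + deg x + 1 ≤ k → Shares2 S v
  shares2-by-degree {x} S v le = let (α , α′ , p , q , ne) = #-two (λ κ → Hole? S x κ ×-dec Hole? S v κ) two in
    α , α′ , ne , p , q
    where
    hx hv both : ℕ
    hx = # (Hole? S x)
    hv = # (Hole? S v)
    both = # (λ κ → Hole? S x κ ×-dec Hole? S v κ)
    incl : hx + hv ≤ k + both
    incl = ≤-trans (+-monoˡ-≤ hv (≤-reflexive (#-split (Hole? S x) (Hole? S v))))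
      (≤-trans (≤-reflexive (trans (+-assoc both _ hv) (+-comm both _))) (+-monoˡ-≤ both
        (≤-trans (#-disjoint (λ κ → Hole? S x κ ×-dec ¬? (Hole? S v κ)) (Hole? S v) (λ κ → T? true)
          (λ _ _ → tt) (λ _ _ → tt) (λ κ p q → proj₂ p q)) (#-≤ (λ κ → T? true)))))
    e₁ : ∀ dv dx a b k → 2 + (dv + dx + k + k + a + b) ≡ (dv + dx + 1) + (suc k + (k + (a + b)))
    e₁ = solve-∀
    e₂ : ∀ dv dx a b k c → k + ((a + dx) + ((b + dv) + (k + c))) ≡ c + (dv + dx + k + k + a + b)
    e₂ = solve-∀
    two : 2 ≤ both
    two = cancel (deg v + deg x + k + k + hx + hv) (+-mono-≤ le (+-mono-≤ (holes-x S) (+-mono-≤ (holes-≥ S v) incl)))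
      (e₁ (deg v) (deg x) hx hv k) (e₂ (deg v) (deg x) hx hv k both)

  -- The colours in `F` are frozen, so that edges and missing colours already relied upon survive
  -- the later exchanges.
  Agree : ∀ {x y} → State x y → State x y → List Colour → Set
  Agree S S′ F = ∀ κ → κ ∈ F → ∀ v → M S′ κ v ≡ M S κ v

  module _ {x y : Vertex} (F : List Colour) {a b : Vertex} (a≢b : a ≢ b) (a≢x : a ≢ x) (b≢x : b ≢ x) where

    Fresh : State x y → Colour → Set
    Fresh S α = Hole S x α × α ∉ F

    Common : State x y → Colour → Set
    Common S η = (Hole S a η × Hole S b η) × ¬ Hole S x η × η ∉ F

    abstract
      -- Exchanging a colour α missing at `x` with a colour η missing at both `a` and `b` hands α to
      -- whichever of the two is off the path from `x`.
      give : (S : State x y) {α η : Colour} → Fresh S α → Common S η →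
             Σ[ S′ ∈ State x y ] (Same S S′ x × Agree S S′ F × Others-same S S′ α η × (Hole S′ a α ⊎ Hole S′ b α))
      give S {α} {η} (αx , α∉) ((ηa , ηb) , _ , η∉) with awayPair S α η αx a b a≢b a≢x b≢x (inj₂ ηa) (inj₂ ηb)
      ... | S′ , x′ , o , e = S′ , x′ , (λ κ κ∈ v → o κ v (λ { refl → α∉ κ∈ }) (λ { refl → η∉ κ∈ })) , o ,
            [ (λ z → inj₁ (trans (proj₁ z) ηa)) , (λ z → inj₂ (trans (proj₁ z) ηb)) ]′ e

    ≢-holes : (S : State x y) → ∀ {α η} → Fresh S α → Common S η → η ≢ α
    ≢-holes S f c refl = proj₁ (proj₂ c) (proj₁ f)

    keep-fresh : (S S′ : State x y) → Same S S′ x → ∀ {α} → Fresh S α → Fresh S′ α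
    keep-fresh S S′ s {α} (αx , α∉) = trans (s α) αx , α∉

    keep-common : (S S′ : State x y) → Same S S′ x → ∀ {α₀ η₀} → Others-same S S′ α₀ η₀ →
                  ∀ {η} → η ≢ α₀ → η ≢ η₀ → Common S η → Common S′ η
    keep-common S S′ s o {η} p q ((ηa , ηb) , ηx , η∉) =
      (trans (o η a p q) ηa , trans (o η b p q) ηb) , (λ e → ηx (trans (≡-sym (s η)) e)) , η∉

    -- Three exchanges of distinct colour pairs; each gives a or b a new hole shared with x,
    -- so one of the two gets two of them.
    give-two : (S : State x y) {α₁ α₂ α₃ η₁ η₂ η₃ : Colour} →
               Fresh S α₁ → Fresh S α₂ → Fresh S α₃ → α₁ ≢ α₂ → α₁ ≢ α₃ → α₂ ≢ α₃ →
               Common S η₁ → Common S η₂ → Common S η₃ → η₁ ≢ η₂ → η₁ ≢ η₃ → η₂ ≢ η₃ →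
               Σ[ S′ ∈ State x y ] (Same S S′ x × Agree S S′ F × (Shares2 S′ a ⊎ Shares2 S′ b))
    give-two S {α₁} {α₂} {α₃} {η₁} {η₂} {η₃} f₁ f₂ f₃ a12 a13 a23 c₁ c₂ c₃ h12 h13 h23 =
      S₃ , (λ κ → trans (x₃ κ) (trans (x₂ κ) (x₁ κ))) ,
      (λ κ κ∈ v → trans (g₃ κ κ∈ v) (trans (g₂ κ κ∈ v) (g₁ κ κ∈ v))) ,
      pick (proj₂ (proj₂ (proj₂ (proj₂ r₁)))) (proj₂ (proj₂ (proj₂ (proj₂ r₂)))) (proj₂ (proj₂ (proj₂ (proj₂ r₃))))
      where
      n12 : η₂ ≢ α₁
      n12 = ≢-holes S f₁ c₂
      n13 : η₃ ≢ α₁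
      n13 = ≢-holes S f₁ c₃
      n23 : η₃ ≢ α₂
      n23 = ≢-holes S f₂ c₃
      r₁ = give S f₁ c₁
      S₁ : State x y
      S₁ = proj₁ r₁
      x₁ : Same S S₁ x
      x₁ = proj₁ (proj₂ r₁)
      g₁ : Agree S S₁ F
      g₁ = proj₁ (proj₂ (proj₂ r₁))
      o₁ : Others-same S S₁ α₁ η₁
      o₁ = proj₁ (proj₂ (proj₂ (proj₂ r₁)))
      f₃₁ : Fresh S₁ α₃
      f₃₁ = keep-fresh S S₁ x₁ f₃
      c₃₁ : Common S₁ η₃
      c₃₁ = keep-common S S₁ x₁ o₁ n13 (≢-sym h13) c₃
      r₂ = give S₁ (keep-fresh S S₁ x₁ f₂) (keep-common S S₁ x₁ o₁ n12 (≢-sym h12) c₂)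
      S₂ : State x y
      S₂ = proj₁ r₂
      x₂ : Same S₁ S₂ x
      x₂ = proj₁ (proj₂ r₂)
      g₂ : Agree S₁ S₂ F
      g₂ = proj₁ (proj₂ (proj₂ r₂))
      o₂ : Others-same S₁ S₂ α₂ η₂
      o₂ = proj₁ (proj₂ (proj₂ (proj₂ r₂)))
      r₃ = give S₂ (keep-fresh S₁ S₂ x₂ f₃₁) (keep-common S₁ S₂ x₂ o₂ n23 (≢-sym h23) c₃₁)
      S₃ : State x y
      S₃ = proj₁ r₃
      x₃ : Same S₂ S₃ x
      x₃ = proj₁ (proj₂ r₃)
      g₃ : Agree S₂ S₃ F
      g₃ = proj₁ (proj₂ (proj₂ r₃))
      o₃ : Others-same S₂ S₃ α₃ η₃
      o₃ = proj₁ (proj₂ (proj₂ (proj₂ r₃)))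
      hx : ∀ α → Hole S x α → Hole S₃ x α
      hx α αx = trans (x₃ α) (trans (x₂ α) (trans (x₁ α) αx))
      k₁ : ∀ {v} → Hole S₁ v α₁ → Hole S₃ v α₁
      k₁ {v} q = trans (o₃ α₁ v a13 (≢-sym n13)) (trans (o₂ α₁ v a12 (≢-sym n12)) q)
      k₂ : ∀ {v} → Hole S₂ v α₂ → Hole S₃ v α₂
      k₂ {v} q = trans (o₃ α₂ v a23 (≢-sym n23)) q
      pick : Hole S₁ a α₁ ⊎ Hole S₁ b α₁ → Hole S₂ a α₂ ⊎ Hole S₂ b α₂ → Hole S₃ a α₃ ⊎ Hole S₃ b α₃ →
             Shares2 S₃ a ⊎ Shares2 S₃ b
      pick (inj₁ p) (inj₁ q) _ = inj₁ (α₁ , α₂ , a12 , (hx α₁ (proj₁ f₁) , k₁ p) , (hx α₂ (proj₁ f₂) , k₂ q))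
      pick (inj₂ p) (inj₂ q) _ = inj₂ (α₁ , α₂ , a12 , (hx α₁ (proj₁ f₁) , k₁ p) , (hx α₂ (proj₁ f₂) , k₂ q))
      pick (inj₁ p) _ (inj₁ q) = inj₁ (α₁ , α₃ , a13 , (hx α₁ (proj₁ f₁) , k₁ p) , (hx α₃ (proj₁ f₃) , q))
      pick (inj₂ p) _ (inj₂ q) = inj₂ (α₁ , α₃ , a13 , (hx α₁ (proj₁ f₁) , k₁ p) , (hx α₃ (proj₁ f₃) , q))
      pick _ (inj₁ p) (inj₁ q) = inj₁ (α₂ , α₃ , a23 , (hx α₂ (proj₁ f₂) , k₂ p) , (hx α₃ (proj₁ f₃) , q))
      pick _ (inj₂ p) (inj₂ q) = inj₂ (α₂ , α₃ , a23 , (hx α₂ (proj₁ f₂) , k₂ p) , (hx α₃ (proj₁ f₃) , q))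

  -- Among x and three vertices of degree at most h some two share many missing colours, because
  -- together they miss about 4p > k colours.
  module Round (h p : ℕ) (k≡ : k ≡ p + h) (p≤h : p ≤ h) (38≤ : h + 38 ≤ 3 * p)
               {x y : Vertex} (S : State x y) (dx : deg x ≤ h) (F : List Colour) (F≤ : length F ≤ 12) where

    X? : ∀ κ → Dec (Hole S x κ)
    X? = Hole? S x

    Y : Vertex → Colour → Set
    Y v κ = Hole S v κ × ¬ Hole S x κ × κ ∉ F

    Y? : ∀ v κ → Dec (Y v κ)
    Y? v κ = Hole? S v κ ×-dec ¬? (X? κ) ×-dec ¬? (κ ∈? F)

    U? : ∀ κ → Dec (¬ Hole S x κ × κ ∉ F)
    U? κ = ¬? (X? κ) ×-dec ¬? (κ ∈? F)

    V? : ∀ κ → Dec (¬ Hole S x κ × κ ∈ F)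
    V? κ = ¬? (X? κ) ×-dec (κ ∈? F)

    f≤ : # V? ≤ 12
    f≤ = ≤-trans (#-list V? F (λ κ q → proj₂ q)) F≤

    u≤ : # U? + # V? + 1 ≤ h
    u≤ = ≤-trans (≤-reflexive (+-comm (# U? + # V?) 1)) (≤-trans (s≤s (#-disjoint U? V? (λ κ → ¬? (X? κ))
           (λ κ → proj₁) (λ κ → proj₁) (λ κ a b → proj₂ a (proj₂ b)))) (≤-trans (nonholes-x S) dx))

    p≤holes : ∀ v → deg v ≤ h → p ≤ # (Hole? S v)
    p≤holes v dv = +-cancelʳ-≤ h _ _ (≤-trans (≤-reflexive (≡-sym k≡)) (≤-trans (holes-≥ S v) (+-monoʳ-≤ (# (Hole? S v)) dv)))

    y≥ : ∀ v → deg v ≤ h → # (λ κ → X? κ ×-dec Hole? S v κ) ≤ 1 → p ≤ 1 + (# (Y? v) + # V?)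
    y≥ v dv le = ≤-trans (p≤holes v dv) (≤-trans
      (#-∪ (Hole? S v) (λ κ → X? κ ×-dec Hole? S v κ) (λ κ → Hole? S v κ ×-dec ¬? (X? κ)) s₁)
      (+-mono-≤ le (#-∪ (λ κ → Hole? S v κ ×-dec ¬? (X? κ)) (Y? v) V? s₂)))
      where
      s₁ : ∀ κ → Hole S v κ → (Hole S x κ × Hole S v κ) ⊎ (Hole S v κ × ¬ Hole S x κ)
      s₁ κ q with X? κ
      ... | yes z = inj₁ (z , q)
      ... | no z  = inj₂ (q , z)
      s₂ : ∀ κ → Hole S v κ × ¬ Hole S x κ → Y v κ ⊎ (¬ Hole S x κ × κ ∈ F)
      s₂ κ (q , z) with κ ∈? F
      ... | yes m = inj₂ (z , m)
      ... | no m  = inj₁ (q , z , m)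

    -- At least p + 1 colours are missing at `x`, and `38≤` together with `p ≤ h` yields p ≥ 19. So
    -- even after removing 12 frozen colours, 8 remain.
    fresh : 3 ≤ # (λ κ → X? κ ×-dec ¬? (κ ∈? F))
    fresh = fresh-arith (# X?) _ (deg x) p h
        (≤-trans (≤-reflexive (cong suc (≡-sym k≡))) (holes-x S)) dx p≤h 38≤
        (≤-trans (#-∪ X? (λ κ → X? κ ×-dec ¬? (κ ∈? F)) (_∈? F) s) (+-monoʳ-≤ _ (≤-trans (#-list (_∈? F) F (λ _ m → m)) F≤)))
      where
      s : ∀ κ → Hole S x κ → (Hole S x κ × κ ∉ F) ⊎ κ ∈ F
      s κ q with κ ∈? F
      ... | yes m = inj₂ m
      ... | no m  = inj₁ (q , m)
      fresh-arith : ∀ H q d p h → suc (p + h) ≤ H + d → d ≤ h → p ≤ h → h + 38 ≤ 3 * p → H ≤ q + 12 → 3 ≤ q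
      fresh-arith H q d p h a b c e g = ≤-trans (m≤m+n 3 5) (*-cancelˡ-≤ 2
        (cancel {X = 16} (3 * p + 3 * h + 2 * d + 2 * H + 24)
        (+-mono-≤ (+-mono-≤ a a) (+-mono-≤ (+-mono-≤ b b) (+-mono-≤ c (+-mono-≤ e (+-mono-≤ g g)))))
        (i H d p h) (j H q d p h)))
        where
        i : ∀ H d p h → 16 + (3 * p + 3 * h + 2 * d + 2 * H + 24)
            ≡ (suc (p + h) + suc (p + h)) + ((d + d) + (p + ((h + 38) + (H + H))))
        i = solve-∀
        j : ∀ H q d p h → ((H + d) + (H + d)) + ((h + h) + (h + (3 * p + ((q + 12) + (q + 12)))))
            ≡ 2 * q + (3 * p + 3 * h + 2 * d + 2 * H + 24)
        j = solve-∀

    Result : Vertex → Set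
    Result v = Σ[ S′ ∈ State x y ] (Same S S′ x × Agree S S′ F × Shares2 S′ v)

    sharing : ∀ v → Result v ⊎ # (λ κ → X? κ ×-dec Hole? S v κ) ≤ 1
    sharing v with 2 ≤? # (λ κ → X? κ ×-dec Hole? S v κ)
    ... | no z = inj₂ (≤-pred (≰⇒> z))
    ... | yes z with #-two (λ κ → X? κ ×-dec Hole? S v κ) z
    ...   | α , α′ , q , q′ , ne = inj₁ (S , (λ _ → refl) , (λ _ _ _ → refl) , α , α′ , ne , q , q′)

    paired : ∀ a b → a ≢ b → a ≢ x → b ≢ x → (Result a ⊎ Result b) ⊎ # (λ κ → Y? a κ ×-dec Y? b κ) ≤ 2
    paired a b a≢b a≢x b≢x = decide (3 ≤? # (λ κ → Y? a κ ×-dec Y? b κ))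
      where
      common : ∀ {η} → Y a η × Y b η → Common F a≢b a≢x b≢x S η
      common ((ηa , ηx , η∉) , (ηb , _)) = (ηa , ηb) , ηx , η∉
      result : Σ[ S′ ∈ State x y ] (Same S S′ x × Agree S S′ F × (Shares2 S′ a ⊎ Shares2 S′ b)) → Result a ⊎ Result b
      result (S′ , x′ , g , inj₁ s) = inj₁ (S′ , x′ , g , s)
      result (S′ , x′ , g , inj₂ s) = inj₂ (S′ , x′ , g , s)
      decide : Dec (3 ≤ # (λ κ → Y? a κ ×-dec Y? b κ)) → (Result a ⊎ Result b) ⊎ # (λ κ → Y? a κ ×-dec Y? b κ) ≤ 2
      decide (no z)  = inj₂ (≤-pred (≰⇒> z))
      decide (yes z) =
        let (η₁ , η₂ , η₃ , q₁ , q₂ , q₃ , n₁ , n₂ , n₃) = #-three (λ κ → Y? a κ ×-dec Y? b κ) z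
            (α₁ , α₂ , α₃ , f₁ , f₂ , f₃ , m₁ , m₂ , m₃) = #-three (λ κ → X? κ ×-dec ¬? (κ ∈? F)) fresh
        in inj₁ (result (give-two F a≢b a≢x b≢x S f₁ f₂ f₃ m₁ m₂ m₃ (common q₁) (common q₂) (common q₃) n₁ n₂ n₃))

    abstract
      -- When no pair of shared colours can be produced, the sets `Y` of the three vertices have
      -- about p elements and meet pairwise in at most two; they do not fit among the fewer than h
      -- colours present at `x`.
      round : ∀ a b c → a ≢ b → a ≢ c → b ≢ c → a ≢ x → b ≢ x → c ≢ x → deg a ≤ h → deg b ≤ h → deg c ≤ h →
              Result a ⊎ Result b ⊎ Result c
      round a b c ab ac bc ax bx cx da db dc with sharing a | sharing b | sharing c
      ... | inj₁ r | _ | _ = inj₁ r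
      ... | inj₂ _ | inj₁ r | _ = inj₂ (inj₁ r)
      ... | inj₂ _ | inj₂ _ | inj₁ r = inj₂ (inj₂ r)
      ... | inj₂ sa | inj₂ sb | inj₂ sc with paired a b ab ax bx | paired a c ac ax cx | paired b c bc bx cx
      ...   | inj₁ (inj₁ r) | _ | _ = inj₁ r
      ...   | inj₁ (inj₂ r) | _ | _ = inj₂ (inj₁ r)
      ...   | inj₂ _ | inj₁ (inj₁ r) | _ = inj₁ r
      ...   | inj₂ _ | inj₁ (inj₂ r) | _ = inj₂ (inj₂ r)
      ...   | inj₂ _ | inj₂ _ | inj₁ (inj₁ r) = inj₂ (inj₁ r)
      ...   | inj₂ _ | inj₂ _ | inj₁ (inj₂ r) = inj₂ (inj₂ r)
      ...   | inj₂ p₁ | inj₂ p₂ | inj₂ p₃ = ⊥-elim (round-arith h p (# V?) (# (Y? a)) (# (Y? b)) (# (Y? c)) (# U?) _ _ _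
                38≤ f≤ u≤ (y≥ a da sa) (y≥ b db sb) (y≥ c dc sc)
                (#-three-sets (Y? a) (Y? b) (Y? c) U? (λ κ → proj₂) (λ κ → proj₂) (λ κ → proj₂)) p₁ p₂ p₃)

-- Colours that lead to the set A

module SecondOrder {n} (G : Graph n) (k : ℕ) (uncolourable : ¬ ColourableWith (adj G) k)
                   (deg≤k : ∀ v → Degrees.deg G k uncolourable v ≤ k)
                   {A : Fin n → Set} (A? : ∀ v → Dec (A v)) where

  open Degrees G k uncolourable

  -- `Θ` consists of the colours that do not lead from `v` to a vertex outside `A`; in every
  -- colouring there are at least `m v` of them.
  Γ Θ : ∀ {x y} → State x y → Vertex → Colour → Set
  Γ S v κ = M S κ v ≢ v × A (M S κ v)
  Θ S v κ = M S κ v ≡ v ⊎ A (M S κ v)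

  Γ? : ∀ {x y} (S : State x y) v κ → Dec (Γ S v κ)
  Γ? S v κ = ¬? (M S κ v ≟ v) ×-dec A? (M S κ v)

  Θ? : ∀ {x y} (S : State x y) v κ → Dec (Θ S v κ)
  Θ? S v κ = (M S κ v ≟ v) ⊎-dec A? (M S κ v)

  -- If both were empty, `Θ S z` would, apart from γ, avoid `Θ S y` and all colours missing at `x`.
  -- So these are the exceptions in the comparison of `m z` with `m y`.
  E₁ E₂ : ∀ {x y} → State x y → Colour → Vertex → Colour → Set
  E₁ {x} {y} S γ z κ = κ ≢ γ × (Hole S x κ ⊎ Hole S y κ) × Θ S z κ
  E₂ {x} {y} S γ z κ = κ ≢ γ × Γ S y κ × Θ S z κ

  E₁? : ∀ {x y} (S : State x y) γ z κ → Dec (E₁ S γ z κ)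
  E₁? {x} {y} S γ z κ = ¬? (κ ≟ γ) ×-dec (Hole? S x κ ⊎-dec Hole? S y κ) ×-dec Θ? S z κ

  E₂? : ∀ {x y} (S : State x y) γ z κ → Dec (E₂ S γ z κ)
  E₂? {x} {y} S γ z κ = ¬? (κ ≟ γ) ×-dec Γ? S y κ ×-dec Θ? S z κ

  -- A vertex of A that shares two missing colours with x is excluded by the recolouring lemmas from each of
  -- the following places; c bounds the number of colours leading to other vertices of A.
  record FewExceptions (c : ℕ) (x : Vertex) : Set₁ where
    field
      few-fan : ∀ {y} (S : State x y) → # (λ κ → Hole? S x κ ×-dec Γ? S y κ) ≤ c
      few-fixed : ∀ {y} (S : State x y) {Q : Colour → Set} (Q? : ∀ κ → Dec (Q κ)) → (∀ κ → Q κ → Γ S y κ) →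
                  (∀ κ → Q κ → ∀ (S′ : State x y) → Same S S′ x → Hole S′ y κ → ⊥) → # Q? ≤ c
      few-E₁ : ∀ {y} (S : State x y) {γ z} → M S γ y ≡ y → M S γ x ≡ z → z ≢ x → # (E₁? S γ z) ≤ c
      few-E₂ : ∀ {y} (S : State x y) {γ z} → M S γ y ≡ y → M S γ x ≡ z → z ≢ x → # (E₂? S γ z) ≤ c + c

  module _ {x y} (S : State x y) where

    fan-⊥ : ∀ {κ u} → Hole S x κ → M S κ y ≡ u → u ≢ y → Shares2 S u → ⊥
    fan-⊥ kx e u≢y (α , _ , _ , (αx , αu) , _) = no-shared-neighbour S (proj₂ (hole-at-y S deg≤k)) kx e u≢y αx αu

    -- By `free` the colour κ can become missing at `y` while `x` keeps its colours, which is what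
    -- the last hypothesis forbids.
    fixed-⊥ : ∀ {κ u} → M S κ y ≡ u → u ≢ y → Shares2 S u → (∀ (S′ : State x y) → Same S S′ x → Hole S′ y κ → ⊥) → ⊥
    fixed-⊥ e u≢y (α , _ , _ , (αx , αu) , _) bad =
      let (S′ , x′ , h) = free S (proj₂ (hole-at-y S deg≤k)) e u≢y αx αu in bad S′ x′ h

    module _ {γ z} (my : M S γ y ≡ y) (xz : M S γ x ≡ z) (z≢x : z ≢ x) where

      neighbour≢x : ∀ {κ} → κ ≢ γ → M S κ z ≢ x
      neighbour≢x ne e = ne (same-colour S (flip S e) xz z≢x)

      E₁-seen : ∀ {κ} → κ ≢ γ → Hole S x κ ⊎ Hole S y κ → M S κ z ≢ z
      E₁-seen ne (inj₁ kx) = x-hole-used-at-z S my xz z≢x kx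
      E₁-seen ne (inj₂ ky) = y-hole-used-at-z S my xz z≢x (proj₂ (hole-at-x S deg≤k)) ky ne

      E₁-⊥ : ∀ {κ w} → κ ≢ γ → Hole S x κ ⊎ Hole S y κ → M S κ z ≡ w → w ≢ z → Shares2 S w → ⊥
      E₁-⊥ ne (inj₁ kx) e w≢z (α , _ , _ , (αx , αw) , _) = no-shared-second-neighbour S my xz z≢x kx e w≢z αx αw
      E₁-⊥ ne (inj₂ ky) refl w≢z s = no-sharing-along-y-hole S my xz z≢x ky ne refl w≢z (neighbour≢x ne) s

  module Sharing (x : Vertex) (low : ∀ a → A a → deg a + deg x + 1 ≤ k) where

    sh : ∀ {y} (S : State x y) {a} → A a → Shares2 S a
    sh S {a} Aa = shares2-by-degree S a (low a Aa)

    no-exceptions : FewExceptions 0 x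
    no-exceptions = record
      { few-fan = λ S → ≤-reflexive (#-∅ (λ κ → Hole? S x κ ×-dec Γ? S _ κ)
          (λ κ (kx , ne , Au) → fan-⊥ S kx refl ne (sh S Au)))
      ; few-fixed = λ S Q? g bad → ≤-reflexive (#-∅ Q?
          (λ κ q → fixed-⊥ S refl (proj₁ (g κ q)) (sh S (proj₂ (g κ q))) (bad κ q)))
      ; few-E₁ = λ S {γ} {z} my xz z≢x → ≤-reflexive (#-∅ (E₁? S γ z) (λ κ (ne , h , θ) →
          E₁-⊥ S my xz z≢x ne h refl (E₁-seen S my xz z≢x ne h)
            (sh S ([ (λ e → contradiction e (E₁-seen S my xz z≢x ne h)) , id ]′ θ))))
      ; few-E₂ = λ S {γ} {z} my xz z≢x → ≤-reflexive (#-∅ (E₂? S γ z) (λ κ (ne , (u≢y , Au) , θ) →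
          let seen = no-hole-beside-sharing S my xz z≢x refl u≢y (sh S Au) in
          no-double-sharing S my xz z≢x refl u≢y refl seen (sh S Au)
            (sh S ([ (λ e → contradiction e seen) , id ]′ θ)))) }

  module Rounds (h p : ℕ) (k≡ : k ≡ p + h) (p≤h : p ≤ h) (38≤ : h + 38 ≤ 3 * p)
                (low : ∀ a → A a → deg a ≤ h) (x : Vertex) (dx : deg x ≤ h) where

    module _ {y} (S : State x y) (v : Vertex) (F : List Colour) (F≤ : length F ≤ 12)
             {P : Colour → Set} (Γ′ : ∀ {κ} → P κ → Γ S v κ) (≢x : ∀ {κ} → P κ → M S κ v ≢ x) where

      -- κ is the colour whose end now shares two missing colours with `x`. The other two are
      -- returned as well because later rounds use them again.
      record Picked : Set where
        constructor picked
        field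
          S′     : State x y
          x-same : Same S S′ x
          agree  : Agree S S′ F
          κ κ′ κ″ : Colour
          Pκ     : P κ
          Pκ′     : P κ′
          Pκ″    : P κ″
          κ≢κ′    : κ ≢ κ′
          κ≢κ″    : κ ≢ κ″
          κ′≢κ″    : κ′ ≢ κ″
          shares : Shares2 S′ (M S κ v)

      pick3 : ∀ {κ₁ κ₂ κ₃} → P κ₁ → P κ₂ → P κ₃ → κ₁ ≢ κ₂ → κ₁ ≢ κ₃ → κ₂ ≢ κ₃ → Picked
      pick3 {κ₁} {κ₂} {κ₃} p₁ p₂ p₃ n₁₂ n₁₃ n₂₃ = result
          (Round.round h p k≡ p≤h 38≤ S dx F F≤ (M S κ₁ v) (M S κ₂ v) (M S κ₃ v)
            (differ p₁ p₂ n₁₂) (differ p₁ p₃ n₁₃) (differ p₂ p₃ n₂₃) (≢x p₁) (≢x p₂) (≢x p₃)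
            (low _ (proj₂ (Γ′ p₁))) (low _ (proj₂ (Γ′ p₂))) (low _ (proj₂ (Γ′ p₃))))
        where
        differ : ∀ {κ μ} → P κ → P μ → κ ≢ μ → M S κ v ≢ M S μ v
        differ pκ pμ ne e = ne (proper S _ _ v e (proj₁ (Γ′ pκ)))
        R : Vertex → Set
        R a = Σ[ S′ ∈ State x y ] (Same S S′ x × Agree S S′ F × Shares2 S′ a)
        result : R (M S κ₁ v) ⊎ R (M S κ₂ v) ⊎ R (M S κ₃ v) → Picked
        result (inj₁ (S′ , a , b , s)) = picked S′ a b κ₁ κ₂ κ₃ p₁ p₂ p₃ n₁₂ n₁₃ n₂₃ s
        result (inj₂ (inj₁ (S′ , a , b , s))) = picked S′ a b κ₂ κ₁ κ₃ p₂ p₁ p₃ (≢-sym n₁₂) n₂₃ n₁₃ s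
        result (inj₂ (inj₂ (S′ , a , b , s))) = picked S′ a b κ₃ κ₁ κ₂ p₃ p₁ p₂ (≢-sym n₁₃) (≢-sym n₂₃) n₁₂ s

    open Picked

    at-most-two : {P : Colour → Set} (P? : ∀ κ → Dec (P κ)) →
      (∀ κ₁ κ₂ κ₃ → P κ₁ → P κ₂ → P κ₃ → κ₁ ≢ κ₂ → κ₁ ≢ κ₃ → κ₂ ≢ κ₃ → ⊥) → # P? ≤ 2
    at-most-two P? bad = decide (3 ≤? # P?)
      where
      decide : Dec (3 ≤ # P?) → # P? ≤ 2
      decide (no z)  = ≤-pred (≰⇒> z)
      decide (yes z) = let (a , b , c , pa , pb , pc , ab , ac , bc) = #-three P? z in
                       ⊥-elim (bad a b c pa pb pc ab ac bc)

    at-most-four : {P : Colour → Set} (P? : ∀ κ → Dec (P κ)) →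
      (∀ κ₁ κ₂ κ₃ κ₄ κ₅ → P κ₁ → P κ₂ → P κ₃ → P κ₄ → P κ₅ → κ₁ ≢ κ₂ → κ₁ ≢ κ₃ → κ₂ ≢ κ₃ →
         κ₁ ≢ κ₄ → κ₂ ≢ κ₄ → κ₃ ≢ κ₄ → κ₁ ≢ κ₅ → κ₂ ≢ κ₅ → κ₃ ≢ κ₅ → κ₄ ≢ κ₅ → ⊥) → # P? ≤ 4
    at-most-four {P} P? bad = decide (5 ≤? # P?)
      where
      decide : Dec (5 ≤ # P?) → # P? ≤ 4
      decide (no z)  = ≤-pred (≰⇒> z)
      decide (yes z) =
        let (e , pe , z′) = #-pick P? 4 z
            (d , (pd , de) , z″) = #-pick (λ κ → P? κ ×-dec ¬? (κ ≟ e)) 3 z′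
            (a , b , c , ((pa , ae) , ad) , ((pb , be) , bd) , ((pc , ce) , cd) , ab , ac , bc) =
              #-three (λ κ → (P? κ ×-dec ¬? (κ ≟ e)) ×-dec ¬? (κ ≟ d)) z″
        in ⊥-elim (bad a b c d e pa pb pc pd pe ab ac bc ad bd cd ae be ce de)

    end≢x : ∀ {y} (S : State x y) {κ} → M S κ y ≢ x
    end≢x S e = uncoloured S _ (flip S e)

    fan-three : ∀ {y} (S : State x y) {P : Colour → Set} (κ₁ κ₂ κ₃ : Colour) → P κ₁ → P κ₂ → P κ₃ →
      κ₁ ≢ κ₂ → κ₁ ≢ κ₃ → κ₂ ≢ κ₃ → (∀ {κ} → P κ → Γ S y κ) →
      (∀ κ → P κ → (S′ : State x y) → Same S S′ x → M S′ κ y ≡ M S κ y → Shares2 S′ (M S κ y) → ⊥) → ⊥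
    fan-three {y} S {P} κ₁ κ₂ κ₃ q₁ q₂ q₃ n₁ n₂ n₃ g bad =
      bad (κ r) (proj₁ (Pκ r)) (S′ r) (x-same r) (agree r (κ r) (proj₂ (Pκ r)) y) (shares r)
      where
      F = κ₁ ∷ κ₂ ∷ κ₃ ∷ []
      r = pick3 S y F (m≤m+n 3 9) {P = λ κ → P κ × κ ∈ F} (λ q → g (proj₁ q)) (λ _ → end≢x S)
            (q₁ , here refl) (q₂ , there (here refl)) (q₃ , there (there (here refl))) n₁ n₂ n₃

    keep-shares : ∀ {y} {S S′ : State x y} {F v} (s : Shares2 S v) → Agree S S′ F →
                  proj₁ s ∈ F → proj₁ (proj₂ s) ∈ F → Shares2 S′ v
    keep-shares (α , α′ , ne , (a , b) , (c , d)) g m m′ =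
      α , α′ , ne , (trans (g α m _) a , trans (g α m _) b) , (trans (g α′ m′ _) c , trans (g α′ m′ _) d)

    module E₂-five {y} (S : State x y) {γ z} (my : M S γ y ≡ y) (xz : M S γ x ≡ z) (z≢x : z ≢ x)
      (κ₁ κ₂ κ₃ κ₄ κ₅ : Colour) (q₁ : E₂ S γ z κ₁) (q₂ : E₂ S γ z κ₂) (q₃ : E₂ S γ z κ₃)
      (q₄ : E₂ S γ z κ₄) (q₅ : E₂ S γ z κ₅)
      (n₁₂ : κ₁ ≢ κ₂) (n₁₃ : κ₁ ≢ κ₃) (n₂₃ : κ₂ ≢ κ₃)
      (n₁₄ : κ₁ ≢ κ₄) (n₂₄ : κ₂ ≢ κ₄) (n₃₄ : κ₃ ≢ κ₄)
      (n₁₅ : κ₁ ≢ κ₅) (n₂₅ : κ₂ ≢ κ₅) (n₃₅ : κ₃ ≢ κ₅) (n₄₅ : κ₄ ≢ κ₅) where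

      F₀ F₁ F₂ F₃ : List Colour
      F₀ = γ ∷ κ₁ ∷ κ₂ ∷ κ₃ ∷ κ₄ ∷ κ₅ ∷ []

      P₀ : Colour → Set
      P₀ κ = E₂ S γ z κ × κ ∈ F₀

      p₁ : P₀ κ₁
      p₁ = q₁ , there (here refl)
      p₂ : P₀ κ₂
      p₂ = q₂ , there (there (here refl))
      p₃ : P₀ κ₃
      p₃ = q₃ , there (there (there (here refl)))
      p₄ : P₀ κ₄
      p₄ = q₄ , there (there (there (there (here refl))))
      p₅ : P₀ κ₅
      p₅ = q₅ , there (there (there (there (there (here refl)))))

      Γ-transport : ∀ {S′ : State x y} {κ v} → M S′ κ v ≡ M S κ v → Γ S v κ → Γ S′ v κ
      Γ-transport e (ne , a) = (λ q → ne (trans (≡-sym e) q)) , subst A (≡-sym e) a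

      Q₁ Q₂ Q₃ : Colour → Set

      Q₁ κ = P₀ κ × κ ≢ κ₄ × κ ≢ κ₅

      r₁ = pick3 S y F₀ (m≤m+n 6 6) {P = Q₁} (λ ((( _ , g , _) , _) , _) → g) (λ _ → end≢x S)
             (p₁ , n₁₄ , n₁₅) (p₂ , n₂₄ , n₂₅) (p₃ , n₃₄ , n₃₅) n₁₂ n₁₃ n₂₃
      S₁ = S′ r₁
      a = κ r₁
      s₁ : Shares2 S₁ (M S a y)
      s₁ = shares r₁
      e₁ : ∀ {κ v} → κ ∈ F₀ → M S₁ κ v ≡ M S κ v
      e₁ m = agree r₁ _ m _

      F₁ = proj₁ s₁ ∷ proj₁ (proj₂ s₁) ∷ F₀
      Q₂ κ = P₀ κ × κ ≢ a × κ ≢ κ₅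

      r₂ = pick3 S₁ y F₁ (m≤m+n 8 4) {P = Q₂} (λ (((_ , g , _) , m) , _) → Γ-transport {S₁} (e₁ m) g) (λ _ → end≢x S₁)
             (proj₁ (Pκ′ r₁) , ≢-sym (κ≢κ′ r₁) , proj₂ (proj₂ (Pκ′ r₁)))
             (proj₁ (Pκ″ r₁) , ≢-sym (κ≢κ″ r₁) , proj₂ (proj₂ (Pκ″ r₁)))
             (p₄ , ≢-sym (proj₁ (proj₂ (Pκ r₁))) , n₄₅)
             (κ′≢κ″ r₁) (proj₁ (proj₂ (Pκ′ r₁))) (proj₁ (proj₂ (Pκ″ r₁)))
      S₂ = S′ r₂
      b = κ r₂
      e₂ : ∀ {κ v} → κ ∈ F₀ → M S₂ κ v ≡ M S κ v
      e₂ m = trans (agree r₂ _ (there (there m)) _) (e₁ m)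
      s₂ : Shares2 S₂ (M S b y)
      s₂ = subst (Shares2 S₂) (e₁ (proj₂ (proj₁ (Pκ r₂)))) (shares r₂)
      s₁₂ : Shares2 S₂ (M S a y)
      s₁₂ = keep-shares {S = S₁} {S₂} s₁ (agree r₂) (here refl) (there (here refl))

      F₂ = proj₁ s₂ ∷ proj₁ (proj₂ s₂) ∷ F₁
      Q₃ κ = P₀ κ × κ ≢ a × κ ≢ b

      r₃ = pick3 S₂ y F₂ (m≤m+n 10 2) {P = Q₃} (λ (((_ , g , _) , m) , _) → Γ-transport {S₂} (e₂ m) g) (λ _ → end≢x S₂)
             (proj₁ (Pκ′ r₂) , proj₁ (proj₂ (Pκ′ r₂)) , ≢-sym (κ≢κ′ r₂))
             (proj₁ (Pκ″ r₂) , proj₁ (proj₂ (Pκ″ r₂)) , ≢-sym (κ≢κ″ r₂))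
             (p₅ , ≢-sym (proj₂ (proj₂ (Pκ r₁))) , ≢-sym (proj₂ (proj₂ (Pκ r₂))))
             (κ′≢κ″ r₂) (proj₂ (proj₂ (Pκ′ r₂))) (proj₂ (proj₂ (Pκ″ r₂)))
      S₃ = S′ r₃
      c = κ r₃
      e₃ : ∀ {κ v} → κ ∈ F₀ → M S₃ κ v ≡ M S κ v
      e₃ m = trans (agree r₃ _ (there (there (there (there m)))) _) (e₂ m)
      s₃ : Shares2 S₃ (M S c y)
      s₃ = subst (Shares2 S₃) (e₂ (proj₂ (proj₁ (Pκ r₃)))) (shares r₃)

      F₃ = proj₁ s₃ ∷ proj₁ (proj₂ s₃) ∷ F₂

      SharesIn : Colour → Set
      SharesIn κ = Σ[ s ∈ Shares2 S₃ (M S κ y) ] (proj₁ s ∈ F₃ × proj₁ (proj₂ s) ∈ F₃)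

      sa : SharesIn a
      sa = keep-shares {S = S₂} {S₃} s₁₂ (agree r₃) (there (there (here refl))) (there (there (there (here refl)))) ,
           there (there (there (there (here refl)))) , there (there (there (there (there (here refl)))))
      sb : SharesIn b
      sb = keep-shares {S = S₂} {S₃} s₂ (agree r₃) (here refl) (there (here refl)) ,
           there (there (here refl)) , there (there (there (here refl)))
      sc : SharesIn c
      sc = s₃ , here refl , there (here refl)

      Q₄ : Colour → Set
      Q₄ κ = P₀ κ × SharesIn κ

      module At (T : State x y) (e : ∀ {κ v} → κ ∈ F₀ → M T κ v ≡ M S κ v) where
        my′ : M T γ y ≡ y
        my′ = trans (e (here refl)) my
        xz′ : M T γ x ≡ z
        xz′ = trans (e (here refl)) xz

      -- The edges at `z` in the selected colours exist because their ends at `y` share colours with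
      -- `x`; hence `Θ` at `z` improves to `Γ`, as the fourth round demands.
      seen : ∀ {κ} → Q₄ κ → M S₃ κ z ≢ z
      seen (((_ , g , _) , m) , s , _) =
        no-hole-beside-sharing S₃ (At.my′ S₃ e₃) (At.xz′ S₃ e₃) z≢x (e₃ m) (proj₁ g) s

      Γz : ∀ {κ} → Q₄ κ → Γ S₃ z κ
      Γz q@(((_ , _ , θ) , m) , _) = seen q ,
        [ (λ e → contradiction (trans (e₃ m) e) (seen q)) , subst A (≡-sym (e₃ m)) ]′ θ

      r₄ = pick3 S₃ z F₃ (m≤m+n 12 0) {P = Q₄} Γz
             (λ (((ne , _) , m) , _) → neighbour≢x S₃ (At.my′ S₃ e₃) (At.xz′ S₃ e₃) z≢x ne)
             (proj₁ (Pκ r₁) , sa) (proj₁ (Pκ r₂) , sb) (proj₁ (Pκ r₃) , sc)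
             (≢-sym (proj₁ (proj₂ (Pκ r₂)))) (≢-sym (proj₁ (proj₂ (Pκ r₃)))) (≢-sym (proj₂ (proj₂ (Pκ r₃))))

      absurd : ⊥
      absurd = finish (Pκ r₄)
        where
        S₄ = S′ r₄
        e₄ : ∀ {κ v} → κ ∈ F₀ → M S₄ κ v ≡ M S κ v
        e₄ m = trans (agree r₄ _ (there (there (there (there (there (there m)))))) _) (e₃ m)
        finish : Q₄ (κ r₄) → ⊥
        finish q@(((_ , g , _) , m) , s , i , j) =
          no-double-sharing S₄ (At.my′ S₄ e₄) (At.xz′ S₄ e₄) z≢x (e₄ m) (proj₁ g)
             (trans (e₄ m) (≡-sym (e₃ m))) (seen q)
             (keep-shares {S = S₃} {S₄} s (agree r₄) i j) (shares r₄)

    few-exceptions : FewExceptions 2 x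
    few-exceptions = record
      { few-fan = λ {y} S → at-most-two (λ κ → Hole? S x κ ×-dec Γ? S y κ) (λ κ₁ κ₂ κ₃ q₁ q₂ q₃ n₁ n₂ n₃ →
          fan-three S {P = λ κ → Hole S x κ × Γ S y κ} κ₁ κ₂ κ₃ q₁ q₂ q₃ n₁ n₂ n₃ proj₂ (λ κ (kx , ne , _) S′ x′ e s →
            fan-⊥ S′ (trans (x′ κ) kx) e ne s))
      ; few-fixed = λ {y} S {Q} Q? g bad → at-most-two Q? (λ κ₁ κ₂ κ₃ q₁ q₂ q₃ n₁ n₂ n₃ →
          fan-three S {P = Q} κ₁ κ₂ κ₃ q₁ q₂ q₃ n₁ n₂ n₃ (λ {κ} → g κ) (λ κ q S′ x′ e s →
            fixed-⊥ S′ e (proj₁ (g κ q)) s (λ S″ x″ → bad κ q S″ (λ μ → trans (x″ μ) (x′ μ)))))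
      ; few-E₁ = λ {y} S {γ} {z} my xz z≢x → at-most-two (E₁? S γ z) (E₁-three S my xz z≢x)
      ; few-E₂ = λ {y} S {γ} {z} my xz z≢x → at-most-four (E₂? S γ z) (E₂-five.absurd S my xz z≢x) }
      where
      E₁-three : ∀ {y} (S : State x y) {γ z} → M S γ y ≡ y → M S γ x ≡ z → z ≢ x → ∀ κ₁ κ₂ κ₃ →
        E₁ S γ z κ₁ → E₁ S γ z κ₂ → E₁ S γ z κ₃ → κ₁ ≢ κ₂ → κ₁ ≢ κ₃ → κ₂ ≢ κ₃ → ⊥
      E₁-three {y} S {γ} {z} my xz z≢x κ₁ κ₂ κ₃ q₁ q₂ q₃ n₁ n₂ n₃ = finish (Pκ r)
        where
        F = κ₁ ∷ κ₂ ∷ κ₃ ∷ γ ∷ []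
        r = pick3 S z F (m≤m+n 4 8) {P = λ κ → E₁ S γ z κ × κ ∈ F}
              (λ ((ne , h , θ) , _) → E₁-seen S my xz z≢x ne h , [ (λ e → contradiction e (E₁-seen S my xz z≢x ne h)) , id ]′ θ)
              (λ ((ne , _) , _) → neighbour≢x S my xz z≢x ne)
              (q₁ , here refl) (q₂ , there (here refl)) (q₃ , there (there (here refl))) n₁ n₂ n₃
        γ∈ : γ ∈ F
        γ∈ = there (there (there (here refl)))
        finish : E₁ S γ z (κ r) × κ r ∈ F → ⊥
        finish ((ne , h , θ) , m) = E₁-⊥ (S′ r) (trans (agree r γ γ∈ y) my) (trans (agree r γ γ∈ x) xz) z≢x ne
          ([ (λ e → inj₁ (trans (agree r _ m x) e)) , (λ e → inj₂ (trans (agree r _ m y) e)) ]′ h)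
          (agree r _ m z) (E₁-seen S my xz z≢x ne h) (shares r)

-- Averages of m and the weights 1 / m

argmax : ∀ {n} {P : Fin n → Set} (P? : ∀ i → Dec (P i)) (f : Fin n → ℕ) →
         (∀ i → ¬ P i) ⊎ (∃[ i ] (P i × ∀ j → P j → f j ≤ f i))
argmax {zero}  P? f = inj₁ (λ ())
argmax {suc n} {P} P? f with P? zero | argmax (P? ∘ suc) (f ∘ suc)
... | no z  | inj₁ none = inj₁ (λ { zero → z ; (suc i) → none i })
... | no z  | inj₂ (i , p , mx) = inj₂ (suc i , p , λ { zero q → contradiction q z ; (suc j) q → mx j q })
... | yes z | inj₁ none = inj₂ (zero , z , λ { zero _ → ≤-refl ; (suc j) q → contradiction q (none j) })
... | yes z | inj₂ (i , p , mx) with ≤-total (f zero) (f (suc i))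
...   | inj₁ le = inj₂ (suc i , p , λ { zero _ → le ; (suc j) q → mx j q })
...   | inj₂ ge = inj₂ (zero , z , λ { zero _ → ≤-refl ; (suc j) q → ≤-trans (mx j q) ge })

sum-0∨ : ∀ {n} {P : Fin n → Set} (P? : ∀ i → Dec (P i)) (f : Fin n → ℕ) → (∀ i → ¬ P i) →
         sum (λ i → indicator (P? i) * f i) ≡ 0
sum-0∨ {n} P? f h = trans (sum-cong (λ i → cong (_* f i) (indicator-no (P? i) (h i)))) (sum-0 n)

sum-on-≤ : ∀ {n} {P : Fin n → Set} (P? : ∀ i → Dec (P i)) (f g : Fin n → ℕ) → (∀ i → P i → f i ≤ g i) →
           sum (λ i → indicator (P? i) * f i) ≤ sum (λ i → indicator (P? i) * g i)
sum-on-≤ P? f g h = sum-mono go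
  where
  go : ∀ i → indicator (P? i) * f i ≤ indicator (P? i) * g i
  go i with P? i
  ... | yes p = *-monoʳ-≤ 1 (h i p)
  ... | no _  = z≤n

sum-on-+ : ∀ {n} {P : Fin n → Set} (P? : ∀ i → Dec (P i)) (f g : Fin n → ℕ) →
           sum (λ i → indicator (P? i) * (f i + g i)) ≡ sum (λ i → indicator (P? i) * f i) + sum (λ i → indicator (P? i) * g i)
sum-on-+ P? f g = trans (sum-cong (λ i → *-distribˡ-+ (indicator (P? i)) (f i) (g i)))
                        (sum-+ (λ i → indicator (P? i) * f i) _)

sum-on-* : ∀ {n} {P : Fin n → Set} (P? : ∀ i → Dec (P i)) c (f : Fin n → ℕ) →
           sum (λ i → indicator (P? i) * (c * f i)) ≡ c * sum (λ i → indicator (P? i) * f i)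
sum-on-* P? c f = trans (sum-cong (λ i → comm (indicator (P? i)) c (f i))) (sum-* c (λ i → indicator (P? i) * f i))
  where
  comm : ∀ a b c → a * (b * c) ≡ b * (a * c)
  comm = solve-∀

-- This is (e - 2m)² ≥ 0, split by the sign of e - 2m because subtraction is truncated.
amgm : ∀ e m → 4 * (e * m) ≤ e * e + 4 * (m * m)
amgm e m with ≤-total e (2 * m)
... | inj₁ le with m≤n⇒∃[o]m+o≡n le
...   | o , eq = *-cancelˡ-≤ 4 (≤-trans (m≤m+n _ (4 * (o * o))) (≤-reflexive (go e m o eq)))
  where
  go : ∀ e m o → e + o ≡ 2 * m → 4 * (4 * (e * m)) + 4 * (o * o) ≡ 4 * (e * e + 4 * (m * m))
  go e m o eq = trans (i₁ e m o) (trans (cong (λ t → 8 * (e * t) + 4 * (o * o)) (≡-sym eq))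
    (trans (i₂ e o) (trans (cong (λ t → 4 * (e * e) + 4 * (t * t)) eq) (i₃ e m))))
    where
    i₁ : ∀ e m o → 4 * (4 * (e * m)) + 4 * (o * o) ≡ 8 * (e * (2 * m)) + 4 * (o * o)
    i₁ = solve-∀
    i₂ : ∀ e o → 8 * (e * (e + o)) + 4 * (o * o) ≡ 4 * (e * e) + 4 * ((e + o) * (e + o))
    i₂ = solve-∀
    i₃ : ∀ e m → 4 * (e * e) + 4 * ((2 * m) * (2 * m)) ≡ 4 * (e * e + 4 * (m * m))
    i₃ = solve-∀
amgm e m | inj₂ ge with m≤n⇒∃[o]m+o≡n ge
...   | o , refl = ≤-trans (m≤m+n _ (o * o)) (≤-reflexive (go m o))
  where
  go : ∀ m o → 4 * ((2 * m + o) * m) + o * o ≡ (2 * m + o) * (2 * m + o) + 4 * (m * m)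
  go = solve-∀

module Reciprocal (k : ℕ) where

  L : ℕ
  L = k !

  -- The weight 1 / m, scaled by L so that the division is exact for 1 ≤ m ≤ k.
  ω : ℕ → ℕ
  ω zero    = 0
  ω (suc m) = L / suc m

  ω-* : ∀ m → 1 ≤ m → m ≤ k → ω m * m ≡ L
  ω-* (suc m) _ le = m/n*n≡m (∣-trans (m∣m*n (m !)) (m≤n⇒m!∣n! le))

  -- The tangent of 1 / m at the point e / 2 lies below the curve: 1 / m ≥ 4 / e - 4m / e². The
  -- inequality is multiplied by e² L.
  ω-tangent : ∀ e m → 1 ≤ m → m ≤ k → 4 * (e * L) ≤ (e * e) * ω m + (4 * L) * m
  ω-tangent e m l u = subst (λ z → 4 * (e * z) ≤ (e * e) * ω m + (4 * z) * m) (ω-* m l u)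
    (≤-trans (≤-reflexive (i₁ e m (ω m))) (≤-trans (*-monoʳ-≤ (ω m) (amgm e m)) (≤-reflexive (i₂ e m (ω m)))))
    where
    i₁ : ∀ e m w → 4 * (e * (w * m)) ≡ w * (4 * (e * m))
    i₁ = solve-∀
    i₂ : ∀ e m w → w * (e * e + 4 * (m * m)) ≡ (e * e) * w + (4 * (w * m)) * m
    i₂ = solve-∀

  L>0 : NonZero L
  L>0 = k !≢0

module Weights {n} (G : Graph n) (k : ℕ) (uncolourable : ¬ ColourableWith (adj G) k)
               (deg≤k : ∀ v → Degrees.deg G k uncolourable v ≤ k)
               (state : ∀ {x y} → T (adj G x y) → Recolouring.State G k uncolourable x y)
               {A : Fin n → Set} (A? : ∀ v → Dec (A v)) where

  open Degrees G k uncolourable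
  open SecondOrder G k uncolourable deg≤k A?
  open Reciprocal k

  σ m : Vertex → ℕ
  σ v = # (λ w → Adj? v w ×-dec ¬? (A? w))
  m v = k ∸ σ v

  degA : Vertex → ℕ
  degA v = # (λ w → Adj? v w ×-dec A? w)

  deg-split : ∀ v → deg v ≡ degA v + σ v
  deg-split v = #-split (Adj? v) A?

  σ≤k : ∀ v → σ v ≤ k
  σ≤k v = ≤-trans (≤-trans (m≤n+m (σ v) (degA v)) (≤-reflexive (≡-sym (deg-split v)))) (deg≤k v)

  m-deg : ∀ v → m v + deg v ≡ k + degA v
  m-deg v = trans (cong (m v +_) (deg-split v)) (trans (i (m v) (degA v) (σ v)) (cong (_+ degA v) (m∸n+n≡m (σ≤k v))))
    where
    i : ∀ a b c → a + (b + c) ≡ a + c + b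
    i = solve-∀

  -- This bounds the weight received: `degA v` shares of 1 / `m v` add up to at most 1.
  degA≤m : ∀ v → degA v ≤ m v
  degA≤m v = +-cancelˡ-≤ k _ _ (≤-trans (≤-reflexive (≡-sym (m-deg v)))
               (≤-trans (+-monoʳ-≤ (m v) (deg≤k v)) (≤-reflexive (+-comm (m v) k))))

  1≤m : ∀ {x v} → A x → Adj v x → 1 ≤ m v
  1≤m {x} {v} Ax a = ≤-trans (≤-trans (s≤s z≤n) (≤-reflexive (≡-sym (#-remove (λ w → Adj? v w ×-dec A? w) x (a , Ax))))) (degA≤m v)

  m≤k : ∀ v → m v ≤ k
  m≤k v = m∸n≤m k (σ v)

  m≤Θ : ∀ {x y} (S : State x y) v → m v ≤ # (Θ? S v)
  m≤Θ S v = m≤n+o⇒m∸n≤o k (σ v) (≤-trans (≤-reflexive (≡-sym (#-¬ (Θ? S v)))) (≤-trans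
    (≤-reflexive (+-comm (# (Θ? S v)) _)) (+-monoˡ-≤ (# (Θ? S v))
    (#-inject (λ κ → ¬? (Θ? S v κ)) (λ w → Adj? v w ×-dec ¬? (A? w)) (along S v)
      (λ κ h → M S κ v , (edge-of S κ v (h ∘ inj₁) , h ∘ inj₂) , refl , h ∘ inj₁) (along-injective S v)))))

  module _ {c x} (Ax : A x) (few : FewExceptions c x) where
    open FewExceptions few

    Θ∩hole : ∀ {y} (S : State x y) → # (λ κ → Θ? S y κ ×-dec Hole? S x κ) ≤ c
    Θ∩hole {y} S = ≤-trans (#-mono (λ κ → Θ? S y κ ×-dec Hole? S x κ) (λ κ → Hole? S x κ ×-dec Γ? S y κ) f) (few-fan S)
      where
      f : ∀ κ → Θ S y κ × Hole S x κ → Hole S x κ × Γ S y κ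
      f κ (inj₁ ky , kx) = ⊥-elim (no-common-hole S kx ky)
      f κ (inj₂ a , kx)  = kx , (λ ky → no-common-hole S kx ky) , a

    -- With `xz` as the uncoloured edge, all but c of the colours in `Θ` at `z` are present at `x`,
    -- and fewer than deg x colours are present there.
    m-bound : ∀ {z} → Adj x z → m z + 1 ≤ deg x + c
    m-bound {z} a = ≤-trans (+-monoˡ-≤ 1 (≤-trans (m≤Θ S z) (≤-reflexive (#-split (Θ? S z) (Hole? S x)))))
      (≤-trans (+-monoˡ-≤ 1 (+-mono-≤ (Θ∩hole S) (#-mono (λ κ → Θ? S z κ ×-dec ¬? (Hole? S x κ)) (λ κ → ¬? (Hole? S x κ)) (λ κ → proj₂))))
      (≤-trans (≤-reflexive (i c (# (λ κ → ¬? (Hole? S x κ))))) (+-monoˡ-≤ c (nonholes-x S))))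
      where
      S = state a
      i : ∀ c q → c + q + 1 ≡ suc q + c
      i = solve-∀

    -- `Θ` at `z` consists of γ, at most c colours of `E₁`, at most 2c of `E₂`, and colours in `Z`;
    -- `Θ` at `y` consists of at most c colours missing at `x` and those in `X`. As `X` and `Z` are
    -- disjoint sets of colours present at `x`, this gives deg x and the 4c exceptions.
    z-bound : ∀ {y} (S : State x y) {γ z} → M S γ y ≡ y → M S γ x ≡ z → z ≢ x →
              m z + m y ≤ deg x + 4 * c
    z-bound {y} S {γ} {z} my xz z≢x = arith (m z) (m y) (# X) (# Z) c (deg x) zΘ (≤-trans (m≤Θ S y) yΘ) XZ
      where
      X = λ κ → Θ? S y κ ×-dec ¬? (Hole? S x κ)
      Z = λ κ → ¬? (Hole? S x κ) ×-dec ¬? (Θ? S y κ)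
      R = λ κ → Θ? S z κ ×-dec ¬? (κ ≟ γ)
      R′ = λ κ → (¬? (κ ≟ γ) ×-dec Θ? S z κ) ×-dec ¬? (Hole? S x κ ⊎-dec Hole? S y κ)
      yΘ : # (Θ? S y) ≤ c + # X
      yΘ = ≤-trans (≤-reflexive (#-split (Θ? S y) (Hole? S x))) (+-monoˡ-≤ (# X) (Θ∩hole S))
      XZ : suc (# X + # Z) ≤ deg x
      XZ = ≤-trans (s≤s (#-disjoint X Z (λ κ → ¬? (Hole? S x κ)) (λ κ → proj₂) (λ κ → proj₁) (λ κ p q → proj₂ q (proj₁ p)))) (nonholes-x S)
      s₁ : ∀ κ → Θ S z κ → κ ∈ (γ ∷ []) ⊎ (Θ S z κ × κ ≢ γ)
      s₁ κ θ with κ ≟ γ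
      ... | yes e = inj₁ (here e)
      ... | no ne = inj₂ (θ , ne)
      s₂ : ∀ κ → Θ S z κ × κ ≢ γ → E₁ S γ z κ ⊎ ((κ ≢ γ × Θ S z κ) × ¬ (Hole S x κ ⊎ Hole S y κ))
      s₂ κ (θ , ne) with Hole? S x κ ⊎-dec Hole? S y κ
      ... | yes h = inj₁ (ne , h , θ)
      ... | no h  = inj₂ ((ne , θ) , h)
      s₃ : ∀ κ → (κ ≢ γ × Θ S z κ) × ¬ (Hole S x κ ⊎ Hole S y κ) → E₂ S γ z κ ⊎ (¬ Hole S x κ × ¬ Θ S y κ)
      s₃ κ ((ne , θ) , h) with A? (M S κ y)
      ... | yes a = inj₁ (ne , (h ∘ inj₂ , a) , θ)
      ... | no a  = inj₂ (h ∘ inj₁ , [ h ∘ inj₂ , a ]′)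
      single : # (λ κ → κ ≟ γ) ≤ 1
      single = #-list (λ κ → κ ≟ γ) (γ ∷ []) (λ κ e → here e)
      zΘ : m z ≤ 1 + (c + ((c + c) + # Z))
      zΘ = ≤-trans (m≤Θ S z) (≤-trans (#-∪ (Θ? S z) (λ κ → κ ≟ γ) R (λ κ θ → [ (λ { (here e) → inj₁ e }) , inj₂ ]′ (s₁ κ θ)))
        (+-mono-≤ single (≤-trans (#-∪ R (E₁? S γ z) R′ s₂) (+-mono-≤ (few-E₁ S my xz z≢x)
          (≤-trans (#-∪ R′ (E₂? S γ z) Z s₃) (+-monoˡ-≤ (# Z) (few-E₂ S my xz z≢x)))))))
      arith : ∀ mz my X Z c d → mz ≤ 1 + (c + ((c + c) + Z)) → my ≤ c + X → suc (X + Z) ≤ d → mz + my ≤ d + 4 * c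
      arith mz my X Z c d a b e = cancel (suc (X + Z)) (+-mono-≤ a (+-mono-≤ b e)) (i mz my X Z) (j X Z c d)
        where
        i : ∀ mz my X Z → mz + my + suc (X + Z) ≡ mz + (my + suc (X + Z))
        i = solve-∀
        j : ∀ X Z c d → 1 + (c + ((c + c) + Z)) + ((c + X) + d) ≡ d + 4 * c + suc (X + Z)
        j = solve-∀

    -- If a colour of `Θ` at `y` is missing at `y`, or can be made so while `x` keeps its colours,
    -- then `z-bound` applies to the neighbour of `x` in this colour. By `few-fixed` at most c
    -- colours resist; distinct colours lead to distinct neighbours.
    low-count : ∀ {y} → Adj x y → m y ≤ # (λ z → Adj? x z ×-dec (m z + m y ≤? deg x + 4 * c)) + c
    low-count {y} a = ≤-trans (m≤Θ S y) (≤-trans (≤-reflexive (#-split (Θ? S y) OK?))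
      (+-mono-≤ (#-inject (λ κ → Θ? S y κ ×-dec OK? κ) (λ z → Adj? x z ×-dec (m z + m y ≤? deg x + 4 * c)) (along S x)
          (λ κ (_ , ne , le) → M S κ x , (edge-of S κ x ne , le) , refl , ne) (along-injective S x))
        (few-fixed S (λ κ → Θ? S y κ ×-dec ¬? (OK? κ)) g bad)))
      where
      S = state a
      OK : Colour → Set
      OK κ = M S κ x ≢ x × m (M S κ x) + m y ≤ deg x + 4 * c
      OK? : ∀ κ → Dec (OK κ)
      OK? κ = ¬? (M S κ x ≟ x) ×-dec (m (M S κ x) + m y ≤? deg x + 4 * c)
      fixed-OK : ∀ (S′ : State x y) → Same S S′ x → ∀ κ → Hole S′ y κ → OK κ
      fixed-OK S′ x′ κ h = (λ e → no-common-hole S′ (trans (x′ κ) e) h) ,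
        z-bound S′ h (x′ κ) (λ e → no-common-hole S′ (trans (x′ κ) e) h)
      g : ∀ κ → Θ S y κ × ¬ OK κ → Γ S y κ
      g κ (θ , nok) with M S κ y ≟ y
      ... | yes h = contradiction (fixed-OK S (λ _ → refl) κ h) nok
      g κ (inj₁ h , nok) | no ne = contradiction h ne
      g κ (inj₂ a , nok) | no ne = ne , a
      bad : ∀ κ → Θ S y κ × ¬ OK κ → ∀ S′ → Same S S′ x → Hole S′ y κ → ⊥
      bad κ (_ , nok) S′ x′ h = nok (fixed-OK S′ x′ κ h)

    Σm : ℕ
    Σm = sum (λ z → indicator (Adj? x z) * m z)

    -- With a the largest m z, all but c of the colours counted by a lead from x to
    -- a vertex with m ≤ d + 4c − a, so the values m z average to at most (d + 4c) / 2.
    sum-bound : 2 * Σm ≤ deg x * (deg x + 4 * c)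
    sum-bound with argmax (Adj? x) m
    ... | inj₁ none = ≤-trans (≤-reflexive (cong (2 *_) (sum-0∨ (Adj? x) m none))) z≤n
    ... | inj₂ (y , ay , mx) = go (≤-total (m y) (d + 4 * c ∸ m y))
      where
      d = deg x
      a = m y
      a≤ : a ≤ d + 4 * c
      a≤ = ≤-trans (≤-trans (m≤m+n a 1) (m-bound ay)) (+-monoʳ-≤ d (m≤m+n c _))
      B = d + 4 * c ∸ a
      a+B : a + B ≡ d + 4 * c
      a+B = m+[n∸m]≡n a≤
      crude : Σm ≤ d * a
      crude = ≤-trans (sum-on-≤ (Adj? x) m (λ _ → a) mx) (≤-reflexive (sum-indicator-* (Adj? x) a))
      low? = λ z → Adj? x z ×-dec (m z + a ≤? d + 4 * c)
      go : a ≤ B ⊎ B ≤ a → 2 * Σm ≤ d * (d + 4 * c)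
      go (inj₁ le) = ≤-trans (*-monoʳ-≤ 2 crude) (≤-trans (≤-reflexive (i d a)) (*-monoʳ-≤ d
        (≤-trans (+-monoʳ-≤ a le) (≤-reflexive a+B))))
        where
        i : ∀ d a → 2 * (d * a) ≡ d * (a + a)
        i = solve-∀
      -- With t = a - B, each vertex counted by `low?` has `m` at least t below the maximum a. At
      -- least half of the neighbours are of this kind, so the average is at most a - t / 2 = (a +
      -- B) / 2.
      go (inj₂ ge) = arith (m≤n⇒∃[o]m+o≡n ge)
        where
        arith : ∃[ t ] (B + t ≡ a) → 2 * Σm ≤ d * (d + 4 * c)
        arith (t , B+t) = +-cancelʳ-≤ (2 * (t * # low?)) _ _
            (≤-trans (≤-reflexive (i₁ Σm t (# low?))) (≤-trans (*-monoʳ-≤ 2 total) (≤-trans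
              (≤-reflexive (trans (i₂ d a) (trans (cong (λ q → d * (a + q)) (≡-sym B+t)) (trans (i₃ d a B t)
                (cong (λ q → d * q + d * t) a+B)))))
              (+-monoʳ-≤ (d * (d + 4 * c)) (≤-trans (*-monoˡ-≤ t d≤) (≤-reflexive (i₄ t (# low?))))))))
          where
          d≤ : d ≤ 2 * # low?
          d≤ = cancel (4 * c) (≤-trans (≤-reflexive (≡-sym a+B)) (≤-trans (+-monoʳ-≤ a ge) (+-mono-≤ (low-count ay)
                 (≤-trans (low-count ay) (+-monoʳ-≤ (# low?) (≤-trans (m≤m+n c c) (m≤m+n (c + c) c))))))) refl (i₅ (# low?) c)
            where
            i₅ : ∀ j c → (j + c) + (j + (c + c + c)) ≡ 2 * j + 4 * c
            i₅ = solve-∀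
          pointwise : ∀ z (p? : Dec (Adj x z)) (q? : Dec (m z + a ≤ d + 4 * c)) →
                      indicator p? * m z + t * indicator (p? ×-dec q?) ≤ indicator p? * a
          pointwise z (no _)  _        = ≤-reflexive (*-zeroʳ t)
          pointwise z (yes q) (no _)   = ≤-trans (≤-reflexive (trans (cong (m z + 0 +_) (*-zeroʳ t)) (trans (+-identityʳ _) (+-identityʳ _)))) (≤-trans (mx z q) (m≤m+n a 0))
          pointwise z (yes q) (yes lo) = ≤-trans (≤-reflexive (j (m z) t)) (≤-trans (+-monoˡ-≤ t mz≤B) (≤-trans (≤-reflexive B+t) (m≤m+n a 0)))
            where
            j : ∀ p t → p + 0 + t * 1 ≡ p + t
            j = solve-∀
            mz≤B : m z ≤ B
            mz≤B = +-cancelʳ-≤ a _ _ (≤-trans lo (≤-reflexive (trans (≡-sym a+B) (+-comm a B))))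
          total : Σm + t * # low? ≤ d * a
          total = ≤-trans (≤-reflexive (trans (cong (Σm +_) (≡-sym (sum-* t (indicator ∘ low?)))) (≡-sym (sum-+ (λ z → indicator (Adj? x z) * m z) _))))
            (≤-trans (sum-mono (λ z → pointwise z (Adj? x z) (m z + a ≤? d + 4 * c))) (≤-reflexive (sum-indicator-* (Adj? x) a)))
          i₁ : ∀ s t l → 2 * s + 2 * (t * l) ≡ 2 * (s + t * l)
          i₁ = solve-∀
          i₂ : ∀ d a → 2 * (d * a) ≡ d * (a + a)
          i₂ = solve-∀
          i₃ : ∀ d a B t → d * (a + (B + t)) ≡ d * (a + B) + d * t
          i₃ = solve-∀
          i₄ : ∀ t j → 2 * j * t ≡ 2 * (t * j)
          i₄ = solve-∀

    Σω : ℕ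
    Σω = sum (λ z → indicator (Adj? x z) * ω (m z))

    -- The tangents at e / 2 are summed, where e / 2 is the bound on the average of `m`; `sum-bound`
    -- controls the linear part, and one factor e cancels.
    weight-bound : (deg x + 4 * c) * Σω ≥ 2 * (deg x * L)
    weight-bound = cases (deg x) refl
      where
      e = deg x + 4 * c
      tangent-sum : 4 * (e * L) * deg x ≤ (e * e) * Σω + (4 * L) * Σm
      tangent-sum = ≤-trans (≤-reflexive (trans (*-comm (4 * (e * L)) (deg x)) (≡-sym (sum-indicator-* (Adj? x) (4 * (e * L))))))
        (≤-trans (sum-on-≤ (Adj? x) (λ _ → 4 * (e * L)) (λ z → (e * e) * ω (m z) + (4 * L) * m z)
          (λ z a → ω-tangent e (m z) (1≤m Ax (Adj-sym a)) (m≤k z)))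
        (≤-reflexive (trans (sum-on-+ (Adj? x) (λ z → (e * e) * ω (m z)) _)
          (cong₂ _+_ (sum-on-* (Adj? x) (e * e) (λ z → ω (m z))) (sum-on-* (Adj? x) (4 * L) m)))))
      i₁ : ∀ e d L → e * (2 * (d * L)) + (2 * L) * (d * e) ≡ 4 * (e * L) * d
      i₁ = solve-∀
      i₂ : ∀ e s L t → (e * e) * s + (4 * L) * t ≡ e * (e * s) + (2 * L) * (2 * t)
      i₂ = solve-∀
      scaled : e * (2 * (deg x * L)) ≤ e * (e * Σω)
      scaled = +-cancelʳ-≤ ((2 * L) * (deg x * e)) _ _ (≤-trans (≤-reflexive (i₁ e (deg x) L)) (≤-trans tangent-sum
        (≤-trans (≤-reflexive (i₂ e Σω L Σm)) (+-monoʳ-≤ (e * (e * Σω)) (*-monoʳ-≤ (2 * L) sum-bound)))))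
      cases : ∀ d → d ≡ deg x → e * Σω ≥ 2 * (deg x * L)
      cases zero eq    = ≤-trans (≤-reflexive (cong (λ d → 2 * (d * L)) (≡-sym eq))) z≤n
      cases (suc d) eq = *-cancelˡ-≤ e ⦃ >-nonZero (≤-trans (s≤s z≤n) (≤-trans (≤-reflexive eq) (m≤m+n (deg x) _))) ⦄ scaled

  double-count : ∀ {P : Vertex → Set} (P? : ∀ v → Dec (P v)) (f : Vertex → ℕ) →
    sum (λ x → indicator (P? x) * sum (λ z → indicator (Adj? x z) * f z)) ≡
    sum (λ z → # (λ x → P? x ×-dec Adj? z x) * f z)
  double-count P? f = trans (sum-cong (λ x → ≡-sym (sum-* (indicator (P? x)) (λ z → indicator (Adj? x z) * f z))))
    (trans (sum-swap (λ x z → indicator (P? x) * (indicator (Adj? x z) * f z)))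
      (sum-cong (λ z → trans (sum-cong (λ x → both (P? x) (Adj? x z) (Adj? z x) Adj-sym Adj-sym (f z))) (sum-indicator-* (λ x → P? x ×-dec Adj? z x) (f z)))))
    where
    both : ∀ {P Q R : Set} (p? : Dec P) (q? : Dec Q) (r? : Dec R) → (Q → R) → (R → Q) → ∀ c →
           indicator p? * (indicator q? * c) ≡ indicator (p? ×-dec r?) * c
    both (no _)  _       _       f g c = refl
    both (yes _) (yes _) (yes _) f g c = +-identityʳ _
    both (yes _) (no _)  (no _)  f g c = refl
    both (yes _) (yes a) (no b)  f g c = contradiction (f a) b
    both (yes _) (no b)  (yes a) f g c = contradiction (g a) b

-- Double counting: expansion and Chvátal's condition

-- With P = 2p = s + 2g + 36 + r and h = p + s, eight times the difference of the two sides of the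
-- hypothesis is a polynomial in s, g, r with positive coefficients.
degree-arith : ∀ p s g → s + 2 * g + 36 ≤ 2 * p →
  2 * p * (suc (p + s)) * (p + s) ≤ (p + 8) * (suc s * (p + s) + (s + g) * g + suc (p + s) * (p + s)) → ⊥
degree-arith p s g le bad with m≤n⇒∃[o]m+o≡n le
... | r , eq = 1+n≰n (≤-trans (s≤s (m≤m+n _ (rest s g r))) (≤-trans (≤-reflexive (cong suc (≡-sym big)))
       (≤-trans (s≤s (*-monoʳ-≤ 8 bad)) (≤-reflexive (cong suc (trans (rhs p s g) (cong (λ P → R P s g) (≡-sym eq))))))))
  where
  R Lh : ℕ → ℕ → ℕ → ℕ
  R P s g = (P + 16) * (2 * suc s * (P + 2 * s) + 4 * ((s + g) * g) + (P + 2 * s + 2) * (P + 2 * s))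
  Lh P s g = 2 * P * (P + 2 * s + 2) * (P + 2 * s)
  rest : ℕ → ℕ → ℕ → ℕ
  rest s g r = 3 * s * s * s + 10 * s * s * g + 7 * s * s * r + 12 * s * s + 8 * s * g * g + 16 * s * g * r + 256 * s * g + 5 * s * r * r + 232 * s * r + 1680 * s + 8 * g * g * r + 160 * g * g + 6 * g * r * r + 368 * g * r + 5344 * g + r * r * r + 92 * r * r + 2672 * r + 23615
  rhs : ∀ p s g → 8 * ((p + 8) * (suc s * (p + s) + (s + g) * g + suc (p + s) * (p + s))) ≡
        (2 * p + 16) * (2 * suc s * (2 * p + 2 * s) + 4 * ((s + g) * g) + (2 * p + 2 * s + 2) * (2 * p + 2 * s))
  rhs = solve-∀
  lhs : ∀ p s → 8 * (2 * p * (suc (p + s)) * (p + s)) ≡ 2 * (2 * p) * (2 * p + 2 * s + 2) * (2 * p + 2 * s)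
  lhs = solve-∀
  poly : ∀ s g r → 2 * (s + 2 * g + 36 + r) * ((s + 2 * g + 36 + r) + 2 * s + 2) * ((s + 2 * g + 36 + r) + 2 * s) ≡
    suc (((s + 2 * g + 36 + r) + 16) * (2 * suc s * ((s + 2 * g + 36 + r) + 2 * s) + 4 * ((s + g) * g) + ((s + 2 * g + 36 + r) + 2 * s + 2) * ((s + 2 * g + 36 + r) + 2 * s))
      + (3 * s * s * s + 10 * s * s * g + 7 * s * s * r + 12 * s * s + 8 * s * g * g + 16 * s * g * r + 256 * s * g + 5 * s * r * r + 232 * s * r + 1680 * s + 8 * g * g * r + 160 * g * g + 6 * g * r * r + 368 * g * r + 5344 * g + r * r * r + 92 * r * r + 2672 * r + 23615))
  poly = solve-∀
  big : 8 * (2 * p * (suc (p + s)) * (p + s)) ≡ suc (R (s + 2 * g + 36 + r) s g + rest s g r)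
  big = trans (lhs p s) (trans (cong (λ P → Lh P s g) (≡-sym eq)) (poly s g r))

-- a, b and q count the vertices of degree at most h, of degree at least n − h, and the others.
class-arith : ∀ p s g a b q → s + 2 * g + 36 ≤ 2 * p → 1 ≤ g → p + s ≤ a → b ≤ p + s →
  a + q + b ≡ (p + s) + (p + s) + g →
  2 * p * suc (p + s) * a ≤ (p + 8) * (suc s * a + (s + g) * q + suc (p + s) * b) → ⊥
class-arith p s g a b q le g≥1 ha bh sum≡ bad = degree-arith p s g le final
  where
  h = p + s
  r = s + g
  -- Reduction to the extreme case a = b = h, q = g. Regarding `i` low vertices as middle ones, and
  -- `j` middle ones as high ones, does not lower the right-hand side, since suc s ≤ s + g ≤ suc h;
  -- the left-hand side is monotone in `a`.
  i = proj₁ (m≤n⇒∃[o]m+o≡n ha)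
  i≡ : h + i ≡ a
  i≡ = proj₂ (m≤n⇒∃[o]m+o≡n ha)
  j = proj₁ (m≤n⇒∃[o]m+o≡n bh)
  j≡ : b + j ≡ h
  j≡ = proj₂ (m≤n⇒∃[o]m+o≡n bh)
  q≡ : q + i ≡ g + j
  q≡ = +-cancelʳ-≡ (h + b) (q + i) (g + j)
         (trans (e₁ q i h b) (trans (cong (λ t → t + q + b) i≡) (trans sum≡ (trans (cong (λ t → h + t + g) (≡-sym j≡)) (e₂ h b j g)))))
    where
    e₁ : ∀ q i h b → q + i + (h + b) ≡ h + i + q + b
    e₁ = solve-∀
    e₂ : ∀ h b j g → h + (b + j) + g ≡ g + j + (h + b)
    e₂ = solve-∀
  g≤p : g ≤ p
  g≤p = *-cancelˡ-≤ 2 (≤-trans (≤-trans (m≤n+m (2 * g) s) (m≤m+n (s + 2 * g) 36)) le)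
  r≤ : r ≤ suc h
  r≤ = ≤-trans (+-monoʳ-≤ s g≤p) (≤-trans (≤-reflexive (+-comm s p)) (n≤1+n _))
  inner : suc s * a + r * q + suc h * b + r * i ≤ suc s * a + r * g + suc h * h
  inner = ≤-trans (≤-reflexive (trans (f₁ (suc s * a) r q (suc h * b) i) (trans (cong (λ t → suc s * a + r * t + suc h * b) q≡) (f₂ (suc s * a) r g j (suc h * b)))))
    (≤-trans (+-monoʳ-≤ (suc s * a + r * g) (+-monoˡ-≤ (suc h * b) (*-monoˡ-≤ j r≤)))
      (≤-reflexive (cong (suc s * a + r * g +_) (trans (f₃ (suc h) j b) (cong (suc h *_) j≡)))))
    where
    f₁ : ∀ x r q y i → x + r * q + y + r * i ≡ x + r * (q + i) + y
    f₁ = solve-∀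
    f₂ : ∀ x r g j y → x + r * (g + j) + y ≡ x + r * g + (r * j + y)
    f₂ = solve-∀
    f₃ : ∀ u j b → u * j + u * b ≡ u * (b + j)
    f₃ = solve-∀
  u≤r : suc s ≤ r
  u≤r = ≤-trans (≤-reflexive (+-comm 1 s)) (+-monoʳ-≤ s g≥1)
  final : 2 * p * suc h * h ≤ (p + 8) * (suc s * h + r * g + suc h * h)
  final = +-cancelʳ-≤ ((p + 8) * (suc s * i)) _ _ (≤-trans (+-mono-≤ (*-monoʳ-≤ (2 * p * suc h) ha) (*-monoʳ-≤ (p + 8) (*-monoˡ-≤ i u≤r)))
    (≤-trans (+-monoˡ-≤ ((p + 8) * (r * i)) bad) (≤-trans (≤-reflexive (≡-sym (*-distribˡ-+ (p + 8) _ (r * i))))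
      (≤-trans (*-monoʳ-≤ (p + 8) inner) (≤-reflexive (trans (cong (λ t → (p + 8) * (suc s * t + r * g + suc h * h)) (≡-sym i≡)) (f (p + 8) (suc s) h i (r * g) (suc h * h))))))))
    where
    f : ∀ c u h i x y → c * (u * (h + i) + x + y) ≡ c * (u * h + x + y) + c * (u * i)
    f = solve-∀

module Critical {n} (G : Graph n) (k : ℕ) (uncolourable : ¬ ColourableWith (adj G) k)
                (deg≤k : ∀ v → Degrees.deg G k uncolourable v ≤ k)
                (state : ∀ {x y} → T (adj G x y) → Recolouring.State G k uncolourable x y)
                (deg>0 : ∀ v → 1 ≤ Degrees.deg G k uncolourable v) where

  open Degrees G k uncolourable
  open Reciprocal k

  Small : Vertex → Set
  Small v = deg v + deg v + 1 ≤ k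

  Small? : ∀ v → Dec (Small v)
  Small? v = deg v + deg v + 1 ≤? k

  small-sum : ∀ {u v} → Small u → Small v → deg u + deg v + 1 ≤ k
  small-sum {u} {v} a b = *-cancelˡ-≤ 2 (≤-trans (≤-reflexive (i (deg u) (deg v))) (≤-trans (+-mono-≤ a b) (≤-reflexive (j k))))
    where
    i : ∀ a b → 2 * (a + b + 1) ≡ (a + a + 1) + (b + b + 1)
    i = solve-∀
    j : ∀ k → k + k ≡ 2 * k
    j = solve-∀

  -- By `degree-sum` the ends of an edge have degrees adding up to at least k + 2.
  small-independent : ∀ {u v} → Small u → Small v → ¬ Adj u v
  small-independent {u} {v} a b e = 1+n≰n (≤-trans (≤-reflexive (i (deg u + deg v))) (≤-trans (small-sum a b)
      (+-cancelʳ-≤ 2 _ _ (≤-trans (degree-sum (state e)) (m≤m+n _ 2)))))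
    where
    i : ∀ a → suc a ≡ a + 1
    i = solve-∀

  module _ {P : Vertex → Set} (P? : ∀ v → Dec (P v)) (P⊆Small : ∀ v → P v → Small v) where
    private module W = Weights G k uncolourable deg≤k state Small?

    Neighbour : Vertex → Set
    Neighbour z = ∃[ x ] (P x × Adj z x)

    Neighbour? : ∀ z → Dec (Neighbour z)
    Neighbour? z = any? (λ x → P? x ×-dec Adj? z x)

    -- Two small vertices have degree sum below k, so c = 0 and the factor deg x cancels from
    -- `weight-bound`.
    weight≥2 : ∀ x → P x → 2 * L ≤ sum (λ z → indicator (Adj? x z) * ω (W.m z))
    weight≥2 x Px = *-cancelˡ-≤ (deg x) ⦃ >-nonZero (deg>0 x) ⦄ (≤-trans (≤-reflexive (i (deg x) L)) (≤-trans
        (W.weight-bound {0} {x} sx (SecondOrder.Sharing.no-exceptions G k uncolourable deg≤k Small? x (λ a sa → small-sum sa sx)))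
        (*-monoˡ-≤ _ (≤-reflexive (+-identityʳ (deg x))))))
      where
      sx = P⊆Small x Px
      i : ∀ d L → d * (2 * L) ≡ 2 * (d * L)
      i = solve-∀

    -- Every vertex of `P` sends out weight at least 2, and each of their neighbours receives at
    -- most 1 because `degA` is at most `m`.
    expansion : 2 * # P? ≤ # Neighbour?
    expansion = *-cancelʳ-≤ _ _ L ⦃ L>0 ⦄ (≤-trans (≤-reflexive (i (# P?) L)) (≤-trans
      (≤-reflexive (≡-sym (sum-indicator-* P? (2 * L))))
      (≤-trans (sum-on-≤ P? (λ _ → 2 * L) (λ x → sum (λ z → indicator (Adj? x z) * ω (W.m z))) weight≥2)
      (≤-trans (≤-reflexive (W.double-count P? (λ z → ω (W.m z))))
      (≤-trans (sum-mono (λ z → bound z (Neighbour? z))) (≤-reflexive (sum-indicator-* Neighbour? L)))))))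
      where
      i : ∀ a L → 2 * a * L ≡ a * (2 * L)
      i = solve-∀
      bound : ∀ z (q : Dec (Neighbour z)) → # (λ x → P? x ×-dec Adj? z x) * ω (W.m z) ≤ indicator q * L
      bound z (no q) = ≤-reflexive (cong (_* ω (W.m z)) (#-∅ (λ x → P? x ×-dec Adj? z x) (λ x w → q (x , w))))
      bound z (yes (x , Px , a)) = ≤-trans (*-monoˡ-≤ (ω (W.m z)) (≤-trans
          (#-mono (λ x → P? x ×-dec Adj? z x) (λ x → Adj? z x ×-dec Small? x) (λ y (Py , b) → b , P⊆Small y Py)) (W.degA≤m z)))
        (≤-trans (≤-reflexive (trans (*-comm (W.m z) _) (ω-* (W.m z) (W.1≤m (P⊆Small x Px) a) (W.m≤k z)))) (m≤m+n L 0))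

  module Chvatal (2n≤3k : 2 * n + 36 ≤ 3 * k) (h : ℕ) (k≤2h : k ≤ 2 * h) (2h<n : 2 * h < n) where

    Low High : Vertex → Set
    Low v  = deg v ≤ h
    High v = n ≤ deg v + h

    Low? : ∀ v → Dec (Low v)
    Low? v = deg v ≤? h

    High? : ∀ v → Dec (High v)
    High? v = n ≤? deg v + h

    private module W = Weights G k uncolourable deg≤k state Low?

    h≤k : h ≤ k
    h≤k = *-cancelˡ-≤ 3 (≤-trans (≤-trans (≤-trans (≤-reflexive (i h)) (+-monoʳ-≤ (2 * h) (≤-trans (m≤m+n h h) (≤-reflexive (j h)))))
        (≤-trans (+-mono-≤ (<⇒≤ 2h<n) (<⇒≤ 2h<n)) (≤-trans (≤-reflexive (j n)) (m≤m+n (2 * n) 36)))) 2n≤3k)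
      where
      i : ∀ h → 3 * h ≡ 2 * h + h
      i = solve-∀
      j : ∀ h → h + h ≡ 2 * h
      j = solve-∀

    p : ℕ
    p = k ∸ h

    k≡ : k ≡ p + h
    k≡ = ≡-sym (m∸n+n≡m h≤k)

    p≤h : p ≤ h
    p≤h = +-cancelʳ-≤ h _ _ (≤-trans (≤-reflexive (≡-sym k≡)) (≤-trans k≤2h (≤-reflexive (i h))))
      where
      i : ∀ h → 2 * h ≡ h + h
      i = solve-∀

    -- In these parameters k = 2p + s and n = 2p + 2s + g, which turns the hypothesis on n and k
    -- into `slack`.
    s g : ℕ
    s = h ∸ p
    g = n ∸ 2 * h

    h≡ : p + s ≡ h
    h≡ = m+[n∸m]≡n p≤h

    n≡ : 2 * h + g ≡ n
    n≡ = m+[n∸m]≡n (<⇒≤ 2h<n)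

    1≤g : 1 ≤ g
    1≤g = +-cancelˡ-≤ (2 * h) _ _ (≤-trans (≤-trans (≤-reflexive (+-comm (2 * h) 1)) 2h<n) (≤-reflexive (≡-sym n≡)))

    slack : s + 2 * g + 36 ≤ 2 * p
    slack = +-cancelʳ-≤ (3 * s + 4 * p) _ _ (≤-trans (≤-reflexive (i s g p)) (≤-trans (≤-reflexive (cong (λ h → 2 * (2 * h + g) + 36) h≡))
      (≤-trans (≤-reflexive (cong (λ n → 2 * n + 36) n≡)) (≤-trans 2n≤3k (≤-reflexive (trans (cong (3 *_) k≡) (trans (cong (λ h → 3 * (p + h)) (≡-sym h≡)) (j p s))))))))
      where
      i : ∀ s g p → s + 2 * g + 36 + (3 * s + 4 * p) ≡ 2 * (2 * (p + s) + g) + 36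
      i = solve-∀
      j : ∀ p s → 3 * (p + (p + s)) ≡ 2 * p + (3 * s + 4 * p)
      j = solve-∀

    38≤ : h + 38 ≤ 3 * p
    38≤ = ≤-trans (+-monoˡ-≤ 38 (≤-reflexive (≡-sym h≡))) (≤-trans (≤-reflexive (i p s)) (≤-trans
      (+-monoʳ-≤ p (≤-trans (+-monoˡ-≤ 36 (+-monoʳ-≤ s (*-monoʳ-≤ 2 1≤g))) slack)) (≤-reflexive (j p))))
      where
      i : ∀ p s → p + s + 38 ≡ p + (s + 2 * 1 + 36)
      i = solve-∀
      j : ∀ p → p + 2 * p ≡ 3 * p
      j = solve-∀

    -- If deg x < p = k - h, then deg x plus the degree of any low vertex is below k, and sharing
    -- follows by counting; only the other low vertices need the rounds.
    few : ∀ x → Low x → ∃[ c ] (c ≤ 2 × SecondOrder.FewExceptions G k uncolourable deg≤k Low? c x × (deg x + 1 ≤ p → c ≡ 0))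
    few x lx with deg x + 1 ≤? p
    ... | yes le = 0 , z≤n , SecondOrder.Sharing.no-exceptions G k uncolourable deg≤k Low? x low , (λ _ → refl)
      where
      low : ∀ a → Low a → deg a + deg x + 1 ≤ k
      low a la = ≤-trans (≤-reflexive (+-assoc (deg a) (deg x) 1)) (≤-trans (+-mono-≤ la le) (≤-reflexive (trans (+-comm h p) (≡-sym k≡))))
    ... | no nle = 2 , ≤-refl , SecondOrder.Rounds.few-exceptions G k uncolourable deg≤k Low? h p k≡ p≤h 38≤ (λ _ la → la) x lx ,
                   (λ le → contradiction le nle)

    weight : Vertex → ℕ
    weight x = sum (λ z → indicator (Adj? x z) * ω (W.m z))

    -- The weight 2d / (d + 4c) is 2 when d < p, as then c = 0. When d ≥ p it is at least 2d / (d +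
    -- 8), which increases with d.
    weight-low : ∀ x → Low x → 2 * (p * L) ≤ (p + 8) * weight x
    weight-low x lx = go (few x lx)
      where
      d = deg x
      go : ∃[ c ] (c ≤ 2 × SecondOrder.FewExceptions G k uncolourable deg≤k Low? c x × (deg x + 1 ≤ p → c ≡ 0)) →
           2 * (p * L) ≤ (p + 8) * weight x
      go (c , c≤2 , fe , small) = cases (d + 1 ≤? p)
        where
        wb : 2 * (d * L) ≤ (d + 4 * c) * weight x
        wb = W.weight-bound lx fe
        cases : Dec (d + 1 ≤ p) → 2 * (p * L) ≤ (p + 8) * weight x
        cases (yes le) = ≤-trans (≤-reflexive (i p L)) (≤-trans (*-monoʳ-≤ p two) (*-monoˡ-≤ (weight x) (m≤m+n p 8)))
          where
          i : ∀ p L → 2 * (p * L) ≡ p * (2 * L)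
          i = solve-∀
          two : 2 * L ≤ weight x
          two = *-cancelˡ-≤ d ⦃ >-nonZero (deg>0 x) ⦄ (≤-trans (≤-reflexive (≡-sym (i d L))) (≤-trans wb
            (≤-reflexive (cong (_* weight x) (trans (cong (λ c → d + 4 * c) (small le)) (+-identityʳ d))))))
        cases (no nle) = *-cancelˡ-≤ (d + 8) ⦃ >-nonZero (≤-trans (s≤s z≤n) (m≤n+m 8 d)) ⦄
          (≤-trans (≤-reflexive (i d p L)) (≤-trans (+-monoʳ-≤ (2 * (d * p * L)) (*-monoˡ-≤ L (*-monoʳ-≤ 16 p≤d)))
            (≤-trans (≤-reflexive (j d p L)) (≤-trans (*-monoʳ-≤ (p + 8) (≤-trans wb (*-monoˡ-≤ (weight x) (+-monoʳ-≤ d (*-monoʳ-≤ 4 c≤2)))))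
              (≤-reflexive (l d p (weight x)))))))
          where
          p≤d : p ≤ d
          p≤d = ≤-pred (≤-trans (≰⇒> nle) (≤-reflexive (+-comm d 1)))
          i : ∀ d p L → (d + 8) * (2 * (p * L)) ≡ 2 * (d * p * L) + 16 * p * L
          i = solve-∀
          j : ∀ d p L → 2 * (d * p * L) + 16 * d * L ≡ (p + 8) * (2 * (d * L))
          j = solve-∀
          l : ∀ d p w → (p + 8) * ((d + 8) * w) ≡ (d + 8) * ((p + 8) * w)
          l = solve-∀

    Middle? : ∀ v → Dec (¬ Low v × ¬ High v)
    Middle? v = ¬? (Low? v) ×-dec ¬? (High? v)

    high-not-low : ∀ v → High v → ¬ Low v
    high-not-low v hi lo = 1+n≰n (≤-trans 2h<n (≤-trans hi (≤-trans (+-monoˡ-≤ h lo) (≤-reflexive (i h)))))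
      where
      i : ∀ h → h + h ≡ 2 * h
      i = solve-∀

    classes : # Low? + # Middle? + # High? ≡ n
    classes = trans (i (# Low?) (# Middle?) (# High?)) (trans (cong (# Low? +_) (≡-sym (trans (#-split (λ v → ¬? (Low? v)) High?)
      (cong (_+ # Middle?) (#-cong (λ v → ¬? (Low? v) ×-dec High? v) High? (λ v → proj₂) (λ v hi → high-not-low v hi , hi)))))) (#-¬ Low?))
      where
      i : ∀ a b c → a + b + c ≡ a + (c + b)
      i = solve-∀

    -- An upper bound for h + 1 times the weight received by `z`. That weight is `degA` / m = 1 - (k
    -- - deg z) / m, and m ≤ h + 1, which leaves h + 1 - (k - deg z). This is at most s + 1 for a
    -- low vertex, s + g = n - k for a middle one, and h + 1 for a high one.
    share : Vertex → ℕ
    share z = indicator (Low? z) * suc s + indicator (Middle? z) * (s + g) + indicator (High? z) * suc h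

    share-sum : sum share ≡ suc s * # Low? + (s + g) * # Middle? + suc h * # High?
    share-sum = trans (sum-+ (λ z → indicator (Low? z) * suc s + indicator (Middle? z) * (s + g)) _)
      (cong₂ _+_ (trans (sum-+ (λ z → indicator (Low? z) * suc s) _)
        (cong₂ _+_ (c Low? (suc s)) (c Middle? (s + g)))) (c High? (suc h)))
      where
      c : ∀ {P : Vertex → Set} (P? : ∀ v → Dec (P v)) w → sum (λ z → indicator (P? z) * w) ≡ w * # P?
      c P? w = trans (sum-indicator-* P? w) (*-comm (# P?) w)

    deg-gap : ∀ z → (k ∸ deg z) + deg z ≡ k
    deg-gap z = m∸n+n≡m (deg≤k z)

    share-gap : ∀ z → suc h ≤ share z + (k ∸ deg z)
    share-gap z = go (Low? z) (High? z)
      where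
      go : (l? : Dec (Low z)) (h? : Dec (High z)) →
           suc h ≤ indicator l? * suc s + indicator (¬? l? ×-dec ¬? h?) * (s + g) + indicator h? * suc h + (k ∸ deg z)
      go (yes lo) h? = ≤-trans (≤-trans (s≤s (≤-trans (≤-reflexive (trans (≡-sym h≡) (+-comm p s))) (+-monoʳ-≤ s p≤)))
          (+-monoˡ-≤ (k ∸ deg z) (≤-trans (m≤m+n (suc s) 0) (m≤m+n (suc s + 0) 0)))) (+-monoˡ-≤ (k ∸ deg z) (m≤m+n _ (indicator h? * suc h)))
        where
        p≤ : p ≤ k ∸ deg z
        p≤ = +-cancelʳ-≤ (deg z) _ _ (≤-trans (+-monoʳ-≤ p lo) (≤-reflexive (trans (≡-sym k≡) (≡-sym (deg-gap z)))))
      go (no nl) (yes hi) = ≤-trans (m≤m+n (suc h) 0) (m≤m+n (suc h + 0) _)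
      go (no nl) (no nh) = ≤-trans (+-cancelʳ-≤ (deg z) _ _ (≤-trans (≤-reflexive (i h (deg z))) (≤-trans (≰⇒> nh)
          (≤-reflexive (trans n≡′ (trans (cong (s + g +_) (≡-sym (deg-gap z))) (≡-sym (+-assoc (s + g) (k ∸ deg z) (deg z))))))))) (≤-reflexive (j (s + g) (k ∸ deg z) (deg z)))
        where
        i : ∀ h d → suc h + d ≡ suc (d + h)
        i = solve-∀
        j : ∀ r q d → r + q ≡ r + 0 + 0 + q
        j = solve-∀
        n≡′ : n ≡ s + g + k
        n≡′ = trans (≡-sym n≡) (trans (e h g) (trans (cong (λ t → t + h + g) (≡-sym h≡)) (trans (f p s h g) (cong (s + g +_) (≡-sym k≡)))))
          where
          e : ∀ h g → 2 * h + g ≡ h + h + g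
          e = solve-∀
          f : ∀ p s h g → p + s + h + g ≡ s + g + (p + h)
          f = solve-∀

    m≤suc-h : ∀ {x z} → Low x → Adj x z → W.m z ≤ suc h
    m≤suc-h {x} {z} lx a = let (c , c≤2 , fe , _) = few x lx in
      +-cancelʳ-≤ 1 _ _ (≤-trans (W.m-bound lx fe a) (≤-trans (+-mono-≤ lx c≤2) (≤-reflexive (i h))))
      where
      i : ∀ h → h + 2 ≡ suc h + 1
      i = solve-∀

    vertex-bound : ∀ z → suc h * (W.degA z * ω (W.m z)) ≤ share z * L
    vertex-bound z = go (any? (λ x → Adj? z x ×-dec Low? x))
      where
      m = W.m z
      dA = W.degA z
      q = k ∸ deg z
      m≡ : m ≡ q + dA
      m≡ = +-cancelʳ-≡ (deg z) m (q + dA) (trans (W.m-deg z) (trans (cong (_+ dA) (≡-sym (deg-gap z))) (i q (deg z) dA)))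
        where
        i : ∀ q d a → q + d + a ≡ q + a + d
        i = solve-∀
      go : Dec (∃[ x ] (Adj z x × Low x)) → suc h * (dA * ω m) ≤ share z * L
      go (no none) = ≤-trans (≤-reflexive (trans (cong (λ t → suc h * (t * ω m)) (#-∅ (λ x → Adj? z x ×-dec Low? x) (λ x e → none (x , e)))) (*-zeroʳ (suc h)))) z≤n
      -- q · L = q · ω m · m ≤ q · ω m · (h + 1) is added, after which the left side sums to (h + 1)
      -- · ω m · (q + dA) = (h + 1) · L.
      go (yes (x , a , lx)) = +-cancelʳ-≤ (q * L) _ _ (≤-trans
        (+-monoʳ-≤ (suc h * (dA * ω m)) (≤-trans (≤-reflexive (cong (q *_) (≡-sym ωm))) (*-monoʳ-≤ q (*-monoʳ-≤ (ω m) (m≤suc-h lx (Adj-sym a))))))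
        (≤-trans (≤-reflexive (trans (i (suc h) dA (ω m) q) (cong (suc h *_) (trans (cong (ω m *_) (≡-sym m≡)) ωm))))
          (≤-trans (*-monoˡ-≤ L (share-gap z)) (≤-reflexive (*-distribʳ-+ L (share z) q)))))
        where
        ωm : ω m * m ≡ L
        ωm = ω-* m (W.1≤m lx a) (W.m≤k z)
        i : ∀ u d w q → u * (d * w) + q * (w * u) ≡ u * (w * (q + d))
        i = solve-∀

    -- The low vertices send at least 2p / (p + 8) each, and the total received is bounded by the
    -- shares; `class-arith` shows that both bounds cannot hold together.
    chvatal : h ≤ # Low? → # High? ≤ h → ⊥
    chvatal lo hi = class-arith p s g (# Low?) (# High?) (# Middle?) slack 1≤g
        (≤-trans (≤-reflexive h≡) lo) (≤-trans hi (≤-reflexive (≡-sym h≡)))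
        (trans classes (trans (≡-sym n≡) (cong (_+ g) (trans (i h) (cong₂ _+_ (≡-sym h≡) (≡-sym h≡))))))
        (≤-trans (≤-reflexive (cong (λ t → 2 * p * suc t * # Low?) h≡)) (≤-trans main (≤-reflexive
          (cong (λ t → (p + 8) * (suc s * # Low? + (s + g) * # Middle? + suc t * # High?)) (≡-sym h≡)))))
      where
      i : ∀ h → 2 * h ≡ h + h
      i = solve-∀
      total : ℕ
      total = sum (λ z → W.degA z * ω (W.m z))
      count : sum (λ x → indicator (Low? x) * weight x) ≡ total
      count = trans (W.double-count Low? (λ z → ω (W.m z))) (sum-cong (λ z → cong (_* ω (W.m z))
        (#-cong (λ x → Low? x ×-dec Adj? z x) (λ x → Adj? z x ×-dec Low? x) (λ x (a , b) → b , a) (λ x (a , b) → b , a))))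
      left : 2 * (p * L) * # Low? ≤ (p + 8) * total
      left = ≤-trans (≤-reflexive (trans (*-comm (2 * (p * L)) (# Low?)) (≡-sym (sum-indicator-* Low? (2 * (p * L))))))
        (≤-trans (sum-on-≤ Low? (λ _ → 2 * (p * L)) (λ x → (p + 8) * weight x) weight-low)
        (≤-reflexive (trans (sum-on-* Low? (p + 8) weight) (cong ((p + 8) *_) count))))
      right : suc h * total ≤ sum share * L
      right = ≤-trans (≤-reflexive (≡-sym (sum-* (suc h) (λ z → W.degA z * ω (W.m z))))) (≤-trans (sum-mono vertex-bound)
        (≤-reflexive (trans (sum-cong (λ z → *-comm (share z) L)) (trans (sum-* L share) (*-comm L (sum share))))))
      main : 2 * p * suc h * # Low? ≤ (p + 8) * (suc s * # Low? + (s + g) * # Middle? + suc h * # High?)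
      main = *-cancelʳ-≤ _ _ L ⦃ L>0 ⦄ (≤-trans (≤-reflexive (e₁ p (suc h) (# Low?) L)) (≤-trans (*-monoʳ-≤ (suc h) left)
        (≤-trans (≤-reflexive (e₂ (suc h) (p + 8) total)) (≤-trans (*-monoʳ-≤ (p + 8) right)
          (≤-reflexive (trans (cong (λ t → (p + 8) * (t * L)) share-sum) (≡-sym (*-assoc (p + 8) _ L))))))))
        where
        e₁ : ∀ p u a L → 2 * p * u * a * L ≡ u * (2 * (p * L) * a)
        e₁ = solve-∀
        e₂ : ∀ u c t → u * (c * t) ≡ c * (u * t)
        e₂ = solve-∀

#-∪∩ : ∀ {n} {P Q : Fin n → Set} (P? : ∀ i → Dec (P i)) (Q? : ∀ i → Dec (Q i)) →
       # (λ i → P? i ⊎-dec Q? i) + # (λ i → P? i ×-dec Q? i) ≡ # P? + # Q?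
#-∪∩ P? Q? = trans (≡-sym (sum-+ (λ i → indicator (P? i ⊎-dec Q? i)) _))
  (trans (sum-cong (λ i → go (P? i) (Q? i))) (sum-+ (indicator ∘ P?) (indicator ∘ Q?)))
  where
  go : ∀ {P Q : Set} (p? : Dec P) (q? : Dec Q) →
       indicator (p? ⊎-dec q?) + indicator (p? ×-dec q?) ≡ indicator p? + indicator q?
  go (yes _) (yes _) = refl
  go (yes _) (no _)  = refl
  go (no _)  (yes _) = refl
  go (no _)  (no _)  = refl

sum-++ : ∀ m {n} (f : Fin (m + n) → ℕ) → sum f ≡ sum (λ i → f (i ↑ˡ n)) + sum (λ j → f (m ↑ʳ j))
sum-++ zero    f = refl
sum-++ (suc m) f = trans (cong (f zero +_) (sum-++ m (f ∘ suc))) (≡-sym (+-assoc (f zero) _ _))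

-- Matchings

-- Rado's proof of Hall's theorem: as long as some active vertex has two neighbours,
-- one of the two edges can be removed without violating Hall's condition.
module Hall {l r : ℕ} {Active : Fin l → Set} (Active? : ∀ i → Dec (Active i)) where

  Edges : Set
  Edges = Fin l → Fin r → Bool

  module _ (E : Edges) (P : Fin l → Set) (P? : ∀ i → Dec (P i)) where
    Neighbour : Fin r → Set
    Neighbour y = ∃[ i ] (P i × T (E i y))

    Neighbour? : ∀ y → Dec (Neighbour y)
    Neighbour? y = any? (λ i → P? i ×-dec T? (E i y))

  Condition : Edges → Set₁
  Condition E = ∀ (P : Fin l → Set) (P? : ∀ i → Dec (P i)) → (∀ i → P i → Active i) → # P? ≤ # (Neighbour? E P P?)

  Violator : Edges → Set₁
  Violator E = Σ[ P ∈ (Fin l → Set) ] Σ[ P? ∈ (∀ i → Dec (P i)) ] ((∀ i → P i → Active i) × suc (# (Neighbour? E P P?)) ≤ # P?)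

  member : Vec Bool l → Fin l → Set
  member p i = T (lookup p i)

  member? : ∀ p i → Dec (member p i)
  member? p i = T? (lookup p i)

  -- Decidable predicates are replaced by Boolean vectors, of which there are finitely many, so a
  -- search settles the condition.
  decide : ∀ E → Condition E ⊎ Violator E
  decide E = go (anySubset? (λ p → all? (λ i → ¬? (member? p i ×-dec ¬? (Active? i))) ×-dec
                              (suc (# (Neighbour? E (member p) (member? p))) ≤? # (member? p))))
    where
    Bad : Vec Bool l → Set
    Bad p = (∀ i → ¬ (member p i × ¬ Active i)) × suc (# (Neighbour? E (member p) (member? p))) ≤ # (member? p)
    go : Dec (∃ Bad) → Condition E ⊎ Violator E
    go (yes (p , a , v)) = inj₂ (member p , member? p , (λ i m → decidable-stable (Active? i) (λ na → a i (m , na))) , v)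
    go (no none) = inj₁ λ P P? act → ≮⇒≥ λ lt → none (tabulate (does ∘ P?) ,
        (λ i (m , na) → na (act i (from P P? i m))) ,
        ≤-trans (s≤s (≤-reflexive (#-cong (Neighbour? E _ (member? (tabulate (does ∘ P?)))) (Neighbour? E P P?)
            (λ y (i , m , e) → i , from P P? i m , e) (λ y (i , m , e) → i , to P P? i m , e))))
          (≤-trans lt (≤-reflexive (#-cong P? (member? (tabulate (does ∘ P?))) (to P P?) (from P P?)))))
      where
      from : ∀ P (P? : ∀ i → Dec (P i)) i → member (tabulate (does ∘ P?)) i → P i
      from P P? i m with subst T (lookup∘tabulate (does ∘ P?) i) m
      ... | t with P? i
      ...   | yes q = q
      from P P? i m | () | no _
      to : ∀ P (P? : ∀ i → Dec (P i)) i → P i → member (tabulate (does ∘ P?)) i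
      to P P? i q = subst T (≡-sym (trans (lookup∘tabulate (does ∘ P?) i) (dec-true (P? i) q))) tt

  remove : Edges → Fin l → Fin r → Edges
  remove E i y j z = E j z ∧ not (does (j ≟ i) ∧ does (z ≟ y))

  removed : ∀ E i y {j z} → T (remove E i y j z) → T (E j z)
  removed E i y {j} {z} t with E j z
  ... | true = tt

  removed-≢ : ∀ E i y → ¬ T (remove E i y i y)
  removed-≢ E i y t rewrite dec-true (i ≟ i) refl | dec-true (y ≟ y) refl with E i y
  ... | true = t
  ... | false = t

  keep : ∀ E i y {j z} → ¬ (j ≡ i × z ≡ y) → T (E j z) → T (remove E i y j z)
  keep E i y {j} {z} ne t with E j z | j ≟ i | z ≟ y
  ... | true | yes p | yes q = ne (p , q)
  ... | true | yes _ | no _  = tt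
  ... | true | no _  | _     = tt

  size : Edges → ℕ
  size E = sum (λ i → # (λ y → T? (E i y)))

  remove-size : ∀ E i y → T (E i y) → suc (size (remove E i y)) ≤ size E
  remove-size E i y e = sum-strict i (λ j → #-mono (λ z → T? (remove E i y j z)) (λ z → T? (E j z)) (λ z → removed E i y))
    (≤-trans (s≤s (#-mono (λ z → T? (remove E i y i z)) (λ z → T? (E i z) ×-dec ¬? (z ≟ y))
       (λ z t → removed E i y t , λ { refl → removed-≢ E i y t }))) (≤-reflexive (≡-sym (#-remove (λ z → T? (E i z)) y e))))


  -- Deleting an edge at `i` does not change the neighbourhood of a set that avoids `i`.
  violator-contains : ∀ {E} → Condition E → ∀ {i y} (v : Violator (remove E i y)) → proj₁ v i
  violator-contains {E} hall {i} {y} (P , P? , act , lt) = decidable-stable (P? i) λ ¬Pi →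
    1+n≰n (≤-trans lt (≤-trans (hall P P? act) (#-mono (Neighbour? E P P?) (Neighbour? (remove E i y) P P?)
      (λ z (j , Pj , e) → j , Pj , keep E i y (λ { (refl , _) → ¬Pi Pj }) e))))

  -- Submodularity: the union of the violators has its neighbours in N₁ ∪ N₂, since each deleted
  -- edge survives in the other graph, and their intersection without `i` has its neighbours in N₁ ∩
  -- N₂. Hence |P| + |Q| ≤ |N₁| + |N₂| + 1, one less than two violations require.
  two-violators : ∀ {E} → Condition E → ∀ {i y₁ y₂} → y₁ ≢ y₂ →
                  Violator (remove E i y₁) → Violator (remove E i y₂) → ⊥
  two-violators {E} hall {i} {y₁} {y₂} ne v₁@(P , P? , actP , ltP) v₂@(Q , Q? , actQ , ltQ) =
    1+n≰n (≤-trans (s≤s (≤-trans (≤-reflexive (≡-sym (#-∪∩ P? Q?))) (≤-trans (+-mono-≤ union inter)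
        (≤-reflexive (trans (+-suc _ (# (λ y → N₁? y ×-dec N₂? y))) (cong suc (#-∪∩ N₁? N₂?)))))))
      (≤-trans (≤-reflexive (cong suc (≡-sym (+-suc (# N₁?) (# N₂?))))) (+-mono-≤ ltP ltQ)))
    where
    Pi : P i
    Pi = violator-contains hall v₁
    Qi : Q i
    Qi = violator-contains hall v₂
    N₁? = Neighbour? (remove E i y₁) P P?
    N₂? = Neighbour? (remove E i y₂) Q Q?
    union : # (λ j → P? j ⊎-dec Q? j) ≤ # (λ y → N₁? y ⊎-dec N₂? y)
    union = ≤-trans (hall (λ j → P j ⊎ Q j) (λ j → P? j ⊎-dec Q? j) (λ j → [ actP j , actQ j ]′))
      (#-mono (Neighbour? E (λ j → P j ⊎ Q j) (λ j → P? j ⊎-dec Q? j)) (λ y → N₁? y ⊎-dec N₂? y) sub)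
      where
      sub : ∀ y → Neighbour E (λ j → P j ⊎ Q j) (λ j → P? j ⊎-dec Q? j) y →
            Neighbour (remove E i y₁) P P? y ⊎ Neighbour (remove E i y₂) Q Q? y
      sub y (j , inj₁ p , e) with (j ≟ i) ×-dec (y ≟ y₁)
      ... | no n = inj₁ (j , p , keep E i y₁ n e)
      ... | yes (refl , refl) = inj₂ (i , Qi , keep E i y₂ (λ (_ , q) → ne q) e)
      sub y (j , inj₂ p , e) with (j ≟ i) ×-dec (y ≟ y₂)
      ... | no n = inj₂ (j , p , keep E i y₂ n e)
      ... | yes (refl , refl) = inj₁ (i , Pi , keep E i y₁ (λ (_ , q) → ne (≡-sym q)) e)
    inter : # (λ j → P? j ×-dec Q? j) ≤ suc (# (λ y → N₁? y ×-dec N₂? y))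
    inter = ≤-trans (≤-reflexive (#-remove (λ j → P? j ×-dec Q? j) i (Pi , Qi))) (s≤s (≤-trans
      (hall R R? (λ j ((p , _) , _) → actP j p))
      (#-mono (Neighbour? E R R?) (λ y → N₁? y ×-dec N₂? y) (λ y (j , ((p , q) , n) , e) →
        (j , p , keep E i y₁ (λ (z , _) → n z) e) , (j , q , keep E i y₂ (λ (z , _) → n z) e)))))
      where
      R : Fin l → Set
      R j = (P j × Q j) × j ≢ i
      R? : ∀ j → Dec (R j)
      R? j = (P? j ×-dec Q? j) ×-dec ¬? (j ≟ i)

  Matching : Edges → Set
  Matching E = Σ[ f ∈ (∀ i → Active i → Fin r) ] ((∀ i a → T (E i (f i a))) × (∀ i j a b → f i a ≡ f j b → i ≡ j))

  -- Hall's condition for one vertex gives its partner; for two vertices it prevents the partners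
  -- from coinciding.
  functional : ∀ E → Condition E → (∀ i y₁ y₂ → Active i → T (E i y₁) → T (E i y₂) → y₁ ≡ y₂) → Matching E
  functional E hall uniq = (λ i a → proj₁ (some i a)) , (λ i a → proj₂ (some i a)) , inj
    where
    some : ∀ i → Active i → ∃[ y ] T (E i y)
    some i a = let (y , j , j≡i , e) = #-some (Neighbour? E (_≡ i) (_≟ i)) (≤-trans
                     (≤-trans (s≤s z≤n) (≤-reflexive (≡-sym (#-remove (_≟ i) i refl)))) (hall (_≡ i) (_≟ i) (λ j e → subst Active (≡-sym e) a)))
               in y , subst (λ j → T (E j y)) j≡i e
    inj : ∀ i j a b → proj₁ (some i a) ≡ proj₁ (some j b) → i ≡ j
    inj i j a b eq = decidable-stable (i ≟ j) λ i≢j → 1+n≰n (≤-trans (two i≢j) (≤-trans (hall Q Q? actQ)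
        (#-list (Neighbour? E Q Q?) (proj₁ (some i a) ∷ []) only)))
      where
      Q : Fin l → Set
      Q t = t ≡ i ⊎ t ≡ j
      Q? : ∀ t → Dec (Q t)
      Q? t = (t ≟ i) ⊎-dec (t ≟ j)
      actQ : ∀ t → Q t → Active t
      actQ t (inj₁ refl) = a
      actQ t (inj₂ refl) = b
      two : i ≢ j → 2 ≤ # Q?
      two i≢j = ≤-trans (s≤s (≤-trans (s≤s z≤n) (≤-reflexive (≡-sym (#-remove (λ t → Q? t ×-dec ¬? (t ≟ i)) j (inj₂ refl , ≢-sym i≢j))))))
                  (≤-reflexive (≡-sym (#-remove Q? i (inj₁ refl))))
      only : ∀ y → Neighbour E Q Q? y → y ∈ (proj₁ (some i a) ∷ [])
      only y (t , inj₁ refl , e) = here (uniq i y _ a e (proj₂ (some i a)))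
      only y (t , inj₂ refl , e) = here (trans (uniq j y _ b e (proj₂ (some j b))) (≡-sym eq))

  restrict : ∀ E i y → Matching (remove E i y) → Matching E
  restrict E i y (f , e , inj) = f , (λ j a → removed E i y (e j a)) , inj

  Branching : Edges → Set
  Branching E = ∃[ i ] (Active i × ∃[ y₁ ] ∃[ y₂ ] (T (E i y₁) × T (E i y₂) × y₁ ≢ y₂))

  branching? : ∀ E → Dec (Branching E)
  branching? E = any? λ i → Active? i ×-dec any? λ y₁ → any? λ y₂ → T? (E i y₁) ×-dec T? (E i y₂) ×-dec ¬? (y₁ ≟ y₂)

  matching : ∀ fuel E → size E ≤ fuel → Condition E → Matching E
  matching fuel E le hall = go (branching? E) fuel le
    where
    go : Dec (Branching E) → ∀ fuel → size E ≤ fuel → Matching E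
    go (no nb) fuel le = functional E hall λ i y₁ y₂ a e₁ e₂ → decidable-stable (y₁ ≟ y₂) λ ne → nb (i , a , y₁ , y₂ , e₁ , e₂ , ne)
    go (yes (i , a , y₁ , y₂ , e₁ , e₂ , ne)) zero le = case ≤-trans (remove-size E i y₁ e₁) le of λ ()
    go (yes (i , a , y₁ , y₂ , e₁ , e₂ , ne)) (suc fuel) le = try (decide (remove E i y₁)) (decide (remove E i y₂))
      where
      try : Condition (remove E i y₁) ⊎ Violator (remove E i y₁) → Condition (remove E i y₂) ⊎ Violator (remove E i y₂) → Matching E
      try (inj₁ c) _ = restrict E i y₁ (matching fuel _ (≤-pred (≤-trans (remove-size E i y₁ e₁) le)) c)
      try (inj₂ _) (inj₁ c) = restrict E i y₂ (matching fuel _ (≤-pred (≤-trans (remove-size E i y₂ e₂) le)) c)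
      try (inj₂ v) (inj₂ w) = ⊥-elim (two-violators hall ne v w)

-- Hamiltonian cycles

data Walk {n} (E : Fin n → Fin n → Set) : Fin n → Fin n → List (Fin n) → Set where
  stop : ∀ v → Walk E v v (v ∷ [])
  step : ∀ {u w v xs} → E u w → Walk E w v xs → Walk E u v (u ∷ xs)

HamiltonianCycle : ∀ {n} → (Fin n → Fin n → Set) → Set
HamiltonianCycle {n} E = ∃[ u ] ∃[ v ] ∃[ xs ] (Walk E u v xs × xs ↭ allFin n × E v u)

module _ {n} {E : Fin n → Fin n → Set} where

  start-∈ : ∀ {u v xs} → Walk E u v xs → u ∈ xs
  start-∈ (stop _)   = here refl
  start-∈ (step _ _) = here refl

  end-∈ : ∀ {u v xs} → Walk E u v xs → v ∈ xs
  end-∈ (stop _)   = here refl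
  end-∈ (step _ w) = there (end-∈ w)

  join : ∀ {u v w t xs ys} → Walk E u v xs → E v w → Walk E w t ys → Walk E u t (xs ++ ys)
  join (stop _)   e q = step e q
  join (step f p) e q = step f (join p e q)

  reverse-walk : (∀ {u v} → E u v → E v u) → ∀ {u v xs} → Walk E u v xs → ∃[ ys ] (Walk E v u ys × ys ↭ xs)
  reverse-walk s (stop v) = _ , stop v , ↭-refl
  reverse-walk s (step {u} e w) = let (ys , w′ , p) = reverse-walk s w in
    ys ++ [ u ] , join w′ (s e) (stop u) , ↭-trans (↭-sym (∷↭∷ʳ u ys)) (↭-prep u p)

  closed-walk-short : ∀ {u xs} → Walk E u u xs → Unique xs → length xs ≤ 1
  closed-walk-short (stop _)   _        = ≤-refl
  closed-walk-short (step _ w) (ne ∷ _) = contradiction refl (All.lookup ne (end-∈ w))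

  lookup-start : ∀ {u v xs} → Walk E u v xs → ∀ j → toℕ j ≡ 0 → List.lookup xs j ≡ u
  lookup-start (stop _)   zero _ = refl
  lookup-start (step _ _) zero _ = refl

  lookup-end : ∀ {u v xs} → Walk E u v xs → ∀ i → suc (toℕ i) ≡ length xs → List.lookup xs i ≡ v
  lookup-end (stop _)            zero    _ = refl
  lookup-end (step _ (stop _))   zero    ()
  lookup-end (step _ (step _ _)) zero    ()
  lookup-end (step _ w)          (suc i) p = lookup-end w i (suc-injective p)

  lookup-step : ∀ {u v xs} → Walk E u v xs → ∀ i j → toℕ j ≡ suc (toℕ i) → E (List.lookup xs i) (List.lookup xs j)
  lookup-step (stop _)       zero    zero    ()
  lookup-step (step {u} e w) zero    (suc j) p = subst (E u) (≡-sym (lookup-start w j (suc-injective p))) e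
  lookup-step (step e w)     (suc i) (suc j) p = lookup-step w i j (suc-injective p)

unique-↭ : ∀ {n} {xs : List (Fin n)} → xs ↭ allFin n → Unique xs
unique-↭ {n} p = Unique-resp-↭ (setoid (Fin n)) (↭⇒↭ₛ (↭-sym p)) (allFin⁺ n)

length-↭ : ∀ {n} {xs : List (Fin n)} → xs ↭ allFin n → length xs ≡ n
length-↭ p = trans (↭-length p) (length-tabulate id)

hamiltonian : ∀ {n} (G : Graph n) → 3 ≤ n → HamiltonianCycle (λ u v → T (adj G u v)) → Hamiltonian G
hamiltonian {n} G 3≤n (u , v , xs , w , p , e) = 3≤n , mk↔ₛ′ to from to-from from-to , adjacent
  where
  len : n ≡ length xs
  len = ≡-sym (length-↭ p)
  all : ∀ z → z ∈ xs
  all z = ∈-resp-↭ (↭-sym p) (∈-allFin z)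
  to : Fin n → Fin n
  to i = List.lookup xs (cast len i)
  from : Fin n → Fin n
  from z = cast (≡-sym len) (index (all z))
  cast-cancel : ∀ {a b} (q : a ≡ b) (r : b ≡ a) (i : Fin a) → cast r (cast q i) ≡ i
  cast-cancel q r i = trans (cast-trans q r i) (cast-is-id _ i)
  to-from : ∀ z → to (from z) ≡ z
  to-from z = trans (cong (List.lookup xs) (cast-cancel (≡-sym len) len _)) (≡-sym (lookup-index (all z)))
  index-lookup : ∀ (ys : List (Fin n)) i → index (∈-lookup {xs = ys} i) ≡ i
  index-lookup (y ∷ ys) zero    = refl
  index-lookup (y ∷ ys) (suc i) = cong suc (index-lookup ys i)
  -- The list has no repetitions, so membership proofs are unique and the index found for an entry
  -- is its own position.
  from-to : ∀ i → from (to i) ≡ i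
  from-to i = trans (cong (cast (≡-sym len)) (trans (cong index (unique⇒irrelevant (unique-↭ p) _ (∈-lookup (cast len i))))
    (index-lookup xs (cast len i)))) (cast-cancel len (≡-sym len) i)
  adjacent : ∀ i j → toℕ j ≡ suc (toℕ i) ⊎ (suc (toℕ i) ≡ n × toℕ j ≡ 0) → T (adj G (to i) (to j))
  adjacent i j (inj₁ q) = lookup-step w _ _ (trans (toℕ-cast len j) (trans q (cong suc (≡-sym (toℕ-cast len i)))))
  adjacent i j (inj₂ (q , r)) = subst (λ z → T (adj G z (to j))) (≡-sym (lookup-end w _ (trans (cong suc (toℕ-cast len i)) (trans q len))))
    (subst (λ z → T (adj G v z)) (≡-sym (lookup-start w _ (trans (toℕ-cast len j) r))) e)

-- Crossing edges and the Bondy-Chvátal closure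

countIn : ∀ {A : Set} {P : A → Set} → (∀ i → Dec (P i)) → List A → ℕ
countIn P? []       = 0
countIn P? (x ∷ xs) = indicator (P? x) + countIn P? xs

countIn-↭ : ∀ {A : Set} {P : A → Set} (P? : ∀ i → Dec (P i)) {xs ys} → xs ↭ ys → countIn P? xs ≡ countIn P? ys
countIn-↭ P? Perm.refl         = refl
countIn-↭ P? (Perm.prep x p)   = cong (indicator (P? x) +_) (countIn-↭ P? p)
countIn-↭ P? (Perm.swap x y p) = trans (cong (λ t → indicator (P? x) + (indicator (P? y) + t)) (countIn-↭ P? p))
  (rotate (indicator (P? x)) (indicator (P? y)) _)
  where
  rotate : ∀ a b c → a + (b + c) ≡ b + (a + c)
  rotate = solve-∀
countIn-↭ P? (Perm.trans p q)  = trans (countIn-↭ P? p) (countIn-↭ P? q)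

countIn-tabulate : ∀ {n} {A : Set} {P : A → Set} (P? : ∀ i → Dec (P i)) (f : Fin n → A) → countIn P? (List.tabulate f) ≡ # (P? ∘ f)
countIn-tabulate {zero}  P? f = refl
countIn-tabulate {suc n} P? f = cong (indicator (P? (f zero)) +_) (countIn-tabulate P? (f ∘ suc))

module Crossing {n} {E : Fin n → Fin n → Set} {P Q : Fin n → Set} (P? : ∀ i → Dec (P i)) (Q? : ∀ i → Dec (Q i)) where

  Cross : Fin n → Fin n → List (Fin n) → Set
  Cross u v xs = ∃[ c ] ∃[ d ] ∃[ ys ] ∃[ zs ] (Walk E u c ys × Walk E d v zs × xs ≡ ys ++ zs × Q c × P d)

  -- Without a consecutive pair in Q and P, each of the length - 1 pairs contributes at most one to
  -- the members of P after the first vertex plus the members of Q before the last.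
  crossing : ∀ {u v xs} → Walk E u v xs → Cross u v xs ⊎
             suc (countIn P? xs + countIn Q? xs) ≤ indicator (P? u) + indicator (Q? v) + length xs
  crossing (stop v) = inj₂ (≤-reflexive (i (indicator (P? v)) (indicator (Q? v))))
    where
    i : ∀ a b → suc (a + 0 + (b + 0)) ≡ a + b + 1
    i = solve-∀
  crossing (step {u} {w} {v} {xs} e p) with crossing p
  ... | inj₁ (c , d , ys , zs , y , z , eq , q , r) = inj₁ (c , d , u ∷ ys , zs , step e y , z , cong (u ∷_) eq , q , r)
  ... | inj₂ le = go (Q? u) (P? w) le
    where
    pu cp qv cq : ℕ
    pu = indicator (P? u)
    cp = countIn P? xs
    qv = indicator (Q? v)
    cq = countIn Q? xs
    i : ∀ a b c d → suc (a + c + (b + d)) ≡ suc (c + d) + (a + b)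
    i = solve-∀
    j : ∀ a b c d l → c + d + l + (a + b) ≡ (b + c) + (a + d + l)
    j = solve-∀
    go : (q? : Dec (Q u)) (p? : Dec (P w)) → suc (cp + cq) ≤ indicator p? + qv + length xs →
         Cross u v (u ∷ xs) ⊎ suc (pu + cp + (indicator q? + cq)) ≤ pu + qv + suc (length xs)
    go (yes q) (yes r) _ = inj₁ (u , w , [ u ] , xs , stop u , p , refl , q , r)
    go q? p? le = [ inj₁ , (λ le₁ → inj₂ (≤-trans (≤-reflexive (i pu (indicator q?) cp cq))
        (≤-trans (+-monoˡ-≤ (pu + indicator q?) le) (≤-trans (≤-reflexive (j pu (indicator q?) (indicator p?) qv (length xs)))
        (≤-trans (+-monoˡ-≤ (pu + qv + length xs) le₁) (≤-reflexive (≡-sym (+-suc (pu + qv) (length xs))))))))) ]′ (one q? p?)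
      where
      one : (q? : Dec (Q u)) (p? : Dec (P w)) → Cross u v (u ∷ xs) ⊎ indicator q? + indicator p? ≤ 1
      one (yes q) (yes r) = inj₁ (u , w , [ u ] , xs , stop u , p , refl , q , r)
      one (yes q) (no _)  = inj₂ ≤-refl
      one (no _)  (yes _) = inj₂ ≤-refl
      one (no _)  (no _)  = inj₂ z≤n

Joins : ∀ {n} → Fin n → Fin n → Fin n → Fin n → Set
Joins c d a b = (a ≡ c × b ≡ d) ⊎ (a ≡ d × b ≡ c)

module BondyChvatal {n} (3≤n : 3 ≤ n) {E : Fin n → Fin n → Set} (E? : ∀ u v → Dec (E u v)) (E-sym : ∀ {u v} → E u v → E v u)
           (E-irrefl : ∀ {v} → ¬ E v v) where

  -- Ore's exchange: if `c`, `d` are consecutive with `v` adjacent to `c` and `u` to `d`, then u ...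
  -- c v ... d u is a cycle. Such a pair exists, for otherwise `crossing` would bound the degree sum
  -- below n.
  close : ∀ {u v xs} → n ≤ # (E? u) + # (E? v) → Walk E u v xs → xs ↭ allFin n → HamiltonianCycle E
  close {u} {v} {xs} le w p with Crossing.crossing {E = E} (E? u) (E? v) w
  ... | inj₁ (c , d , ys , zs , y , z , refl , vc , ud) = let (zs′ , z′ , q) = reverse-walk E-sym z in
        u , d , ys ++ zs′ , join y (E-sym vc) z′ , ↭-trans (++⁺ˡ ys q) p , E-sym ud
  ... | inj₂ lt = contradiction (≤-trans (s≤s le) (≤-trans (s≤s (≤-reflexive (≡-sym (cong₂ _+_ (count u) (count v)))))
        (≤-trans lt (≤-reflexive (cong₂ _+_ (cong₂ _+_ (indicator-no (E? u u) E-irrefl) (indicator-no (E? v v) E-irrefl)) (length-↭ p)))))) 1+n≰n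
    where
    count : ∀ t → countIn (E? t) xs ≡ # (E? t)
    count t = trans (countIn-↭ (E? t) p) (countIn-tabulate (E? t) id)

  module _ {E′ : Fin n → Fin n → Set} where

    avoid : ∀ {d a b xs} → (∀ {p q} → E′ p q → E p q ⊎ (p ≡ d ⊎ q ≡ d)) → d ∉ xs → Walk E′ a b xs → Walk E a b xs
    avoid new d∉ (stop v)   = stop v
    avoid new d∉ (step e w) with new e
    ... | inj₁ e′          = step e′ (avoid new (d∉ ∘ there) w)
    ... | inj₂ (inj₁ refl) = contradiction (here refl) d∉
    ... | inj₂ (inj₂ refl) = contradiction (there (start-∈ w)) d∉

    -- A spanning path from `d` to `c` cannot use the new edge: `d` occurs only at the start, and a
    -- first step to `c` would end the path after two of the at least three vertices.
    spanning-path : ∀ {c d xs} → (∀ {p q} → E′ p q → E p q ⊎ Joins c d p q) → Walk E′ d c xs → xs ↭ allFin n → Walk E d c xs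
    spanning-path {c} {d} new w p = go w (unique-↭ p) (≤-trans 3≤n (≤-reflexive (≡-sym (length-↭ p))))
      where
      touch : ∀ {p q} → E′ p q → E p q ⊎ (p ≡ d ⊎ q ≡ d)
      touch e = [ inj₁ , [ inj₂ ∘ inj₂ ∘ proj₂ , inj₂ ∘ inj₁ ∘ proj₁ ]′ ]′ (new e)
      go : ∀ {xs} → Walk E′ d c xs → Unique xs → 3 ≤ length xs → Walk E d c xs
      go (stop _) _ (s≤s ())
      go (step e w) (d≢ ∷ un) (s≤s 2≤) = step (old (new e)) (avoid touch d∉ w)
        where
        d∉ : d ∉ _
        d∉ m = All.lookup d≢ m refl
        old : E d _ ⊎ Joins c d d _ → E d _
        old (inj₁ e′) = e′
        old (inj₂ (inj₁ (_ , refl))) = contradiction (start-∈ w) d∉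
        old (inj₂ (inj₂ (_ , refl))) = contradiction (≤-trans 2≤ (closed-walk-short w un)) 1+n≰n

    first-new : ∀ {c d a b xs} → (∀ {p q} → E′ p q → E p q ⊎ Joins c d p q) → Walk E′ a b xs →
      Walk E a b xs ⊎ (∃[ p ] ∃[ q ] ∃[ ys ] ∃[ zs ] (Walk E′ a p ys × Walk E′ q b zs × xs ≡ ys ++ zs × Joins c d p q))
    first-new new (stop v) = inj₁ (stop v)
    first-new new (step {u} e w) with new e | first-new new w
    ... | inj₂ j  | _ = inj₂ (_ , _ , _ , _ , stop u , w , refl , j)
    ... | inj₁ e′ | inj₁ w′ = inj₁ (step e′ w′)
    ... | inj₁ e′ | inj₂ (p , q , ys , zs , y , z , refl , j) = inj₂ (p , q , u ∷ ys , zs , step e y , z , refl , j)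

    close-path : ∀ {c d} → (∀ {p q} → E′ p q → E p q ⊎ Joins c d p q) → n ≤ # (E? c) + # (E? d) →
           ∀ {p q xs} → Joins c d p q → Walk E′ q p xs → xs ↭ allFin n → HamiltonianCycle E
    close-path {c} new le (inj₁ (refl , refl)) w p = close (≤-trans le (≤-reflexive (+-comm (# (E? c)) _))) (spanning-path new w p) p
    close-path new le (inj₂ (refl , refl)) w p = close le (spanning-path ([ inj₁ , inj₂ ∘ ⊎-swap ]′ ∘ new) w p) p

    -- A cycle through the new edge is rotated until this edge closes it; what remains is a
    -- Hamiltonian path of `E` between `c` and `d`, to which `close` applies.
    remove-edge : ∀ {c d} → (∀ {p q} → E′ p q → E p q ⊎ Joins c d p q) → n ≤ # (E? c) + # (E? d) →
                  HamiltonianCycle E′ → HamiltonianCycle E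
    remove-edge {c} {d} new le (a , b , xs , w , p , e) with first-new new w | new e
    ... | inj₁ w′ | inj₁ e′ = a , b , xs , w′ , p , e′
    ... | _       | inj₂ j  = close-path new le j w p
    ... | inj₂ (r , q , ys , zs , y , z , refl , j) | inj₁ _ = close-path new le j (join z e y) (↭-trans (++-comm zs ys) p)

-- A cycle through the clique and the private neighbours

complete-↭ : ∀ {n} {xs : List (Fin n)} → Unique xs → (∀ z → z ∈ xs) → xs ↭ allFin n
complete-↭ {n} un all = ∼bag⇒↭ (unique∧set⇒bag un (allFin⁺ n) (mk⇔ (λ _ → ∈-allFin _) (λ _ → all _)))

-- The vertices outside S form a clique, so a cycle is obtained by visiting each vertex s of S
-- between its two private neighbours partner false s and partner true s.
module Blocks {n} (3≤n : 3 ≤ n) {E : Fin n → Fin n → Set} (E-sym : ∀ {u v} → E u v → E v u)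
              {S : Fin n → Set} (S? : ∀ v → Dec (S v)) (partner : Bool → Fin n → Fin n)
              (partner-adj : ∀ b {s} → S s → E s (partner b s))
              (partner-∉ : ∀ b {s} → S s → ¬ S (partner b s))
              (partner-inj : ∀ {b c s t} → S s → S t → partner b s ≡ partner c t → b ≡ c × s ≡ t)
              (clique : ∀ {u v} → ¬ S u → ¬ S v → u ≢ v → E u v) where

  Used : Fin n → Set
  Used v = ∃[ s ] (S s × (partner false s ≡ v ⊎ partner true s ≡ v))

  Used? : ∀ v → Dec (Used v)
  Used? v = any? (λ s → S? s ×-dec ((partner false s ≟ v) ⊎-dec (partner true s ≟ v)))

  blockOf : ∀ v → Dec (S v) → Dec (Used v) → List (Fin n)
  blockOf v (yes _) _       = partner false v ∷ v ∷ partner true v ∷ []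
  blockOf v (no _)  (yes _) = []
  blockOf v (no _)  (no _)  = [ v ]

  block : Fin n → List (Fin n)
  block v = blockOf v (S? v) (Used? v)

  -- Membership in a block, freed from the case distinctions of `blockOf`; it shows that every
  -- vertex lies in only one block.
  data Owner (v : Fin n) : Fin n → Set where
    centre : S v → Owner v v
    side   : ∀ b → S v → Owner v (partner b v)
    free   : ¬ S v → ¬ Used v → Owner v v

  used : ∀ b {s} → S s → Used (partner b s)
  used false Ss = _ , Ss , inj₁ refl
  used true  Ss = _ , Ss , inj₂ refl

  owner : ∀ {v z} → z ∈ block v → Owner v z
  owner {v} = go (S? v) (Used? v)
    where
    go : ∀ {z} (s? : Dec (S v)) (u? : Dec (Used v)) → z ∈ blockOf v s? u? → Owner v z
    go (yes s) _       (here refl)                 = side false s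
    go (yes s) _       (there (here refl))         = centre s
    go (yes s) _       (there (there (here refl))) = side true s
    go (no s)  (no u)  (here refl)                 = free s u

  owner-unique : ∀ {v w z} → Owner v z → Owner w z → v ≡ w
  owner-unique p q = go p q refl
    where
    go : ∀ {v w z z′} → Owner v z → Owner w z′ → z ≡ z′ → v ≡ w
    go (centre _) (centre _) e    = e
    go (centre s) (side b t) refl = contradiction s (partner-∉ b t)
    go (centre _) (free _ _) e    = e
    go (side b s) (centre t) refl = contradiction t (partner-∉ b s)
    go (side b s) (side c t) e    = proj₂ (partner-inj s t e)
    go (side b s) (free _ u) refl = contradiction (used b s) u
    go (free _ _) (centre _) e    = e
    go (free _ u) (side b t) refl = contradiction (used b t) u
    go (free _ _) (free _ _) e    = e

  owned : ∀ z → ∃[ v ] z ∈ block v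
  owned z with S? z in s | Used? z in u
  ... | yes _ | _ = z , in-block
    where
    in-block : z ∈ block z
    in-block rewrite s = there (here refl)
  ... | no _ | no _ = z , in-block
    where
    in-block : z ∈ block z
    in-block rewrite s | u = here refl
  ... | no _ | yes (v , Sv , p) = v , go (S? v) p
    where
    go : (s? : Dec (S v)) → partner false v ≡ z ⊎ partner true v ≡ z → z ∈ blockOf v s? (Used? v)
    go (no ¬Sv) _          = contradiction Sv ¬Sv
    go (yes _) (inj₁ refl) = here refl
    go (yes _) (inj₂ refl) = there (there (here refl))

  -- A used vertex has an empty block. The other blocks begin and end outside `S`, so that the
  -- clique joins consecutive ones.
  ClosedUp : List (Fin n) → Set
  ClosedUp xs = xs ≡ [] ⊎ (∃[ a ] ∃[ b ] (¬ S a × ¬ S b × Walk E a b xs))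

  block-walk : ∀ v → ClosedUp (block v)
  block-walk v with S? v | Used? v
  ... | yes s | _ = inj₂ (_ , _ , partner-∉ false s , partner-∉ true s ,
                      step (E-sym (partner-adj false s)) (step (partner-adj true s) (stop _)))
  ... | no _  | yes _ = inj₁ refl
  ... | no s  | no _  = inj₂ (v , v , s , s , stop v)

  block-unique : ∀ v → Unique (block v)
  block-unique v with S? v | Used? v
  ... | yes s | _ = (out false s ∷ (λ e → case-bool (proj₁ (partner-inj s s e))) ∷ []) ∷ (≢-sym (out true s) ∷ []) ∷ [] ∷ []
    where
    out : ∀ b → S v → partner b v ≢ v
    out b s e = partner-∉ b s (subst S (≡-sym e) s)
    case-bool : false ≢ true
    case-bool ()
  ... | no _ | yes _ = []
  ... | no _ | no _  = [] ∷ []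

  tour : List (Fin n) → List (Fin n)
  tour = concatMap block

  tour-owner : ∀ {z} vs → z ∈ tour vs → ∃[ v ] (v ∈ vs × Owner v z)
  tour-owner (v ∷ vs) m with ∈-++⁻ (block v) m
  ... | inj₁ p = v , here refl , owner p
  ... | inj₂ p = let (w , q , o) = tour-owner vs p in w , there q , o

  ∈-tour : ∀ {v z} vs → v ∈ vs → z ∈ block v → z ∈ tour vs
  ∈-tour (v ∷ vs) (here refl) m = ∈-++⁺ˡ m
  ∈-tour (v ∷ vs) (there p)   m = ∈-++⁺ʳ (block v) (∈-tour vs p m)

  disjoint : ∀ {v vs z} → Unique (v ∷ vs) → z ∈ block v → z ∈ tour vs → ⊥
  disjoint {vs = vs} (v∉ ∷ _) p q = let (w , w∈ , o) = tour-owner vs q in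
    All.lookup v∉ w∈ (owner-unique (owner p) o)

  tour-unique : ∀ vs → Unique vs → Unique (tour vs)
  tour-unique []       _          = []
  tour-unique (v ∷ vs) (v∉ ∷ un) = ++⁺ (block-unique v) (tour-unique vs un) (λ (p , q) → disjoint (v∉ ∷ un) p q)

  tour-walk : ∀ vs → Unique vs → ClosedUp (tour vs)
  tour-walk []       _ = inj₁ refl
  tour-walk (v ∷ vs) un@(_ ∷ un′) with block-walk v | tour-walk vs un′
  ... | inj₁ e | c      = subst ClosedUp (cong (_++ tour vs) (≡-sym e)) c
  ... | inj₂ w | inj₁ e = subst ClosedUp (trans (≡-sym (++-identityʳ (block v))) (cong (block v ++_) (≡-sym e))) (inj₂ w)
  ... | inj₂ (a , b , Ka , Kb , w) | inj₂ (a′ , b′ , Ka′ , Kb′ , w′) = inj₂ (a , b′ , Ka , Kb′ ,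
        join w (clique Kb Ka′ (λ { refl → disjoint un (end-∈ w) (start-∈ w′) })) w′)

  hamiltonianCycle : HamiltonianCycle E
  hamiltonianCycle = finish (tour-walk (allFin n) (allFin⁺ n))
    where
    xs : List (Fin n)
    xs = tour (allFin n)
    un : Unique xs
    un = tour-unique (allFin n) (allFin⁺ n)
    perm : xs ↭ allFin n
    perm = complete-↭ un (λ z → let (v , m) = owned z in ∈-tour (allFin n) (∈-allFin v) m)
    long : 3 ≤ length xs
    long = ≤-trans 3≤n (≤-reflexive (≡-sym (length-↭ perm)))
    finish : ClosedUp xs → HamiltonianCycle E
    finish (inj₁ e) = case-empty (≤-trans long (≤-reflexive (cong length e)))
      where
      case-empty : 3 ≤ 0 → HamiltonianCycle E
      case-empty ()
    finish (inj₂ (a , b , Ka , Kb , w)) = a , b , xs , w , perm , clique Kb Ka ne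
      where
      ne : b ≢ a
      ne refl = case-short (≤-trans long (closed-walk-short w un))
        where
        case-short : 3 ≤ 1 → ⊥
        case-short (s≤s ())

-- The closure of a critical graph

module Closure {n} (G : Graph n) (k : ℕ) (uncolourable : ¬ ColourableWith (adj G) k)
               (deg≤k : ∀ v → Degrees.deg G k uncolourable v ≤ k)
               (state : ∀ {x y} → T (adj G x y) → Recolouring.State G k uncolourable x y)
               (deg>0 : ∀ v → 1 ≤ Degrees.deg G k uncolourable v)
               (2n≤3k : 2 * n + 36 ≤ 3 * k) (3≤n : 3 ≤ n) where

  open Degrees G k uncolourable using (Adj; Adj?; Adj-sym; Adj-irrefl; deg)
  open Critical G k uncolourable deg≤k state deg>0

  -- Each small vertex occurs twice on the left side of the bipartite graph, so that a matching
  -- provides two private neighbours.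
  half : Bool → Fin n → Fin (n + n)
  half false v = v ↑ˡ n
  half true  v = n ↑ʳ v

  unhalf : Fin (n + n) → Fin n
  unhalf i = [ id , id ]′ (splitAt n i)

  unhalf-half : ∀ b v → unhalf (half b v) ≡ v
  unhalf-half false v = cong [ id , id ]′ (splitAt-↑ˡ n v n)
  unhalf-half true  v = cong [ id , id ]′ (splitAt-↑ʳ n n v)

  half-injective : ∀ b c {v w} → half b v ≡ half c w → b ≡ c × v ≡ w
  half-injective false false {v} {w} e = refl , inj₁-injective (trans (≡-sym (splitAt-↑ˡ n v n)) (trans (cong (splitAt n) e) (splitAt-↑ˡ n w n)))
  half-injective true  true  {v} {w} e = refl , inj₂-injective (trans (≡-sym (splitAt-↑ʳ n n v)) (trans (cong (splitAt n) e) (splitAt-↑ʳ n n w)))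
  half-injective false true  {v} {w} e with trans (≡-sym (splitAt-↑ˡ n v n)) (trans (cong (splitAt n) e) (splitAt-↑ʳ n n w))
  ... | ()
  half-injective true  false {v} {w} e with trans (≡-sym (splitAt-↑ʳ n n v)) (trans (cong (splitAt n) e) (splitAt-↑ˡ n w n))
  ... | ()

  module H = Hall {n + n} {n} {Small ∘ unhalf} (Small? ∘ unhalf)

  edges : H.Edges
  edges i y = adj G (unhalf i) y

  -- A set of copies is at most twice as large as its projection `Q`, and `expansion` gives `Q` at
  -- least twice as many neighbours.
  hall : H.Condition edges
  hall P P? act = ≤-trans (≤-reflexive (sum-++ n (indicator ∘ P?))) (≤-trans (+-mono-≤ (#-mono (P? ∘ half false) Q? (λ _ → inj₁))
      (#-mono (P? ∘ half true) Q? (λ _ → inj₂))) (≤-trans (≤-reflexive (cong (# Q? +_) (≡-sym (+-identityʳ (# Q?))))) (≤-trans (expansion Q? Q⊆Small)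
      (#-mono (Neighbour? Q? Q⊆Small) (H.Neighbour? edges P P?) to))))
    where
    Q : Fin n → Set
    Q v = P (half false v) ⊎ P (half true v)
    Q? : ∀ v → Dec (Q v)
    Q? v = P? (half false v) ⊎-dec P? (half true v)
    small : ∀ b v → P (half b v) → Small v
    small b v p = subst Small (unhalf-half b v) (act _ p)
    Q⊆Small : ∀ v → Q v → Small v
    Q⊆Small v = [ small false v , small true v ]′
    via : ∀ b x z → P (half b x) → Adj z x → H.Neighbour edges P P? z
    via b x z p a = half b x , p , subst (λ t → Adj t z) (≡-sym (unhalf-half b x)) (Adj-sym a)
    to : ∀ z → Neighbour Q? Q⊆Small z → H.Neighbour edges P P? z
    to z (x , inj₁ p , a) = via false x z p a
    to z (x , inj₂ p , a) = via true x z p a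

  abstract
    private-neighbours : H.Matching edges
    private-neighbours = H.matching _ edges ≤-refl hall

  active : ∀ b {v} → Small v → Small (unhalf (half b v))
  active b {v} = subst Small (≡-sym (unhalf-half b v))

  partnerOf : Bool → ∀ v → Dec (Small v) → Fin n
  partnerOf b v (yes s) = proj₁ private-neighbours (half b v) (active b s)
  -- A default value; the cycle uses partners of small vertices only.
  partnerOf b v (no _)  = v

  partner : Bool → Fin n → Fin n
  partner b v = partnerOf b v (Small? v)

  partner-adj : ∀ b {s} → Small s → Adj s (partner b s)
  partner-adj b {s} Ss = go (Small? s)
    where
    go : (d : Dec (Small s)) → Adj s (partnerOf b s d)
    go (yes a) = subst (λ t → Adj t (proj₁ private-neighbours (half b s) (active b a))) (unhalf-half b s) (proj₁ (proj₂ private-neighbours) (half b s) (active b a))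
    go (no ¬a) = contradiction Ss ¬a

  partner-∉ : ∀ b {s} → Small s → ¬ Small (partner b s)
  partner-∉ b Ss Sp = small-independent Ss Sp (partner-adj b Ss)

  partner-inj : ∀ {b c s t} → Small s → Small t → partner b s ≡ partner c t → b ≡ c × s ≡ t
  partner-inj {b} {c} {s} {t} Ss St = go (Small? s) (Small? t)
    where
    go : (d : Dec (Small s)) (e : Dec (Small t)) → partnerOf b s d ≡ partnerOf c t e → b ≡ c × s ≡ t
    go (yes a) (yes a′) e = half-injective b c (proj₂ (proj₂ private-neighbours) (half b s) (half c t) (active b a) (active c a′) e)
    go (no ¬a) _        _ = contradiction Ss ¬a
    go _       (no ¬a)  _ = contradiction St ¬a

  nonedges : {E : Fin n → Fin n → Set} → (∀ u v → Dec (E u v)) → ℕ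
  nonedges E? = sum (λ u → # (λ v → ¬? (E? u v)))

  module Step {E : Fin n → Fin n → Set} (E? : ∀ u v → Dec (E u v)) (E-sym : ∀ {u v} → E u v → E v u)
              (E-irrefl : ∀ {v} → ¬ E v v) (G⊆E : ∀ {u v} → Adj u v → E u v) where

    d : Fin n → ℕ
    d v = # (E? v)

    deg≤d : ∀ v → deg v ≤ d v
    deg≤d v = #-mono (Adj? v) (E? v) (λ _ → G⊆E)

    NonNeighbour : Fin n → Fin n → Set
    NonNeighbour v u = ¬ Small u × v ≢ u × ¬ E v u

    NonNeighbour? : ∀ v u → Dec (NonNeighbour v u)
    NonNeighbour? v u = ¬? (Small? u) ×-dec ¬? (v ≟ u) ×-dec ¬? (E? v u)

    Incomplete : Fin n → Set
    Incomplete v = ¬ Small v × ∃ (NonNeighbour v)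

    Incomplete? : ∀ v → Dec (Incomplete v)
    Incomplete? v = ¬? (Small? v) ×-dec any? (NonNeighbour? v)

    NewPair : Set
    NewPair = ∃[ u ] ∃[ v ] ((¬ Small u × NonNeighbour u v) × n ≤ d u + d v)

    newPair? : Dec NewPair
    newPair? = any? λ u → any? λ v → (¬? (Small? u) ×-dec NonNeighbour? u v) ×-dec (n ≤? d u + d v)

    -- With h = d u < n - d v, the vertex `v` has at least h non-neighbours other than itself, all
    -- of degree at most h by the choice of `u` or by being small. Every vertex of degree at least n
    -- - h must be adjacent to `u`, or it would form a new pair; so there are at most h of them. As
    -- `u` is not small, k ≤ 2h, and `chvatal` applies to the degrees in G, which do not exceed
    -- those in `E`.
    extremal-pair : ¬ NewPair → ∀ {u v} → ¬ Small v → NonNeighbour v u → d u ≤ d v →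
                    (∀ w → NonNeighbour v w → d w ≤ d u) → ⊥
    extremal-pair none {u} {v} Kv (Ku , v≢u , ¬vu) du≤dv mx = chvatal low high
      where
      h : ℕ
      h = d u
      sum<n : d v + d u < n
      sum<n = ≰⇒> (λ le → none (v , u , (Kv , Ku , v≢u , ¬vu) , le))
      double : ∀ h → h + h ≡ 2 * h
      double = solve-∀
      k≤2h : k ≤ 2 * h
      k≤2h = ≤-trans (≤-pred (≤-trans (≰⇒> Ku) (≤-reflexive (+-comm (deg u + deg u) 1))))
               (≤-trans (+-mono-≤ (deg≤d u) (deg≤d u)) (≤-reflexive (double h)))
      2h<n : 2 * h < n
      2h<n = ≤-trans (s≤s (≤-trans (≤-reflexive (≡-sym (double h))) (+-monoˡ-≤ h du≤dv))) sum<n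
      open Chvatal 2n≤3k h k≤2h 2h<n using (Low?; High?; chvatal)
      small-low : ∀ {w} → Small w → deg w ≤ h
      small-low {w} s = *-cancelˡ-≤ 2 (≤-trans (≤-reflexive (≡-sym (double (deg w)))) (≤-trans (m≤m+n _ 1) (≤-trans s k≤2h)))
      low : h ≤ # Low?
      low = +-cancelʳ-≤ (suc (d v)) h (# Low?) (≤-trans (≤-reflexive (trans (+-suc h (d v)) (cong suc (+-comm h (d v)))))
        (≤-trans sum<n (≤-trans (≤-reflexive (trans (≡-sym (#-¬ (E? v))) (trans (cong (d v +_) (#-remove (λ w → ¬? (E? v w)) v E-irrefl)) (i (d v) (# far?)))))
          (+-monoˡ-≤ (suc (d v)) (#-mono far? Low? far-low)))))
        where
        far? : ∀ w → Dec (¬ E v w × w ≢ v)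
        far? w = ¬? (E? v w) ×-dec ¬? (w ≟ v)
        i : ∀ a b → a + suc b ≡ b + suc a
        i = solve-∀
        far-low : ∀ w → ¬ E v w × w ≢ v → deg w ≤ h
        far-low w (¬e , ne) with Small? w
        ... | yes s = small-low s
        ... | no Kw = ≤-trans (deg≤d w) (mx w (Kw , ≢-sym ne , ¬e))
      not-high : ∀ {w} → deg w ≤ h → ¬ (n ≤ deg w + h)
      not-high le hi = 1+n≰n (≤-trans 2h<n (≤-trans hi (≤-trans (+-monoˡ-≤ h le) (≤-reflexive (double h)))))
      high : # High? ≤ h
      high = #-mono High? (E? u) (λ w hi → decidable-stable (E? u w) (λ ¬e → none (u , w ,
        (Ku , (λ s → not-high (small-low s) hi) , (λ { refl → 1+n≰n (≤-trans 2h<n (≤-trans hi (≤-trans (+-monoˡ-≤ h (deg≤d u)) (≤-reflexive (double h))))) }) , ¬e) ,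
        ≤-trans hi (≤-trans (≤-reflexive (+-comm (deg w) h)) (+-monoʳ-≤ h (deg≤d w))))))

    -- A vertex `v₁` of largest degree in `E` among the incomplete ones and its non-neighbour `u₁`
    -- of largest degree form an extremal pair; `u₁` is incomplete too, whence d u₁ ≤ d v₁.
    complete : ¬ NewPair → ∀ {u v} → ¬ Small u → ¬ Small v → u ≢ v → E u v
    complete none {u} {v} Ku Kv u≢v = decidable-stable (E? u v) (λ ¬e → go ¬e (argmax Incomplete? d))
      where
      go : ¬ E u v → (∀ v → ¬ Incomplete v) ⊎ (∃[ v ] (Incomplete v × ∀ w → Incomplete w → d w ≤ d v)) → ⊥
      go ¬e (inj₁ all) = all u (Ku , v , Kv , u≢v , ¬e)
      go ¬e (inj₂ (v₁ , (Kv₁ , w , nn) , mx₁)) = go′ (argmax (NonNeighbour? v₁) d)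
        where
        go′ : (∀ w → ¬ NonNeighbour v₁ w) ⊎ (∃[ u ] (NonNeighbour v₁ u × ∀ w → NonNeighbour v₁ w → d w ≤ d u)) → ⊥
        go′ (inj₁ all) = all w nn
        go′ (inj₂ (u₁ , p@(Ku₁ , ne , ¬e′) , mx)) = extremal-pair none Kv₁ p (mx₁ u₁ (Ku₁ , v₁ , Kv₁ , ≢-sym ne , ¬e′ ∘ E-sym)) mx

    Extended : Fin n → Fin n → Fin n → Fin n → Set
    Extended a b u v = E u v ⊎ Joins a b u v

    Extended? : ∀ a b u v → Dec (Extended a b u v)
    Extended? a b u v = E? u v ⊎-dec (((u ≟ a) ×-dec (v ≟ b)) ⊎-dec ((u ≟ b) ×-dec (v ≟ a)))

    Extended-sym : ∀ {a b u v} → Extended a b u v → Extended a b v u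
    Extended-sym (inj₁ e)              = inj₁ (E-sym e)
    Extended-sym (inj₂ (inj₁ (p , q))) = inj₂ (inj₂ (q , p))
    Extended-sym (inj₂ (inj₂ (p , q))) = inj₂ (inj₁ (q , p))

    Extended-irrefl : ∀ {a b} → a ≢ b → ∀ {v} → ¬ Extended a b v v
    Extended-irrefl ne (inj₁ e)                    = E-irrefl e
    Extended-irrefl ne (inj₂ (inj₁ (refl , refl))) = ne refl
    Extended-irrefl ne (inj₂ (inj₂ (refl , refl))) = ne refl

    fewer-nonedges : ∀ {a b} → ¬ E a b → suc (nonedges (Extended? a b)) ≤ nonedges E?
    fewer-nonedges {a} {b} ¬e = sum-strict a
      (λ u → #-mono (λ v → ¬? (Extended? a b u v)) (λ v → ¬? (E? u v)) (λ v → _∘ inj₁))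
      (≤-trans (s≤s (#-mono (λ v → ¬? (Extended? a b a v)) (λ v → ¬? (E? a v) ×-dec ¬? (v ≟ b))
         (λ v h → h ∘ inj₁ , λ { refl → h (inj₂ (inj₁ (refl , refl))) })))
       (≤-reflexive (≡-sym (#-remove (λ v → ¬? (E? a v)) b ¬e))))

  -- Edges are added while a new pair exists, and the cycle found at the end is carried back through
  -- them by `remove-edge`. The fuel counts ordered non-adjacent pairs.
  closure : ∀ fuel {E : Fin n → Fin n → Set} (E? : ∀ u v → Dec (E u v)) → (∀ {u v} → E u v → E v u) →
            (∀ {v} → ¬ E v v) → (∀ {u v} → Adj u v → E u v) → nonedges E? ≤ fuel → HamiltonianCycle E
  closure fuel {E} E? E-sym E-irrefl G⊆E le = go newPair? fuel le
    where
    open Step E? E-sym E-irrefl G⊆E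
    go : Dec NewPair → ∀ fuel → nonedges E? ≤ fuel → HamiltonianCycle E
    go (no none) _ _ = Blocks.hamiltonianCycle 3≤n E-sym Small? partner (λ b s → G⊆E (partner-adj b s)) partner-∉ partner-inj (complete none)
    go (yes (a , b , (_ , _ , a≢b , ¬e) , deg-sum)) (suc fuel) le = BondyChvatal.remove-edge 3≤n E? E-sym E-irrefl id deg-sum
      (closure fuel (Extended? a b) Extended-sym (Extended-irrefl a≢b) (inj₁ ∘ G⊆E) (≤-pred (≤-trans (fewer-nonedges ¬e) le)))
    go (yes (a , b , (_ , _ , _ , ¬e) , _)) zero le with ≤-trans (fewer-nonedges ¬e) le
    ... | ()

  hamiltonianCycle : HamiltonianCycle Adj
  hamiltonianCycle = closure _ Adj? Adj-sym Adj-irrefl id ≤-refl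

-- Criticality supplies the colourings of G - xy

T-does⁻ : {P : Set} (d : Dec P) → T (does d) → P
T-does⁻ (yes p) _ = p

T-does⁺ : {P : Set} (d : Dec P) → P → T (does d)
T-does⁺ (yes _) _ = _
T-does⁺ (no ¬p) p = ¬p p

module CriticalGraph {n} (G : Graph n) (k : ℕ) (critical : EdgeCritical G k) where

  uncolourable : ¬ ColourableWith (adj G) k
  uncolourable = proj₂ (proj₁ (proj₂ critical)) k ≤-refl

  open Degrees G k uncolourable

  Joins? : ∀ (x y u v : Vertex) → Dec (Joins x y u v)
  Joins? x y u v = ((u ≟ x) ×-dec (v ≟ y)) ⊎-dec ((u ≟ y) ×-dec (v ≟ x))

  kept? : ∀ x y u v → Dec (Adj u v × ¬ Joins x y u v)
  kept? x y u v = Adj? u v ×-dec ¬? (Joins? x y u v)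

  kept-sym : ∀ {x y u v} → Adj u v × ¬ Joins x y u v → Adj v u × ¬ Joins x y v u
  kept-sym (a , ne) = Adj-sym a , λ j → ne (swapped j)
    where
    swapped : ∀ {x y u v} → Joins x y u v → Joins x y v u
    swapped (inj₁ (p , q)) = inj₂ (q , p)
    swapped (inj₂ (p , q)) = inj₁ (q , p)

  without : Vertex → Vertex → Subgraph G
  without x y = record
    { vert = λ _ → true
    ; edge = λ u v → does (kept? x y u v)
    ; esym = λ u v → does-⇔ (mk⇔ kept-sym kept-sym) (kept? x y u v) (kept? x y v u)
    ; e⊆G  = λ u v e → proj₁ (T-does⁻ (kept? x y u v) e)
    ; e⊆V  = λ _ _ _ → _ }

  state : ∀ {x y} → Adj x y → State x y
  state {x} {y} xy = record
    { M = M′ ; invol = involutive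
    ; edge-of = λ κ v ne → proj₁ (kept (neighbour κ v ne))
    ; proper = λ κ μ v e ne → same (neighbour κ v ne) (subst (Along μ v) (≡-sym e) (neighbour μ v (λ f → ne (trans e f))))
    ; covers = λ u v a nj → let e = T-does⁺ (kept? x y u v) (a , nj) in c u v e , M-unique (e , refl)
    ; uncoloured = λ κ e → proj₂ (kept (subst (Along κ x) e (neighbour κ x (λ f → Adj-irrefl (subst (Adj x) (trans (≡-sym e) f) xy)))))
                             (inj₁ (refl , refl))
    ; adjacent = xy }
    where
    xy-missing : edge (without x y) x y ≡ false
    xy-missing = dec-false (kept? x y x y) (λ (_ , ne) → ne (inj₁ (refl , refl)))
    colouring : ColourableWith (edge (without x y)) k
    colouring = proj₂ (proj₂ critical) (without x y) (inj₂ (x , y , xy , xy-missing))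
    c : ∀ u v → T (edge (without x y) u v) → Colour
    c = proj₁ colouring
    Along : Colour → Vertex → Vertex → Set
    Along κ v w = ∃[ e ] (c v w e ≡ κ)
    Along? : ∀ κ v w → Dec (Along κ v w)
    Along? κ v w with T? (edge (without x y) v w)
    ... | no ne = no (ne ∘ proj₁)
    ... | yes e with c v w e ≟ κ
    ...   | yes p = yes (e , p)
    ...   | no np = no (λ (e′ , p) → np (trans (cong (c v w) (T-irrelevant e e′)) p))
    kept : ∀ {κ v w} → Along κ v w → Adj v w × ¬ Joins x y v w
    kept {v = v} {w} (e , _) = T-does⁻ (kept? x y v w) e
    same : ∀ {κ μ v w} → Along κ v w → Along μ v w → κ ≡ μ
    same {v = v} {w} (e , p) (e′ , q) = trans (≡-sym p) (trans (cong (c v w) (T-irrelevant e e′)) q)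
    Along-sym : ∀ {κ v w} → Along κ v w → Along κ w v
    Along-sym {v = v} {w} (e , p) = e′ , trans (≡-sym (proj₁ (proj₂ colouring) v w e e′)) p
      where
      e′ : T (edge (without x y) w v)
      e′ = subst T (esym (without x y) v w) e
    Along-unique : ∀ {κ v w w′} → Along κ v w → Along κ v w′ → w ≡ w′
    Along-unique {v = v} {w} {w′} (e , p) (e′ , q) = decidable-stable (w ≟ w′) (λ ne → proj₂ (proj₂ colouring) v w w′ e e′ ne (trans p (≡-sym q)))
    pick : ∀ {κ v} → Dec (∃ (Along κ v)) → Vertex
    pick (yes (w , _)) = w
    -- The fixed point encodes that the colour is missing at `v`.
    pick {v = v} (no _) = v
    M′ : Colour → Vertex → Vertex
    M′ κ v = pick (any? (Along? κ v))
    M-unique : ∀ {κ v w} → Along κ v w → M′ κ v ≡ w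
    M-unique {κ} {v} a with any? (Along? κ v)
    ... | yes (_ , b) = Along-unique b a
    ... | no none     = contradiction (_ , a) none
    neighbour : ∀ κ v → M′ κ v ≢ v → Along κ v (M′ κ v)
    neighbour κ v ne with any? (Along? κ v)
    ... | yes (_ , b) = b
    ... | no _        = contradiction refl ne
    involutive : ∀ κ v → M′ κ (M′ κ v) ≡ v
    involutive κ v with M′ κ v ≟ v
    ... | yes e = trans (cong (M′ κ) e) e
    ... | no ne = M-unique (Along-sym (neighbour κ v ne))

  deg≤k : ∀ v → deg v ≤ k
  deg≤k v = ≤-trans (≤-reflexive (#-T (adj G v))) (proj₁ (proj₁ critical) v)

  -- Removing an isolated vertex leaves a proper subgraph with all the edges, which criticality
  -- would colour with k colours.
  deg>0 : ∀ v → 1 ≤ deg v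
  deg>0 v with 1 ≤? deg v
  ... | yes le = le
  ... | no nle = contradiction (proj₂ (proj₂ critical) isolated-removed (inj₁ (v , v-missing))) uncolourable
    where
    isolated : ∀ w → ¬ Adj v w
    isolated w a = nle (≤-trans (s≤s z≤n) (≤-reflexive (≡-sym (#-remove (Adj? v) w a))))
    isolated-removed : Subgraph G
    isolated-removed = record
      { vert = λ w → does (¬? (w ≟ v))
      ; edge = adj G
      ; esym = Graph.sym G
      ; e⊆G  = λ _ _ → id
      ; e⊆V  = λ u w a → T-does⁺ (¬? (u ≟ v)) (λ { refl → isolated w a }) }
    v-missing : does (¬? (v ≟ v)) ≡ false
    v-missing = dec-false (¬? (v ≟ v)) (λ ne → ne refl)

  36≤n : 2 * n + 36 ≤ 3 * k → 36 ≤ n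
  36≤n le = +-cancelˡ-≤ (2 * n) _ _ (≤-trans le (≤-trans (*-monoʳ-≤ 3 k≤n) (≤-reflexive (i n))))
    where
    i : ∀ n → 3 * n ≡ 2 * n + n
    i = solve-∀
    k≤n : k ≤ n
    k≤n = let (v , e) = proj₂ (proj₁ critical) in
      ≤-trans (≤-reflexive (trans (≡-sym e) (≡-sym (#-T (adj G v))))) (#-≤ (Adj? v))

theorem1 : ∀ (n : ℕ) (G : Graph n) (Δ : ℕ) →
    EdgeCritical G Δ → 2 * n + 36 ≤ 3 * Δ → Hamiltonian G
theorem1 n G Δ critical le = hamiltonian G 3≤n
    (Closure.hamiltonianCycle G Δ uncolourable deg≤k state deg>0 le 3≤n)
  where
  open CriticalGraph G Δ critical
  3≤n : 3 ≤ n
  3≤n = ≤-trans (m≤n+m 3 33) (36≤n le)
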